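{- Let $\Gamma$ be either $\operatorname{SL}_2(\mathbb Z)$ or $\operatorname{PSL}_2(\mathbb Z)$, and let $d\in\Gamma$. If $d$ is a commutator in the profinite completion $\widehat{\Gamma}$ (i.e. $d=xyx^{ -1}y^{ -1}$ for some $x,y\in\widehat{\Gamma}$), then $d$ is a commutator in $\Gamma$ (i.e. $d=XYX^{ -1}Y^{ -1}$ for some $X,Y\in\Gamma$).
   Context: $\Gamma$ is residually finite, so it is naturally a subgroup of its profinite completion $\widehat{\Gamma}$. -}

module Defs where

open import Level using (0ℓ) renaming (suc to lsuc)
open import Algebra.Bundles using (Group)
open import Data.Integer using (ℤ; _+_; _*_; -_; _-_; 1ℤ; 0ℤ)
open import Data.Integer.Properties using (neg-involutive)
open import Data.Integer.Tactic.RingSolver using (solve-∀)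
open import Data.Product using (Σ; _×_; _,_; ∃; ∃-syntax)
open import Data.Sum using (_⊎_; inj₁; inj₂)
open import Data.List using (List)
open import Data.List.Relation.Unary.Any using (Any)
open import Relation.Binary.PropositionalEquality
  using (_≡_; refl; sym; trans; cong; cong₂; isEquivalence)

record M2 : Set where
  constructor mat
  field
    a b c d : ℤ

open M2

det : M2 → ℤ
det (mat a b c d) = a * d - b * c

_⊗_ : M2 → M2 → M2
mat a b c d ⊗ mat e f g h = mat (a * e + b * g) (a * f + b * h) (c * e + d * g) (c * f + d * h)

adj : M2 → M2
adj (mat a b c d) = mat d (- b) (- c) a

neg : M2 → M2
neg (mat a b c d) = mat (- a) (- b) (- c) (- d)

I2 : M2
I2 = mat 1ℤ 0ℤ 0ℤ 1ℤ

private
  cong₄ : ∀ {a b c d a' b' c' d'} → a ≡ a' → b ≡ b' → c ≡ c' → d ≡ d' →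
          mat a b c d ≡ mat a' b' c' d'
  cong₄ refl refl refl refl = refl

  detMul : ∀ a b c d e f g h →
    (a * e + b * g) * (c * f + d * h) - (a * f + b * h) * (c * e + d * g)
      ≡ (a * d - b * c) * (e * h - f * g)
  detMul = solve-∀

  detAdj : ∀ a b c d → d * a - (- b) * (- c) ≡ a * d - b * c
  detAdj = solve-∀

  mulAssoc1 : ∀ a b c d e f g h i j k l →
    (a * e + b * g) * i + (a * f + b * h) * k ≡ a * (e * i + f * k) + b * (g * i + h * k)
  mulAssoc1 = solve-∀

  idL : ∀ a b → 1ℤ * a + 0ℤ * b ≡ a
  idL = solve-∀
  idL' : ∀ a b → 0ℤ * a + 1ℤ * b ≡ b
  idL' = solve-∀
  idR : ∀ a b → a * 1ℤ + b * 0ℤ ≡ a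
  idR = solve-∀
  idR' : ∀ a b → a * 0ℤ + b * 1ℤ ≡ b
  idR' = solve-∀

  invL1 : ∀ a b c d → d * a + (- b) * c ≡ a * d - b * c
  invL1 = solve-∀
  invL2 : ∀ a b c d → d * b + (- b) * d ≡ 0ℤ
  invL2 = solve-∀
  invL3 : ∀ a b c d → (- c) * a + a * c ≡ 0ℤ
  invL3 = solve-∀
  invL4 : ∀ a b c d → (- c) * b + a * d ≡ a * d - b * c
  invL4 = solve-∀
  invR1 : ∀ a b c d → a * d + b * (- c) ≡ a * d - b * c
  invR1 = solve-∀
  invR2 : ∀ a b c d → a * (- b) + b * a ≡ 0ℤ
  invR2 = solve-∀
  invR3 : ∀ a b c d → c * d + d * (- c) ≡ 0ℤ
  invR3 = solve-∀
  invR4 : ∀ a b c d → c * (- b) + d * a ≡ a * d - b * c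
  invR4 = solve-∀

  negL : ∀ a b e g → (- a) * e + (- b) * g ≡ - (a * e + b * g)
  negL = solve-∀
  negR : ∀ a b e g → a * (- e) + b * (- g) ≡ - (a * e + b * g)
  negR = solve-∀
  negLR : ∀ a b e g → (- a) * (- e) + (- b) * (- g) ≡ a * e + b * g
  negLR = solve-∀

record SL2 : Set where
  constructor sl
  field
    m   : M2
    det1 : det m ≡ 1ℤ

open SL2

_·_ : SL2 → SL2 → SL2
sl (mat a b c d) p · sl (mat e f g h) q =
  sl (mat a b c d ⊗ mat e f g h)
     (trans (detMul a b c d e f g h) (trans (cong₂ _*_ p q) refl))

inv : SL2 → SL2
inv (sl (mat a b c d) p) = sl (mat d (- b) (- c) a) (trans (detAdj a b c d) p)

one : SL2
one = sl I2 refl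

_≈SL_ : SL2 → SL2 → Set
x ≈SL y = m x ≡ m y

private
  ·-assocM : ∀ x y z → m ((x · y) · z) ≡ m (x · (y · z))
  ·-assocM (sl (mat a b c d) _) (sl (mat e f g h) _) (sl (mat i j k l) _) =
    cong₄ (mulAssoc1 a b c d e f g h i j k l) (mulAssoc1 a b c d e f g h j i l k)
          (mulAssoc1 c d a b e f g h i j k l) (mulAssoc1 c d a b e f g h j i l k)

  idLM : ∀ x → m (one · x) ≡ m x
  idLM (sl (mat a b c d) _) = cong₄ (idL a c) (idL b d) (idL' a c) (idL' b d)

  idRM : ∀ x → m (x · one) ≡ m x
  idRM (sl (mat a b c d) _) = cong₄ (idR a b) (idR' a b) (idR c d) (idR' c d)

  invLM : ∀ x → m (inv x · x) ≡ m one
  invLM (sl (mat a b c d) p) =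
    cong₄ (trans (invL1 a b c d) p) (invL2 a b c d) (invL3 a b c d) (trans (invL4 a b c d) p)

  invRM : ∀ x → m (x · inv x) ≡ m one
  invRM (sl (mat a b c d) p) =
    cong₄ (trans (invR1 a b c d) p) (invR2 a b c d) (invR3 a b c d) (trans (invR4 a b c d) p)

  ·-congM : ∀ {x x' y y'} → m x ≡ m x' → m y ≡ m y' → m (x · y) ≡ m (x' · y')
  ·-congM {sl (mat a b c d) _} {sl (mat _ _ _ _) _} {sl (mat e f g h) _} {sl (mat _ _ _ _) _} refl refl = refl

  inv-congM : ∀ {x y} → m x ≡ m y → m (inv x) ≡ m (inv y)
  inv-congM {sl (mat a b c d) _} {sl (mat _ _ _ _) _} refl = refl

SL₂ℤ : Group 0ℓ 0ℓ
SL₂ℤ = record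
  { Carrier = SL2
  ; _≈_ = _≈SL_
  ; _∙_ = _·_
  ; ε = one
  ; _⁻¹ = inv
  ; isGroup = record
    { isMonoid = record
      { isSemigroup = record
        { isMagma = record
          { isEquivalence = record { refl = refl ; sym = sym ; trans = trans }
          ; ∙-cong = λ {x} {y} {u} {v} → ·-congM {x} {y} {u} {v} }
        ; assoc = ·-assocM }
      ; identity = idLM , idRM }
    ; inverse = invLM , invRM
    ; ⁻¹-cong = λ {x} {y} → inv-congM {x} {y} }
  }

_≈PSL_ : SL2 → SL2 → Set
x ≈PSL y = (m x ≡ m y) ⊎ (m x ≡ neg (m y))

private
  negnegM : ∀ A → neg (neg A) ≡ A
  negnegM (mat a b c d) = cong₄ (neg-involutive a) (neg-involutive b) (neg-involutive c) (neg-involutive d)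

  psl-sym : ∀ {x y} → x ≈PSL y → y ≈PSL x
  psl-sym (inj₁ p) = inj₁ (sym p)
  psl-sym {x} {y} (inj₂ p) = inj₂ (trans (sym (negnegM (m y))) (cong neg (sym p)))

  psl-trans : ∀ {x y z} → x ≈PSL y → y ≈PSL z → x ≈PSL z
  psl-trans (inj₁ p) (inj₁ q) = inj₁ (trans p q)
  psl-trans (inj₁ p) (inj₂ q) = inj₂ (trans p q)
  psl-trans (inj₂ p) (inj₁ q) = inj₂ (trans p (cong neg q))
  psl-trans {z = z} (inj₂ p) (inj₂ q) = inj₁ (trans p (trans (cong neg q) (negnegM (m z))))

  negLM : ∀ A B → neg A ⊗ B ≡ neg (A ⊗ B)
  negLM (mat a b c d) (mat e f g h) = cong₄ (negL a b e g) (negL a b f h) (negL c d e g) (negL c d f h)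

  negRM : ∀ A B → A ⊗ neg B ≡ neg (A ⊗ B)
  negRM (mat a b c d) (mat e f g h) = cong₄ (negR a b e g) (negR a b f h) (negR c d e g) (negR c d f h)

  negLRM : ∀ A B → neg A ⊗ neg B ≡ A ⊗ B
  negLRM (mat a b c d) (mat e f g h) = cong₄ (negLR a b e g) (negLR a b f h) (negLR c d e g) (negLR c d f h)

  mul-m : ∀ x y → m (x · y) ≡ m x ⊗ m y
  mul-m (sl (mat a b c d) _) (sl (mat e f g h) _) = refl

  psl-cong : ∀ {x x' y y'} → x ≈PSL x' → y ≈PSL y' → (x · y) ≈PSL (x' · y')
  psl-cong {x} {x'} {y} {y'} (inj₁ p) (inj₁ q) = inj₁ (·-congM {x} {x'} {y} {y'} p q)
  psl-cong {x} {x'} {y} {y'} (inj₁ p) (inj₂ q) =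
    inj₂ (trans (mul-m x y) (trans (cong₂ _⊗_ p q) (trans (negRM (m x') (m y')) (cong neg (sym (mul-m x' y'))))))
  psl-cong {x} {x'} {y} {y'} (inj₂ p) (inj₁ q) =
    inj₂ (trans (mul-m x y) (trans (cong₂ _⊗_ p q) (trans (negLM (m x') (m y')) (cong neg (sym (mul-m x' y'))))))
  psl-cong {x} {x'} {y} {y'} (inj₂ p) (inj₂ q) =
    inj₁ (trans (mul-m x y) (trans (cong₂ _⊗_ p q) (trans (negLRM (m x') (m y')) (sym (mul-m x' y')))))

  inv-m : ∀ x → m (inv x) ≡ adj (m x)
  inv-m (sl (mat a b c d) _) = refl

  psl-inv-cong : ∀ {x y} → x ≈PSL y → inv x ≈PSL inv y
  psl-inv-cong {x} {y} (inj₁ p) = inj₁ (inv-congM {x} {y} p)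
  psl-inv-cong {x} {y} (inj₂ p) =
    inj₂ (trans (inv-m x) (trans (cong adj p) (helper (m y) (inv-m y))))
    where
      helper : ∀ A → m (inv y) ≡ adj A → adj (neg A) ≡ neg (m (inv y))
      helper (mat a b c d) q = cong neg (sym q)

PSL₂ℤ : Group 0ℓ 0ℓ
PSL₂ℤ = record
  { Carrier = SL2
  ; _≈_ = _≈PSL_
  ; _∙_ = _·_
  ; ε = one
  ; _⁻¹ = inv
  ; isGroup = record
    { isMonoid = record
      { isSemigroup = record
        { isMagma = record
          { isEquivalence = record { refl = inj₁ refl ; sym = λ {x} {y} → psl-sym {x} {y} ; trans = λ {x} {y} {z} → psl-trans {x} {y} {z} }
          ; ∙-cong = λ {x} {y} {u} {v} → psl-cong {x} {y} {u} {v} }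
        ; assoc = λ x y z → inj₁ (·-assocM x y z) }
      ; identity = (λ x → inj₁ (idLM x)) , (λ x → inj₁ (idRM x)) }
    ; inverse = (λ x → inj₁ (invLM x)) , (λ x → inj₁ (invRM x))
    ; ⁻¹-cong = λ {x} {y} → psl-inv-cong {x} {y} }
  }

-- Profinite completion of a group G, as the inverse limit of the finite
-- quotients G/N over the finite-index normal subgroups N of G.

module Profinite (G : Group 0ℓ 0ℓ) where
  open Group G

  record FINormal : Set₁ where
    field
      mem      : Carrier → Set
      mem-resp : ∀ {x y} → x ≈ y → mem x → mem y
      mem-ε    : mem ε
      mem-∙    : ∀ {x y} → mem x → mem y → mem (x ∙ y)
      mem-⁻¹   : ∀ {x} → mem x → mem (x ⁻¹)
      normal   : ∀ g {x} → mem x → mem (g ∙ x ∙ g ⁻¹)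
      reps     : List Carrier
      covers   : ∀ g → Any (λ r → mem (r ⁻¹ ∙ g)) reps

  open FINormal public

  _≡[_]_ : Carrier → FINormal → Carrier → Set
  x ≡[ N ] y = mem N (x ⁻¹ ∙ y)

  _⊆N_ : FINormal → FINormal → Set
  N ⊆N M = ∀ x → mem N x → mem M x

  -- an element of Ĝ = lim← G/N : a compatible family of cosets, each coset
  -- given by a representative
  record Ĝ : Set₁ where
    field
      at     : FINormal → Carrier
      compat : ∀ N M → N ⊆N M → at N ≡[ M ] at M

  open Ĝ public

  ι : Carrier → Ĝ
  ι g = record { at = λ _ → g ; compat = λ N M _ → mem-resp M (Group.sym G (inverseˡ g)) (mem-ε M) }

  _≈̂_ : Ĝ → Ĝ → Set₁
  x ≈̂ y = ∀ N → at x N ≡[ N ] at y N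

  -- d ∈ G is a commutator in Ĝ: ι d = x y x⁻¹ y⁻¹ for some x, y ∈ Ĝ
  -- (the group operations of Ĝ being componentwise, this equality says
  -- that in every finite quotient G/N, d ≡ x_N y_N x_N⁻¹ y_N⁻¹)
  IsCommutatorĜ : Carrier → Set₁
  IsCommutatorĜ d = Σ Ĝ λ x → Σ Ĝ λ y →
    ∀ N → at (ι d) N ≡[ N ] (at x N ∙ at y N ∙ at x N ⁻¹ ∙ at y N ⁻¹)

  IsCommutator : Carrier → Set
  IsCommutator d = Σ Carrier λ X → Σ Carrier λ Y → d ≈ X ∙ Y ∙ X ⁻¹ ∙ Y ⁻¹

{-# OPTIONS --safe #-}
module Submission where

-- Modulo ±1 the group is Γ = ⟨S, U | S² = U³ = 1⟩, and up to conjugation d is a power of U, or S, or a cyclic word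
-- W = S U^±1 ⋯ S U^±1; the sign is recovered from the character of SL₂(ℤ) with values in ℤ/4. Choose a
-- representation ρ of Γ by integral matrices for which the trace of such a word grows so fast that q = |2 − tr ρ(W)|
-- divides no 2 − tr ρ(W') with W' shorter than W. Suppose that d is the commutator of x and y in a finite quotient
-- through which ρ mod q factors, and let L be the group of the g for which ρ(g) lies, modulo q, in the algebra B
-- spanned by 1, ρ(x), ρ(y), ρ(xy). Every XY − YX with X, Y in B is a multiple of ρ(x)ρ(y) − ρ(y)ρ(x), whose
-- determinant ±(2 − tr ρ([x, y])) vanishes modulo q; hence all commutators of L have trace 2 modulo q, and none of
-- them is conjugate to a word shorter than W.
-- A fine enough quotient also forces the closed path read by d in the coset graph of L to be null-homologous, so that
-- every crossing of an edge is matched by a crossing in the opposite direction. Two linked pairs of matched crossings,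
-- or a matched pair around a single fixed point of U, allow a surgery that writes the path as a commutator of L times
-- a shorter null-homologous path. A shortest nontrivial null-homologous path is therefore a commutator of L, hence not
-- shorter than W, so the surgery applied to W leaves nothing but a commutator.

open import Defs
open import Data.Product using (_×_)
open import Algebra.Bundles using (Group)
open import Data.Bool.Base using (Bool; true; false; _xor_)
open import Data.Empty using (⊥; ⊥-elim)
open import Data.Fin.Base using (Fin; toℕ; fromℕ<; combine; remQuot; funToFin; finToFun)
open import Data.Fin.Properties using (any?; pigeonhole; toℕ<n; toℕ-fromℕ<; combine-injective; remQuot-combine; finToFun-funToFin)
open import Data.Integer.Base as ℤ using (ℤ; +_; -[1+_]; _+_; _*_; -_; _-_; 0ℤ; 1ℤ; ∣_∣)
open import Data.Integer.DivMod using (_/_; _%_; n%d<d; a≡a%n+[a/n]*n; _%ℕ_; _/ℕ_; n%ℕd<d; a≡a%ℕn+[a/ℕn]*n)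
open import Data.Integer.Divisibility.Signed using (_∣_; divides; _∣?_; ∣⇒∣ᵤ; ∣m∣∣m; ∣m∣n⇒∣m+n; ∣m⇒∣-m; ∣m⇒∣m*n; ∣n⇒∣m*n)
open import Data.Integer.Properties using (_≟_; neg-involutive; +-assoc; +-identityˡ; +-identityʳ; *-identityˡ; *-distribˡ-+; *-distribʳ-+; pos-+; pos-*; ∣-i∣≡∣i∣; ∣i*j∣≡∣i∣*∣j∣; ∣i-j∣≤∣i∣+∣j∣)
open import Data.Integer.Tactic.RingSolver using (solve-∀)
open import Data.List.Base using (List; []; _∷_; _++_; length; take; drop; map; _∷ʳ_; initLast; _∷ʳ′_)
open import Data.List.Membership.Propositional using (_∈_; lose)
open import Data.List.Membership.Propositional.Properties using (∈-map⁺; ∈-++⁺ˡ; ∈-++⁺ʳ)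
open import Data.List.Properties using (++-assoc; ++-identityʳ; length-++; length-take; length-drop; take++drop≡id; ∷-injective)
open import Data.List.Relation.Unary.Any as Any using (Any)
open import Data.Nat.Base as ℕ using (ℕ; zero; suc; s≤s; z≤n; NonZero)
open import Data.Nat.Divisibility using (∣⇒≤)
open import Data.Nat.Induction using (<-wellFounded)
import Data.Nat.Properties as ℕₚ
import Data.Nat.Tactic.RingSolver as ℕ-Solver
open import Data.Product.Base using (∃; _,_; proj₁; proj₂)
open import Data.Sum.Base using (_⊎_; inj₁; inj₂)
open import Induction.WellFounded using (Acc; acc)
open import Relation.Binary.PropositionalEquality
open import Relation.Nullary using (¬_; Dec; yes; no)
open import Relation.Nullary.Decidable using (map′; _×-dec_; _⊎-dec_)

-- The witnesses x and y depend on the finite quotient, so the quotient has to be fixed from d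
-- alone, before L exists. It therefore records the sums of all weights on the Cayley graph of the
-- image of ρ modulo q that behave like cocycles modulo a number M; once x and y are given, the
-- L-invariant weights are found among them. L itself is defined by a condition modulo q, so it
-- contains d, which is only congruent to a word in x and y.
--
-- The tautological representation would not do for ρ: the powers of S U all have trace ±2 there, so
-- the trace says nothing about the number of turns. The family used here has a free parameter, and
-- the traces of words with k turns lie between 2 b^k and 2 (6 b)^k, windows that a large b
-- separates.
--
-- Homology is seen only modulo M. Signed crossings are counted by numbers not exceeding the length
-- of the word, so an M beyond this length loses nothing, and the factors 2 and 3 of M keep the
-- torsion of S and U visible.

-- Integral matrices.

mat-≡ : ∀ {p q r s p' q' r' s'} → p ≡ p' → q ≡ q' → r ≡ r' → s ≡ s' → mat p q r s ≡ mat p' q' r' s'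
mat-≡ refl refl refl refl = refl

⊗-assoc : ∀ A B C → (A ⊗ B) ⊗ C ≡ A ⊗ (B ⊗ C)
⊗-assoc (mat a b c d) (mat e f g h) (mat i j k l) =
  mat-≡ (entry a b e f g h i k) (entry a b e f g h j l) (entry c d e f g h i k) (entry c d e f g h j l)
  where
  entry : ∀ a b e f g h i k →
    (a * e + b * g) * i + (a * f + b * h) * k ≡ a * (e * i + f * k) + b * (g * i + h * k)
  entry = solve-∀

⊗-identityˡ : ∀ A → I2 ⊗ A ≡ A
⊗-identityˡ (mat a b c d) = mat-≡ (fst a c) (fst b d) (snd a c) (snd b d)
  where
  fst : ∀ p r → 1ℤ * p + 0ℤ * r ≡ p
  fst = solve-∀
  snd : ∀ p r → 0ℤ * p + 1ℤ * r ≡ r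
  snd = solve-∀

⊗-identityʳ : ∀ A → A ⊗ I2 ≡ A
⊗-identityʳ (mat a b c d) = mat-≡ (fst a b) (snd a b) (fst c d) (snd c d)
  where
  fst : ∀ p r → p * 1ℤ + r * 0ℤ ≡ p
  fst = solve-∀
  snd : ∀ p r → p * 0ℤ + r * 1ℤ ≡ r
  snd = solve-∀

neg-neg : ∀ A → neg (neg A) ≡ A
neg-neg (mat a b c d) = mat-≡ (neg-involutive a) (neg-involutive b) (neg-involutive c) (neg-involutive d)

neg-⊗ˡ : ∀ A B → neg A ⊗ B ≡ neg (A ⊗ B)
neg-⊗ˡ (mat a b c d) (mat e f g h) = mat-≡ (entry a b e g) (entry a b f h) (entry c d e g) (entry c d f h)
  where
  entry : ∀ a b e g → (- a) * e + (- b) * g ≡ - (a * e + b * g)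
  entry = solve-∀

-- Words in the generators and their matrices.

data Letter : Set where
  S U : Letter

Word : Set
Word = List Letter

actS actU : M2 → M2
actS (mat p q r s) = mat (- r) (- s) p q
actU (mat p q r s) = mat (- r) (- s) (p + r) (q + s)

-- S and U evaluate to [0 -1; 1 0] and [0 -1; 1 1], so that S U = -[1 1; 0 1] and S U U = -[1 0; 1 1].
mt : Word → M2
mt []      = I2
mt (S ∷ w) = actS (mt w)
mt (U ∷ w) = actU (mt w)

actS-⊗ : ∀ A B → actS A ⊗ B ≡ actS (A ⊗ B)
actS-⊗ (mat p q r s) (mat e f g h) = mat-≡ (entry r s e g) (entry r s f h) refl refl
  where
  entry : ∀ r s e g → (- r) * e + (- s) * g ≡ - (r * e + s * g)
  entry = solve-∀

actU-⊗ : ∀ A B → actU A ⊗ B ≡ actU (A ⊗ B)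
actU-⊗ (mat p q r s) (mat e f g h) = mat-≡ (top r s e g) (top r s f h) (bot p q r s e g) (bot p q r s f h)
  where
  top : ∀ r s e g → (- r) * e + (- s) * g ≡ - (r * e + s * g)
  top = solve-∀
  bot : ∀ p q r s e g → (p + r) * e + (q + s) * g ≡ (p * e + q * g) + (r * e + s * g)
  bot = solve-∀

mt-++ : ∀ v w → mt (v ++ w) ≡ mt v ⊗ mt w
mt-++ []      w = sym (⊗-identityˡ (mt w))
mt-++ (S ∷ v) w = trans (cong actS (mt-++ v w)) (sym (actS-⊗ (mt v) (mt w)))
mt-++ (U ∷ v) w = trans (cong actU (mt-++ v w)) (sym (actU-⊗ (mt v) (mt w)))

det-mt : ∀ w → det (mt w) ≡ 1ℤ
det-mt []      = refl
det-mt (S ∷ w) = trans (lemma (mt w)) (det-mt w)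
  where
  poly : ∀ p q r s → (- r) * q - (- s) * p ≡ p * s - q * r
  poly = solve-∀
  lemma : ∀ A → det (actS A) ≡ det A
  lemma (mat p q r s) = poly p q r s
det-mt (U ∷ w) = trans (lemma (mt w)) (det-mt w)
  where
  poly : ∀ p q r s → (- r) * (q + s) - (- s) * (p + r) ≡ p * s - q * r
  poly = solve-∀
  lemma : ∀ A → det (actU A) ≡ det A
  lemma (mat p q r s) = poly p q r s

sg : Bool → M2 → M2
sg false A = A
sg true  A = neg A

sg-sg : ∀ σ τ A → sg σ (sg τ A) ≡ sg (σ xor τ) A
sg-sg false τ     A = refl
sg-sg true  false A = refl
sg-sg true  true  A = neg-neg A

sg-⊗ˡ : ∀ σ A B → sg σ A ⊗ B ≡ sg σ (A ⊗ B)
sg-⊗ˡ false A B = refl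
sg-⊗ˡ true  A B = neg-⊗ˡ A B

sg-actS : ∀ σ A → actS (sg σ A) ≡ sg σ (actS A)
sg-actS false A = refl
sg-actS true (mat p q r s) = refl

sg-actU : ∀ σ A → actU (sg σ A) ≡ sg σ (actU A)
sg-actU false A = refl
sg-actU true (mat p q r s) = mat-≡ refl refl (entry p r) (entry q s)
  where
  entry : ∀ p r → - p + - r ≡ - (p + r)
  entry = solve-∀

neg≢ : ∀ A → det A ≡ 1ℤ → A ≢ neg A
neg≢ (mat p q r s) detA eq = contra (trans (sym detA) det≡0)
  where
  self-neg : ∀ i → i ≡ - i → i ≡ 0ℤ
  self-neg (+ zero) _ = refl
  self-neg (+ suc n) ()
  self-neg -[1+ n ] ()
  det≡0 : det (mat p q r s) ≡ 0ℤ
  det≡0 = trans (cong₂ (λ x y → x * s - y * r) (self-neg p (cong M2.a eq)) (self-neg q (cong M2.b eq))) refl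
  contra : 1ℤ ≢ 0ℤ
  contra ()

-- The presentation of the group by words.

-- R σ v w: the words v and w are equal modulo S² = U³ = -1, up to the sign σ.
data R : Bool → Word → Word → Set where
  R-refl  : ∀ {w} → R false w w
  R-sym   : ∀ {σ v w} → R σ v w → R σ w v
  R-trans : ∀ {σ τ u v w} → R σ u v → R τ v w → R (σ xor τ) u w
  R-cons  : ∀ {σ v w} l → R σ v w → R σ (l ∷ v) (l ∷ w)
  R-SS    : ∀ {w} → R true (S ∷ S ∷ w) w
  R-UUU   : ∀ {w} → R true (U ∷ U ∷ U ∷ w) w

R-sound : ∀ {σ v w} → R σ v w → mt v ≡ sg σ (mt w)
R-sound R-refl = refl
R-sound (R-sym {false} p) = sym (R-sound p)
R-sound (R-sym {true} {v} {w} p) = trans (sym (neg-neg (mt w))) (cong neg (sym (R-sound p)))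
R-sound (R-trans {σ} {τ} {w = w} p q) = trans (R-sound p) (trans (cong (sg σ) (R-sound q)) (sg-sg σ τ (mt w)))
R-sound (R-cons {σ} {v} {w} S p) = trans (cong actS (R-sound p)) (sg-actS σ (mt w))
R-sound (R-cons {σ} {v} {w} U p) = trans (cong actU (R-sound p)) (sg-actU σ (mt w))
R-sound (R-SS {w}) = refl
R-sound (R-UUU {w}) = lemma (mt w)
  where
  top : ∀ p r → - (- r + (p + r)) ≡ - p
  top = solve-∀
  bot : ∀ p r → - (p + r) + (- r + (p + r)) ≡ - r
  bot = solve-∀
  lemma : ∀ A → actU (actU (actU A)) ≡ neg A
  lemma (mat p q r s) = mat-≡ (top p r) (top q s) (bot p r) (bot q s)

infix 4 _∼_
-- With the sign forgotten this is equality in the free product of ℤ/2 and ℤ/3.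
_∼_ : Word → Word → Set
v ∼ w = ∃ λ σ → R σ v w

∼-refl : ∀ {w} → w ∼ w
∼-refl = false , R-refl

∼-reflexive : ∀ {v w} → v ≡ w → v ∼ w
∼-reflexive refl = ∼-refl

∼-sym : ∀ {v w} → v ∼ w → w ∼ v
∼-sym (σ , p) = σ , R-sym p

∼-trans : ∀ {u v w} → u ∼ v → v ∼ w → u ∼ w
∼-trans (σ , p) (τ , q) = σ xor τ , R-trans p q

∼-SS : ∀ {w} → S ∷ S ∷ w ∼ w
∼-SS = true , R-SS

∼-UUU : ∀ {w} → U ∷ U ∷ U ∷ w ∼ w
∼-UUU = true , R-UUU

∼-cons : ∀ l {v w} → v ∼ w → l ∷ v ∼ l ∷ w
∼-cons l (σ , p) = σ , R-cons l p

∼-++ˡ : ∀ u {v w} → v ∼ w → u ++ v ∼ u ++ w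
∼-++ˡ []      p = p
∼-++ˡ (l ∷ u) p = ∼-cons l (∼-++ˡ u p)

R-++ʳ : ∀ {σ v w} u → R σ v w → R σ (v ++ u) (w ++ u)
R-++ʳ u R-refl        = R-refl
R-++ʳ u (R-sym p)     = R-sym (R-++ʳ u p)
R-++ʳ u (R-trans p q) = R-trans (R-++ʳ u p) (R-++ʳ u q)
R-++ʳ u (R-cons l p)  = R-cons l (R-++ʳ u p)
R-++ʳ u R-SS          = R-SS
R-++ʳ u R-UUU         = R-UUU

∼-++ʳ : ∀ {v w} u → v ∼ w → v ++ u ∼ w ++ u
∼-++ʳ u (σ , p) = σ , R-++ʳ u p

∼-++ : ∀ {t u v w} → t ∼ u → v ∼ w → t ++ v ∼ u ++ w
∼-++ {u = u} {v} p q = ∼-trans (∼-++ʳ v p) (∼-++ˡ u q)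

winv : Word → Word
winv []      = []
winv (S ∷ w) = winv w ++ S ∷ []
winv (U ∷ w) = winv w ++ U ∷ U ∷ []

winv-cancelˡ : ∀ w v → winv w ++ (w ++ v) ∼ v
winv-cancelˡ []      v = ∼-refl
winv-cancelˡ (S ∷ w) v = ∼-trans (∼-reflexive (++-assoc (winv w) (S ∷ []) (S ∷ w ++ v)))
  (∼-trans (∼-++ˡ (winv w) ∼-SS) (winv-cancelˡ w v))
winv-cancelˡ (U ∷ w) v = ∼-trans (∼-reflexive (++-assoc (winv w) (U ∷ U ∷ []) (U ∷ w ++ v)))
  (∼-trans (∼-++ˡ (winv w) ∼-UUU) (winv-cancelˡ w v))

winv-cancelʳ : ∀ w v → w ++ (winv w ++ v) ∼ v
winv-cancelʳ []      v = ∼-refl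
winv-cancelʳ (S ∷ w) v = ∼-trans (∼-reflexive (cong (λ z → S ∷ w ++ z) (++-assoc (winv w) (S ∷ []) v)))
  (∼-trans (∼-cons S (winv-cancelʳ w (S ∷ v))) ∼-SS)
winv-cancelʳ (U ∷ w) v = ∼-trans (∼-reflexive (cong (λ z → U ∷ w ++ z) (++-assoc (winv w) (U ∷ U ∷ []) v)))
  (∼-trans (∼-cons U (winv-cancelʳ w (U ∷ U ∷ v))) ∼-UUU)

winv-inverseˡ : ∀ w → winv w ++ w ∼ []
winv-inverseˡ w = ∼-trans (∼-reflexive (cong (winv w ++_) (sym (++-identityʳ w)))) (winv-cancelˡ w [])

winv-inverseʳ : ∀ w → w ++ winv w ∼ []
winv-inverseʳ w = ∼-trans (∼-reflexive (cong (w ++_) (sym (++-identityʳ (winv w))))) (winv-cancelʳ w [])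

commW : Word → Word → Word
commW v w = v ++ (w ++ (winv v ++ winv w))

-- Normal forms and their faithfulness.

-- A turn stands for U or U⁻¹ = U U.
data Turn : Set where
  ℓ ʳ : Turn

uw : Turn → Word
uw ℓ = U ∷ []
uw ʳ = U ∷ U ∷ []

W : List Turn → Word
W []       = []
W (ε ∷ es) = S ∷ (uw ε ++ W es)

data Z3 : Set where
  z0 z1 z2 : Z3

uz : Z3 → Word
uz z0 = []
uz z1 = U ∷ []
uz z2 = U ∷ U ∷ []

tl : Bool → Word
tl false = []
tl true  = S ∷ []

nfWord : Z3 → List Turn → Bool → Word
nfWord e es t = uz e ++ (W es ++ tl t)

#S : Word → ℕ
#S []      = 0
#S (S ∷ w) = suc (#S w)
#S (U ∷ w) = #S w

#S-++ : ∀ v w → #S (v ++ w) ≡ #S v ℕ.+ #S w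
#S-++ []      w = refl
#S-++ (S ∷ v) w = cong suc (#S-++ v w)
#S-++ (U ∷ v) w = #S-++ v w

#S-uw : ∀ ε → #S (uw ε) ≡ 0
#S-uw ℓ = refl
#S-uw ʳ = refl

#S-W : ∀ es → #S (W es) ≡ length es
#S-W []       = refl
#S-W (ε ∷ es) = cong suc (trans (#S-++ (uw ε) (W es)) (cong₂ ℕ._+_ (#S-uw ε) (#S-W es)))

bit : Bool → ℕ
bit false = 0
bit true  = 1

-- The bound is carried along so that the descent can measure a word by `#S` without reducing it
-- first.
normalise : ∀ w → ∃ λ e → ∃ λ es → ∃ λ t → w ∼ nfWord e es t × length es ℕ.+ bit t ℕ.≤ #S w
normalise [] = z0 , [] , false , ∼-refl , z≤n
normalise (U ∷ w) with normalise w
... | z0 , es , t , p , le = z1 , es , t , ∼-cons U p , le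
... | z1 , es , t , p , le = z2 , es , t , ∼-cons U p , le
... | z2 , es , t , p , le = z0 , es , t , ∼-trans (∼-cons U p) ∼-UUU , le
normalise (S ∷ w) with normalise w
... | z1 , es , t , p , le     = z0 , ℓ ∷ es , t , ∼-cons S p , s≤s le
... | z2 , es , t , p , le     = z0 , ʳ ∷ es , t , ∼-cons S p , s≤s le
... | z0 , [] , false , p , le = z0 , [] , true , ∼-cons S p , s≤s le
... | z0 , [] , true , p , le  = z0 , [] , false , ∼-trans (∼-cons S p) ∼-SS , z≤n
... | z0 , ℓ ∷ es , t , p , le = z1 , es , t , ∼-trans (∼-cons S p) ∼-SS , ℕₚ.m≤n⇒m≤1+n (ℕₚ.≤-trans (ℕₚ.n≤1+n _) le)
... | z0 , ʳ ∷ es , t , p , le = z2 , es , t , ∼-trans (∼-cons S p) ∼-SS , ℕₚ.m≤n⇒m≤1+n (ℕₚ.≤-trans (ℕₚ.n≤1+n _) le)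

Col : Set
Col = ℕ × ℕ

stepCol : Turn → Col → Col
stepCol ℓ (p , r) = p ℕ.+ r , r
stepCol ʳ (p , r) = p , p ℕ.+ r

cols : List Turn → Col → Col
cols []       v = v
cols (ε ∷ es) v = stepCol ε (cols es v)

col₁ col₂ : Bool → Col
col₁ false = 1 , 0
col₁ true  = 0 , 1
col₂ false = 0 , 1
col₂ true  = 1 , 0

τ± : Bool → ℤ → ℤ
τ± false i = i
τ± true  i = - i

fromCols : Bool → Col → Col → M2
fromCols t (p , r) (q , s) = mat (+ p) (τ± t (+ q)) (+ r) (τ± t (+ s))

-- Up to sign each turn is an elementary matrix with nonnegative entries, so nothing ever cancels in
-- the columns. A final `S` exchanges the two columns and negates the second one, which is the role
-- of `t`.
mt-W : ∀ es t → ∃ λ σ → mt (W es ++ tl t) ≡ sg σ (fromCols t (cols es (col₁ t)) (cols es (col₂ t)))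
mt-W [] false = false , refl
mt-W [] true  = false , refl
mt-W (ε ∷ es) t with mt-W es t
... | σ , eq = σ xor true , step ε
  where
  c₁ = cols es (col₁ t)
  c₂ = cols es (col₂ t)
  τ-+ : ∀ t i j → - (τ± t i + τ± t j) ≡ - τ± t (i + j)
  τ-+ false i j = refl
  τ-+ true i j = cong -_ (poly i j)
    where
    poly : ∀ i j → - i + - j ≡ - (i + j)
    poly = solve-∀
  L-step : ∀ c₁ c₂ → actS (actU (fromCols t c₁ c₂)) ≡ neg (fromCols t (stepCol ℓ c₁) (stepCol ℓ c₂))
  L-step (p , r) (q , s) = mat-≡ refl (τ-+ t (+ q) (+ s)) refl refl
  R-step : ∀ c₁ c₂ → actS (actU (actU (fromCols t c₁ c₂))) ≡ neg (fromCols t (stepCol ʳ c₁) (stepCol ʳ c₂))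
  R-step (p , r) (q , s) = mat-≡ (poly (+ p) (+ r)) (poly (τ± t (+ q)) (τ± t (+ s))) refl (τ-+ t (+ q) (+ s))
    where
    poly : ∀ p r → - (- r + (p + r)) ≡ - p
    poly = solve-∀
  step : ∀ ε → mt (W (ε ∷ es) ++ tl t) ≡ sg (σ xor true) (fromCols t (stepCol ε c₁) (stepCol ε c₂))
  step ℓ = trans (cong (λ z → actS (actU z)) eq)
    (trans (cong actS (sg-actU σ _)) (trans (sg-actS σ _) (trans (cong (sg σ) (L-step c₁ c₂)) (sg-sg σ true _))))
  step ʳ = trans (cong (λ z → actS (actU (actU z))) eq)
    (trans (cong (λ z → actS (actU z)) (sg-actU σ _)) (trans (cong actS (sg-actU σ _))
      (trans (sg-actS σ _) (trans (cong (sg σ) (R-step c₁ c₂)) (sg-sg σ true _)))))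

abs4 : M2 → (ℕ × ℕ) × (ℕ × ℕ)
abs4 (mat p q r s) = (∣ p ∣ , ∣ r ∣) , (∣ q ∣ , ∣ s ∣)

abs4-sg : ∀ σ A → abs4 (sg σ A) ≡ abs4 A
abs4-sg false A = refl
abs4-sg true (mat p q r s) = cong₂ _,_ (cong₂ _,_ (∣-i∣≡∣i∣ p) (∣-i∣≡∣i∣ r)) (cong₂ _,_ (∣-i∣≡∣i∣ q) (∣-i∣≡∣i∣ s))

colU : Z3 → Col → Col
colU z0 (p , r) = p , r
colU z1 (p , r) = r , p ℕ.+ r
colU z2 (p , r) = p ℕ.+ r , p

abs4-nf : ∀ e es t → abs4 (mt (nfWord e es t)) ≡ (colU e (cols es (col₁ t)) , colU e (cols es (col₂ t)))
abs4-nf e es t with mt-W es t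
... | σ , eq = go e
  where
  c₁ = cols es (col₁ t)
  c₂ = cols es (col₂ t)
  abs-τ : ∀ t n → ∣ τ± t (+ n) ∣ ≡ n
  abs-τ false n = refl
  abs-τ true  n = ∣-i∣≡∣i∣ (+ n)
  τ-+ : ∀ t i j → τ± t i + τ± t j ≡ τ± t (i + j)
  τ-+ false i j = refl
  τ-+ true i j = poly i j
    where
    poly : ∀ i j → - i + - j ≡ - (i + j)
    poly = solve-∀
  cancel : ∀ p r → - r + (p + r) ≡ p
  cancel = solve-∀
  base0 : ∀ c₁ c₂ → abs4 (fromCols t c₁ c₂) ≡ (c₁ , c₂)
  base0 (p , r) (q , s) = cong ((p , r) ,_) (cong₂ _,_ (abs-τ t q) (abs-τ t s))
  base1 : ∀ c₁ c₂ → abs4 (actU (fromCols t c₁ c₂)) ≡ (colU z1 c₁ , colU z1 c₂)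
  base1 (p , r) (q , s) = cong₂ _,_ (cong₂ _,_ (∣-i∣≡∣i∣ (+ r)) refl)
    (cong₂ _,_ (trans (∣-i∣≡∣i∣ (τ± t (+ s))) (abs-τ t s)) (trans (cong ∣_∣ (τ-+ t (+ q) (+ s))) (abs-τ t (q ℕ.+ s))))
  base2 : ∀ c₁ c₂ → abs4 (actU (actU (fromCols t c₁ c₂))) ≡ (colU z2 c₁ , colU z2 c₂)
  base2 (p , r) (q , s) = cong₂ _,_
    (cong₂ _,_ (∣-i∣≡∣i∣ (+ (p ℕ.+ r))) (cong ∣_∣ (cancel (+ p) (+ r))))
    (cong₂ _,_ (trans (∣-i∣≡∣i∣ (τ± t (+ q) + τ± t (+ s))) (trans (cong ∣_∣ (τ-+ t (+ q) (+ s))) (abs-τ t (q ℕ.+ s))))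
               (trans (cong ∣_∣ (cancel (τ± t (+ q)) (τ± t (+ s)))) (abs-τ t q)))
  go : ∀ e → abs4 (mt (nfWord e es t)) ≡ (colU e c₁ , colU e c₂)
  go z0 = trans (cong abs4 eq) (trans (abs4-sg σ _) (base0 c₁ c₂))
  go z1 = trans (cong (λ z → abs4 (actU z)) eq)
    (trans (cong abs4 (sg-actU σ _)) (trans (abs4-sg σ _) (base1 c₁ c₂)))
  go z2 = trans (cong (λ z → abs4 (actU (actU z))) eq)
    (trans (cong (λ z → abs4 (actU z)) (sg-actU σ _)) (trans (cong abs4 (sg-actU σ _)) (trans (abs4-sg σ _) (base2 c₁ c₂))))

-- Whenever a turn or a power of `U` comes first, an entry that should be 0 is a sum of natural
-- numbers one of which should be 1.
cols-identity : ∀ e es t → colU e (cols es (col₁ t)) ≡ (1 , 0) → colU e (cols es (col₂ t)) ≡ (0 , 1) →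
                e ≡ z0 × es ≡ [] × t ≡ false
cols-identity z0 [] false _ _ = refl , refl , refl
cols-identity z0 [] true ()
cols-identity z0 (ℓ ∷ es) t _ p₂ with cols es (col₂ t) | p₂
... | (zero , r)  | eq with trans (sym (cong proj₁ eq)) (cong proj₂ eq)
...   | ()
cols-identity z0 (ℓ ∷ es) t _ p₂ | (suc p , r) | ()
cols-identity z0 (ʳ ∷ es) t p₁ _ with cols es (col₁ t) | p₁
... | (zero , r)  | ()
... | (suc p , r) | ()
cols-identity z1 es t p₁ _ with cols es (col₁ t) | p₁
... | (zero , zero)  | ()
... | (zero , suc r) | ()
... | (suc p , r)    | ()
cols-identity z2 es t _ p₂ with cols es (col₂ t) | p₂
... | (zero , zero)  | ()
... | (zero , suc r) | ()
... | (suc p , r)    | ()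

∼-kernel : ∀ w σ → mt w ≡ sg σ I2 → w ∼ []
∼-kernel w σ eq with normalise w
... | e , es , t , (τ , p) , _ with cols-identity e es t (cong proj₁ both) (cong proj₂ both)
  where
  both : (colU e (cols es (col₁ t)) , colU e (cols es (col₂ t))) ≡ ((1 , 0) , (0 , 1))
  both = trans (sym (abs4-nf e es t)) (trans (sym (abs4-sg τ _))
    (trans (cong abs4 (trans (sym (R-sound p)) eq)) (abs4-sg σ I2)))
... | refl , refl , refl = τ , p

-- Applying `∼-kernel` to the product of `v` with the inverse of `w` relates the words up to some
-- sign. That sign has to be `σ`, because a matrix of determinant 1 is never its own negative.
R-complete : ∀ v w σ → mt v ≡ sg σ (mt w) → R σ v w
R-complete v w σ eq = fix τ σ p (trans (sym (R-sound p)) eq)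
  where
  inverse : ∃ λ ρ → mt (w ++ winv w) ≡ sg ρ I2
  inverse = proj₁ (winv-inverseʳ w) , R-sound (proj₂ (winv-inverseʳ w))
  ρ = proj₁ inverse
  quotient : mt (v ++ winv w) ≡ sg (σ xor ρ) I2
  quotient = trans (mt-++ v (winv w)) (trans (cong (_⊗ mt (winv w)) eq) (trans (sg-⊗ˡ σ (mt w) (mt (winv w)))
    (trans (cong (sg σ) (trans (sym (mt-++ w (winv w))) (proj₂ inverse))) (sg-sg σ ρ I2))))
  related : v ∼ w
  related = ∼-trans (∼-reflexive (sym (++-identityʳ v)))
    (∼-trans (∼-++ˡ v (∼-sym (winv-inverseˡ w)))
    (∼-trans (∼-reflexive (sym (++-assoc v (winv w) w)))
             (∼-++ʳ w (∼-kernel (v ++ winv w) (σ xor ρ) quotient))))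
  τ = proj₁ related
  p = proj₂ related
  fix : ∀ τ σ → R τ v w → sg τ (mt w) ≡ sg σ (mt w) → R σ v w
  fix false false p _ = p
  fix true  true  p _ = p
  fix false true  p e = ⊥-elim (neg≢ (mt w) (det-mt w) e)
  fix true  false p e = ⊥-elim (neg≢ (mt w) (det-mt w) (sym e))

-- Words for given matrices.

shear : ℤ → M2 → M2
shear k (mat p q r s) = mat (p + k * r) (q + k * s) r s

-- `S S S U` is the elementary matrix and `U U U U U S` its inverse; the additional `S S` and
-- `U U U` only correct the sign.
shearWord : ∀ k w → ∃ λ v → mt v ≡ shear k (mt w)
shearWord (+ zero) w = w , id-shear (mt w)
  where
  poly : ∀ p r → p ≡ p + 0ℤ * r
  poly = solve-∀
  id-shear : ∀ A → A ≡ shear 0ℤ A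
  id-shear (mat p q r s) = mat-≡ (poly p r) (poly q s) refl refl
shearWord (+ suc n) w with shearWord (+ n) w
... | v , eq = S ∷ S ∷ S ∷ U ∷ v , trans (cong (λ z → actS (actS (actS (actU z)))) eq) (shear-suc (mt w))
  where
  top : ∀ k p r → - (- (p + k * r + r)) ≡ p + (1ℤ + k) * r
  top = solve-∀
  bot : ∀ r → - (- r) ≡ r
  bot = solve-∀
  shear-suc : ∀ A → actS (actS (actS (actU (shear (+ n) A)))) ≡ shear (+ suc n) A
  shear-suc (mat p q r s) = mat-≡ (top (+ n) p r) (top (+ n) q s) (bot r) (bot s)
shearWord -[1+ zero ] w = U ∷ U ∷ U ∷ U ∷ U ∷ S ∷ w , trans (R-sound (R-UUU {U ∷ U ∷ S ∷ w})) (shear-pred (mt w))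
  where
  top : ∀ p r → - (- (- r + p)) ≡ p + - 1ℤ * r
  top = solve-∀
  bot : ∀ p r → - (- p + (- r + p)) ≡ r
  bot = solve-∀
  shear-pred : ∀ A → neg (actU (actU (actS A))) ≡ shear (- 1ℤ) A
  shear-pred (mat p q r s) = mat-≡ (top p r) (top q s) (bot p r) (bot q s)
shearWord -[1+ suc n ] w with shearWord -[1+ n ] w
... | v , eq with shearWord -[1+ zero ] v
...   | u , eq' = u , trans eq' (trans (cong (shear (- 1ℤ)) eq) (shear-add (mt w)))
  where
  poly : ∀ k p r → p + k * r + - 1ℤ * r ≡ p + (- 1ℤ + k) * r
  poly = solve-∀
  shear-add : ∀ A → shear (- 1ℤ) (shear -[1+ n ] A) ≡ shear -[1+ suc n ] A
  shear-add (mat p q r s) = mat-≡ (poly -[1+ n ] p r) (poly -[1+ n ] q s) refl refl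

-- Euclid's algorithm on the first column: a shear replaces the upper entry by its remainder, `S`
-- exchanges the rows, and the lower left entry gets smaller in absolute value. Once it is 0, the
-- matrix is a shear up to sign.
decompose : ∀ A → det A ≡ 1ℤ → ∃ λ w → mt w ≡ A
decompose A detA = go A detA (<-wellFounded ∣ M2.c A ∣)
  where
  abs-one : ∀ i → ∣ i ∣ ≡ 1 → i ≡ 1ℤ ⊎ i ≡ - 1ℤ
  abs-one (+ .1)     refl = inj₁ refl
  abs-one -[1+ .0 ] refl = inj₂ refl

  unit : ∀ p s → p * s ≡ 1ℤ → (p ≡ 1ℤ × s ≡ 1ℤ) ⊎ (p ≡ - 1ℤ × s ≡ - 1ℤ)
  unit p s eq with abs-one p (ℕₚ.m*n≡1⇒m≡1 ∣ p ∣ ∣ s ∣ (trans (sym (∣i*j∣≡∣i∣*∣j∣ p s)) (cong ∣_∣ eq)))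
                 | abs-one s (ℕₚ.m*n≡1⇒n≡1 ∣ p ∣ ∣ s ∣ (trans (sym (∣i*j∣≡∣i∣*∣j∣ p s)) (cong ∣_∣ eq)))
  unit _ _ _  | inj₁ refl | inj₁ refl = inj₁ (refl , refl)
  unit _ _ () | inj₁ refl | inj₂ refl
  unit _ _ () | inj₂ refl | inj₁ refl
  unit _ _ _  | inj₂ refl | inj₂ refl = inj₂ (refl , refl)

  upper : ∀ p q s → det (mat p q 0ℤ s) ≡ 1ℤ → ∃ λ w → mt w ≡ mat p q 0ℤ s
  upper p q s detA with unit p s (trans (poly p q s) detA)
    where
    poly : ∀ p q s → p * s ≡ p * s - q * 0ℤ
    poly = solve-∀
  ... | inj₁ (refl , refl) with shearWord q []
  ...   | v , eq = v , trans eq (mat-≡ (poly₁ q) (poly₂ q) refl refl)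
    where
    poly₁ : ∀ q → 1ℤ + q * 0ℤ ≡ 1ℤ
    poly₁ = solve-∀
    poly₂ : ∀ q → 0ℤ + q * 1ℤ ≡ q
    poly₂ = solve-∀
  upper p q s detA | inj₂ (refl , refl) with shearWord (- q) []
  ...   | v , eq = S ∷ S ∷ v , trans (cong neg eq) (mat-≡ (poly₁ q) (poly₂ q) refl refl)
    where
    poly₁ : ∀ q → - (1ℤ + - q * 0ℤ) ≡ - 1ℤ
    poly₁ = solve-∀
    poly₂ : ∀ q → - (0ℤ + - q * 1ℤ) ≡ q
    poly₂ = solve-∀

  lower : ∀ p q r s .{{_ : ℤ.NonZero r}} → det (mat p q r s) ≡ 1ℤ →
          (∀ B → det B ≡ 1ℤ → ∣ M2.c B ∣ ℕ.< ∣ r ∣ → ∃ λ w → mt w ≡ B) → ∃ λ w → mt w ≡ mat p q r s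
  lower p q r s detA rec =
    proj₁ shifted , trans (proj₂ shifted) (trans (cong (λ z → shear k (actS z)) (proj₂ smaller))
      (mat-≡ (trans (cong (_+ k * r) (double-neg (+ t))) (sym division)) (undo k q s) refl refl))
    where
    k = p / r
    t = p % r
    division : p ≡ + t + k * r
    division = a≡a%n+[a/n]*n p r
    B = mat r s (- (+ t)) (- (q - k * s))
    double-neg : ∀ x → - (- x) ≡ x
    double-neg = solve-∀
    undo : ∀ k q s → - (- (q - k * s)) + k * s ≡ q
    undo = solve-∀
    poly : ∀ t k q r s → r * (- (q - k * s)) - s * (- t) ≡ (t + k * r) * s - q * r
    poly = solve-∀
    detB : det B ≡ 1ℤ
    detB = trans (poly (+ t) k q r s) (trans (cong (λ z → z * s - q * r) (sym division)) detA)
    smaller = rec B detB (subst (ℕ._< ∣ r ∣) (sym (∣-i∣≡∣i∣ (+ t))) (n%d<d p r))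
    shifted = shearWord k (S ∷ proj₁ smaller)

  go : ∀ A → det A ≡ 1ℤ → Acc ℕ._<_ ∣ M2.c A ∣ → ∃ λ w → mt w ≡ A
  go (mat p q (+ zero) s) detA _ = upper p q s detA
  go (mat p q (+ suc r) s) detA (acc rs) = lower p q (+ suc r) s detA (λ B detB lt → go B detB (rs lt))
  go (mat p q -[1+ r ] s) detA (acc rs) = lower p q -[1+ r ] s detA (λ B detB lt → go B detB (rs lt))

-- A function of the matrix alone: the junk value [] is never reached from SL2.
opaque

  wordOf : M2 → Word
  wordOf A with det A ≟ 1ℤ
  ... | yes detA = proj₁ (decompose A detA)
  ... | no  _    = []

  mt-wordOf : ∀ A → det A ≡ 1ℤ → mt (wordOf A) ≡ A
  mt-wordOf A detA with det A ≟ 1ℤ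
  ... | yes detA' = proj₂ (decompose A detA')
  ... | no  ¬detA = ⊥-elim (¬detA detA)

wd : SL2 → Word
wd g = wordOf (SL2.m g)

mt-wd : ∀ g → mt (wd g) ≡ SL2.m g
mt-wd g = mt-wordOf (SL2.m g) (SL2.det1 g)

toSL : Word → SL2
toSL w = sl (mt w) (det-mt w)

R-wd-toSL : ∀ w → R false (wd (toSL w)) w
R-wd-toSL w = R-complete (wd (toSL w)) w false (mt-wd (toSL w))

R-wd-· : ∀ g h → R false (wd (g · h)) (wd g ++ wd h)
R-wd-· g h = R-complete _ _ false (trans (mt-wd (g · h)) (sym (trans (mt-++ (wd g) (wd h)) (cong₂ _⊗_ (mt-wd g) (mt-wd h)))))

R-wd-one : R false (wd one) []
R-wd-one = R-complete _ _ false (mt-wd one)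

R-wd-inverseˡ : ∀ g → R false (wd (inv g) ++ wd g) []
R-wd-inverseˡ g = R-trans (R-sym (R-wd-· (inv g) g))
  (R-complete _ [] false (trans (mt-wd (inv g · g)) (Group.inverseˡ SL₂ℤ g)))

R-wd-cong : ∀ g h → SL2.m g ≡ SL2.m h → R false (wd g) (wd h)
R-wd-cong g h eq = R-complete _ _ false (trans (mt-wd g) (trans eq (sym (mt-wd h))))

∼-wd-PSL : ∀ g h → g ≈PSL h → wd g ∼ wd h
∼-wd-PSL g h (inj₁ eq) = false , R-wd-cong g h eq
∼-wd-PSL g h (inj₂ eq) = true , R-complete _ _ true (trans (mt-wd g) (trans eq (cong neg (sym (mt-wd h)))))

R-PSL : ∀ {σ g h} → R σ (wd g) (wd h) → g ≈PSL h
R-PSL {false} {g} {h} p = inj₁ (trans (sym (mt-wd g)) (trans (R-sound p) (mt-wd h)))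
R-PSL {true}  {g} {h} p = inj₂ (trans (sym (mt-wd g)) (trans (R-sound p) (cong neg (mt-wd h))))

∼-inverse-unique : ∀ u v → u ++ v ∼ [] → u ∼ winv v
∼-inverse-unique u v p = ∼-trans (∼-reflexive (sym (++-identityʳ u)))
  (∼-trans (∼-++ˡ u (∼-sym (winv-inverseʳ v)))
  (∼-trans (∼-reflexive (sym (++-assoc u v (winv v)))) (∼-++ʳ (winv v) p)))

∼-wd-inv : ∀ g → wd (inv g) ∼ winv (wd g)
∼-wd-inv g = ∼-inverse-unique (wd (inv g)) (wd g) (false , R-wd-inverseˡ g)

-- Finite index by the pigeonhole principle.

wordsOfLength≤ : ℕ → List Word
wordsOfLength≤ zero    = [] ∷ []
wordsOfLength≤ (suc n) = [] ∷ (map (S ∷_) (wordsOfLength≤ n) ++ map (U ∷_) (wordsOfLength≤ n))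

∈-wordsOfLength≤ : ∀ n w → length w ℕ.≤ n → w ∈ wordsOfLength≤ n
∈-wordsOfLength≤ zero    []      _ = Any.here refl
∈-wordsOfLength≤ (suc n) []      _ = Any.here refl
∈-wordsOfLength≤ (suc n) (S ∷ w) (s≤s le) = Any.there (∈-++⁺ˡ (∈-map⁺ (S ∷_) (∈-wordsOfLength≤ n w le)))
∈-wordsOfLength≤ (suc n) (U ∷ w) (s≤s le) =
  Any.there (∈-++⁺ʳ (map (S ∷_) (wordsOfLength≤ n)) (∈-map⁺ (U ∷_) (∈-wordsOfLength≤ n w le)))

-- Two prefixes of a long word get the same code, and the segment between them can be cut out.
shorten : ∀ {K} (_≈_ : Word → Word → Set) → (∀ {u} → u ≈ u) → (∀ {u v w} → u ≈ v → v ≈ w → u ≈ w) →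
          (∀ {u v} w → u ≈ v → (u ++ w) ≈ (v ++ w)) →
          (Φ : Word → Fin K) → (∀ {u v} → Φ u ≡ Φ v → u ≈ v) →
          ∀ w → ∃ λ v → length v ℕ.≤ K × v ≈ w
shorten {K} _≈_ ≈-refl ≈-trans ≈-++ Φ separates w = go w (<-wellFounded (length w))
  where
  go : ∀ w → Acc ℕ._<_ (length w) → ∃ λ v → length v ℕ.≤ K × v ≈ w
  go w (acc rs) with length w ℕₚ.≤? K
  ... | yes le = w , le , ≈-refl
  ... | no  gt with pigeonhole (ℕₚ.n<1+n K) (λ i → Φ (take (toℕ i) w))
  ...   | i , j , i<j , eq = proj₁ rest , proj₁ (proj₂ rest) , ≈-trans (proj₂ (proj₂ rest)) cut≈w
    where
    cut = take (toℕ i) w ++ drop (toℕ j) w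
    j≤ : toℕ j ℕ.≤ length w
    j≤ = ℕₚ.≤-trans (ℕₚ.≤-pred (toℕ<n j)) (ℕₚ.<⇒≤ (ℕₚ.≰⇒> gt))
    shorter : length cut ℕ.< length w
    shorter = begin-strict
      length cut                                           ≡⟨ length-++ (take (toℕ i) w) ⟩
      length (take (toℕ i) w) ℕ.+ length (drop (toℕ j) w)  ≡⟨ cong₂ ℕ._+_ (length-take (toℕ i) w) (length-drop (toℕ j) w) ⟩
      toℕ i ℕ.⊓ length w ℕ.+ (length w ℕ.∸ toℕ j)          ≤⟨ ℕₚ.+-monoˡ-≤ _ (ℕₚ.m⊓n≤m (toℕ i) (length w)) ⟩
      toℕ i ℕ.+ (length w ℕ.∸ toℕ j)                       <⟨ ℕₚ.+-monoˡ-< _ i<j ⟩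
      toℕ j ℕ.+ (length w ℕ.∸ toℕ j)                       ≡⟨ ℕₚ.m+[n∸m]≡n j≤ ⟩
      length w                                             ∎
      where open ℕₚ.≤-Reasoning
    rest = go cut (rs shorter)
    cut≈w : cut ≈ w
    cut≈w = subst (cut ≈_) (take++drop≡id (toℕ j) w) (≈-++ (drop (toℕ j) w) (separates eq))

-- This supplies coset representatives without enumerating a quotient: a code in `Fin K` that
-- separates the classes already forces each class to contain a word of length at most `K`.
covers-by-short-words : ∀ {K} (_≈_ : Word → Word → Set) → (∀ {u} → u ≈ u) → (∀ {u v w} → u ≈ v → v ≈ w → u ≈ w) →
  (∀ {u v} w → u ≈ v → (u ++ w) ≈ (v ++ w)) →
  (Φ : Word → Fin K) → (∀ {u v} → Φ u ≡ Φ v → u ≈ v) →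
  (P : SL2 → SL2 → Set) → (∀ v g → v ≈ wd g → P (toSL v) g) →
  ∀ g → Any (λ r → P r g) (map toSL (wordsOfLength≤ K))
covers-by-short-words {K} _≈_ ≈-refl ≈-trans ≈-++ Φ separates P close g
  with shorten _≈_ ≈-refl ≈-trans ≈-++ Φ separates (wd g)
... | v , le , v≈g = lose (∈-map⁺ toSL (∈-wordsOfLength≤ K v le)) (close v g v≈g)

-- Identities in the algebra of matrices.

infixl 7 _⊠_
infixr 6 _⊕_
infixr 7 _⊛_

-- Opaque, so that the type checker never unfolds a product of matrices into its entries.
opaque

  _⊠_ _⊕_ : M2 → M2 → M2
  _⊠_ = _⊗_
  mat a b c d ⊕ mat e f g h = mat (a + e) (b + f) (c + g) (d + h)

  _⊛_ : ℤ → M2 → M2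
  k ⊛ mat a b c d = mat (k * a) (k * b) (k * c) (k * d)

  tr : M2 → ℤ
  tr (mat a b c d) = a + d

  dt : M2 → ℤ
  dt = det

  ad : M2 → M2
  ad = adj

comm : M2 → M2 → M2
comm A B = (A ⊠ B) ⊕ (- 1ℤ) ⊛ (B ⊠ A)

O2 : M2
O2 = mat 0ℤ 0ℤ 0ℤ 0ℤ

opaque
  unfolding _⊠_ _⊕_ _⊛_ tr dt ad

  ⊠-assoc : ∀ A B C → (A ⊠ B) ⊠ C ≡ A ⊠ (B ⊠ C)
  ⊠-assoc = ⊗-assoc

  ⊠-identityˡ : ∀ A → I2 ⊠ A ≡ A
  ⊠-identityˡ = ⊗-identityˡ

  ⊠-identityʳ : ∀ A → A ⊠ I2 ≡ A
  ⊠-identityʳ = ⊗-identityʳ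

  dt-⊠ : ∀ A B → dt (A ⊠ B) ≡ dt A * dt B
  dt-⊠ (mat a b c d) (mat e f g h) = poly a b c d e f g h
    where
    poly : ∀ a b c d e f g h →
      (a * e + b * g) * (c * f + d * h) - (a * f + b * h) * (c * e + d * g) ≡ (a * d - b * c) * (e * h - f * g)
    poly = solve-∀

  ⊠-distribˡ : ∀ A B C → A ⊠ (B ⊕ C) ≡ A ⊠ B ⊕ A ⊠ C
  ⊠-distribˡ (mat a b c d) (mat e f g h) (mat i j k l) =
    mat-≡ (poly a b e g i k) (poly a b f h j l) (poly c d e g i k) (poly c d f h j l)
    where
    poly : ∀ a b e g i k → a * (e + i) + b * (g + k) ≡ a * e + b * g + (a * i + b * k)
    poly = solve-∀

  ⊠-distribʳ : ∀ A B C → (B ⊕ C) ⊠ A ≡ B ⊠ A ⊕ C ⊠ A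
  ⊠-distribʳ (mat a b c d) (mat e f g h) (mat i j k l) =
    mat-≡ (poly e f i j a c) (poly e f i j b d) (poly g h k l a c) (poly g h k l b d)
    where
    poly : ∀ e f i j a c → (e + i) * a + (f + j) * c ≡ e * a + f * c + (i * a + j * c)
    poly = solve-∀

  ⊠-⊛ : ∀ k A B → A ⊠ (k ⊛ B) ≡ k ⊛ (A ⊠ B)
  ⊠-⊛ k (mat a b c d) (mat e f g h) = mat-≡ (poly k a b e g) (poly k a b f h) (poly k c d e g) (poly k c d f h)
    where
    poly : ∀ k a b e g → a * (k * e) + b * (k * g) ≡ k * (a * e + b * g)
    poly = solve-∀

  ⊛-⊠ : ∀ k A B → (k ⊛ A) ⊠ B ≡ k ⊛ (A ⊠ B)
  ⊛-⊠ k (mat a b c d) (mat e f g h) = mat-≡ (poly k a b e g) (poly k a b f h) (poly k c d e g) (poly k c d f h)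
    where
    poly : ∀ k a b e g → (k * a) * e + (k * b) * g ≡ k * (a * e + b * g)
    poly = solve-∀

  ⊛-⊛ : ∀ k l A → k ⊛ (l ⊛ A) ≡ (k * l) ⊛ A
  ⊛-⊛ k l (mat a b c d) = mat-≡ (poly k l a) (poly k l b) (poly k l c) (poly k l d)
    where
    poly : ∀ k l a → k * (l * a) ≡ (k * l) * a
    poly = solve-∀

  ⊛-distribˡ : ∀ k A B → k ⊛ (A ⊕ B) ≡ k ⊛ A ⊕ k ⊛ B
  ⊛-distribˡ k (mat a b c d) (mat e f g h) =
    mat-≡ (*-distribˡ-+ k a e) (*-distribˡ-+ k b f) (*-distribˡ-+ k c g) (*-distribˡ-+ k d h)

  ⊛-distribʳ : ∀ k l A → k ⊛ A ⊕ l ⊛ A ≡ (k + l) ⊛ A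
  ⊛-distribʳ k l (mat a b c d) =
    mat-≡ (sym (*-distribʳ-+ a k l)) (sym (*-distribʳ-+ b k l)) (sym (*-distribʳ-+ c k l)) (sym (*-distribʳ-+ d k l))

  ⊕-medial : ∀ A B C D → (A ⊕ B) ⊕ (C ⊕ D) ≡ (A ⊕ C) ⊕ (B ⊕ D)
  ⊕-medial (mat a b c d) (mat e f g h) (mat i j k l) (mat m n o p) =
    mat-≡ (poly a e i m) (poly b f j n) (poly c g k o) (poly d h l p)
    where
    poly : ∀ a b c d → a + b + (c + d) ≡ a + c + (b + d)
    poly = solve-∀

  0⊛-⊕ : ∀ A B → 0ℤ ⊛ A ⊕ B ≡ B
  0⊛-⊕ (mat a b c d) (mat e f g h) = mat-≡ (poly a e) (poly b f) (poly c g) (poly d h)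
    where
    poly : ∀ a e → 0ℤ * a + e ≡ e
    poly = solve-∀

  ⊕-0⊛ : ∀ A B → B ⊕ 0ℤ ⊛ A ≡ B
  ⊕-0⊛ (mat a b c d) (mat e f g h) = mat-≡ (poly a e) (poly b f) (poly c g) (poly d h)
    where
    poly : ∀ a e → e + 0ℤ * a ≡ e
    poly = solve-∀

  ⊛-identity : ∀ A → 1ℤ ⊛ A ≡ A
  ⊛-identity (mat a b c d) = mat-≡ (*-identityˡ a) (*-identityˡ b) (*-identityˡ c) (*-identityˡ d)

  ⊠-ad : ∀ A → A ⊠ ad A ≡ dt A ⊛ I2
  ⊠-ad (mat a b c d) = mat-≡ (p₁ a b c d) (p₂ a b c d) (p₃ a b c d) (p₄ a b c d)
    where
    p₁ : ∀ a b c d → a * d + b * (- c) ≡ (a * d - b * c) * 1ℤ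
    p₁ = solve-∀
    p₂ : ∀ a b c d → a * (- b) + b * a ≡ (a * d - b * c) * 0ℤ
    p₂ = solve-∀
    p₃ : ∀ a b c d → c * d + d * (- c) ≡ (a * d - b * c) * 0ℤ
    p₃ = solve-∀
    p₄ : ∀ a b c d → c * (- b) + d * a ≡ (a * d - b * c) * 1ℤ
    p₄ = solve-∀

  ad-tr : ∀ A → ad A ≡ tr A ⊛ I2 ⊕ (- 1ℤ) ⊛ A
  ad-tr (mat a b c d) = mat-≡ (p₁ a d) (p₂ (a + d) b) (p₂ (a + d) c) (p₄ a d)
    where
    p₁ : ∀ a d → d ≡ (a + d) * 1ℤ + (- 1ℤ) * a
    p₁ = solve-∀
    p₂ : ∀ t b → - b ≡ t * 0ℤ + (- 1ℤ) * b
    p₂ = solve-∀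
    p₄ : ∀ a d → a ≡ (a + d) * 1ℤ + (- 1ℤ) * d
    p₄ = solve-∀

  ad-⊠ : ∀ A B → ad (A ⊠ B) ≡ ad B ⊠ ad A
  ad-⊠ (mat a b c d) (mat e f g h) = mat-≡ (p c d f h) (q a b f h) (r c d e g) (s a b e g)
    where
    p : ∀ c d f h → c * f + d * h ≡ h * d + (- f) * (- c)
    p = solve-∀
    q : ∀ a b f h → - (a * f + b * h) ≡ h * (- b) + (- f) * a
    q = solve-∀
    r : ∀ c d e g → - (c * e + d * g) ≡ (- g) * d + e * (- c)
    r = solve-∀
    s : ∀ a b e g → a * e + b * g ≡ (- g) * (- b) + e * a
    s = solve-∀

  -- The determinant is a quadratic form, and `tr (A ⊠ ad B)` is its polar form.
  dt-difference : ∀ A B → dt (A ⊕ (- 1ℤ) ⊛ B) ≡ dt A + dt B - tr (A ⊠ ad B)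
  dt-difference (mat a b c d) (mat e f g h) = poly a b c d e f g h
    where
    poly : ∀ a b c d e f g h →
      (a + (- 1ℤ) * e) * (d + (- 1ℤ) * h) - (b + (- 1ℤ) * f) * (c + (- 1ℤ) * g)
        ≡ (a * d - b * c) + (e * h - f * g) - (a * h + b * (- g) + (c * (- f) + d * e))
    poly = solve-∀

  tr-⊛ : ∀ k A → tr (k ⊛ A) ≡ k * tr A
  tr-⊛ k (mat a b c d) = poly k a d
    where
    poly : ∀ k a d → k * a + k * d ≡ k * (a + d)
    poly = solve-∀

  tr-cyclic : ∀ A B → tr (A ⊠ B) ≡ tr (B ⊠ A)
  tr-cyclic (mat a b c d) (mat e f g h) = poly a b c d e f g h
    where
    poly : ∀ a b c d e f g h → a * e + b * g + (c * f + d * h) ≡ e * a + f * c + (g * b + h * d)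
    poly = solve-∀

  cayley-hamilton : ∀ A → A ⊠ A ≡ tr A ⊛ A ⊕ (- dt A) ⊛ I2
  cayley-hamilton (mat a b c d) = mat-≡ (p₁ a b c d) (p₂ a b c d) (p₃ a b c d) (p₄ a b c d)
    where
    p₁ : ∀ a b c d → a * a + b * c ≡ (a + d) * a + (- (a * d - b * c)) * 1ℤ
    p₁ = solve-∀
    p₂ : ∀ a b c d → a * b + b * d ≡ (a + d) * b + (- (a * d - b * c)) * 0ℤ
    p₂ = solve-∀
    p₃ : ∀ a b c d → c * a + d * c ≡ (a + d) * c + (- (a * d - b * c)) * 0ℤ
    p₃ = solve-∀
    p₄ : ∀ a b c d → c * b + d * d ≡ (a + d) * d + (- (a * d - b * c)) * 1ℤ
    p₄ = solve-∀

  swap : ∀ A B → B ⊠ A ≡ (- 1ℤ) ⊛ (A ⊠ B) ⊕ tr B ⊛ A ⊕ tr A ⊛ B ⊕ (tr (A ⊠ B) - tr A * tr B) ⊛ I2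
  swap (mat a b c d) (mat e f g h) =
    mat-≡ (p₁ a b c d e f g h) (p₂ a b c d e f g h) (p₃ a b c d e f g h) (p₄ a b c d e f g h)
    where
    p₁ : ∀ a b c d e f g h → e * a + f * c ≡ (- 1ℤ) * (a * e + b * g) + ((e + h) * a + ((a + d) * e
           + (a * e + b * g + (c * f + d * h) - (a + d) * (e + h)) * 1ℤ))
    p₁ = solve-∀
    p₂ : ∀ a b c d e f g h → e * b + f * d ≡ (- 1ℤ) * (a * f + b * h) + ((e + h) * b + ((a + d) * f
           + (a * e + b * g + (c * f + d * h) - (a + d) * (e + h)) * 0ℤ))
    p₂ = solve-∀
    p₃ : ∀ a b c d e f g h → g * a + h * c ≡ (- 1ℤ) * (c * e + d * g) + ((e + h) * c + ((a + d) * g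
           + (a * e + b * g + (c * f + d * h) - (a + d) * (e + h)) * 0ℤ))
    p₃ = solve-∀
    p₄ : ∀ a b c d e f g h → g * b + h * d ≡ (- 1ℤ) * (c * f + d * h) + ((e + h) * d + ((a + d) * h
           + (a * e + b * g + (c * f + d * h) - (a + d) * (e + h)) * 1ℤ))
    p₄ = solve-∀

  ⊕-self : ∀ A → A ⊕ (- 1ℤ) ⊛ A ≡ O2
  ⊕-self (mat a b c d) = mat-≡ (poly a) (poly b) (poly c) (poly d)
    where
    poly : ∀ p → p + (- 1ℤ) * p ≡ 0ℤ
    poly = solve-∀

  ⊠-negate : ∀ P Q Y → (P ⊠ Y) ⊕ (- 1ℤ) ⊛ (Q ⊠ Y) ≡ (- 1ℤ) ⊛ ((Q ⊕ (- 1ℤ) ⊛ P) ⊠ Y)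
  ⊠-negate (mat a b c d) (mat a' b' c' d') (mat e f g h) =
    mat-≡ (entry a b a' b' e g) (entry a b a' b' f h) (entry c d c' d' e g) (entry c d c' d' f h)
    where
    entry : ∀ a b c d e g → a * e + b * g + (- 1ℤ) * (c * e + d * g) ≡ (- 1ℤ) * ((c + (- 1ℤ) * a) * e + (d + (- 1ℤ) * b) * g)
    entry = solve-∀

  comm-swap : ∀ A B → comm B A ≡ (- 1ℤ) ⊛ comm A B
  comm-swap A B = lemma (A ⊠ B) (B ⊠ A)
    where
    poly : ∀ p q → q + (- 1ℤ) * p ≡ (- 1ℤ) * (p + (- 1ℤ) * q)
    poly = solve-∀
    lemma : ∀ P Q → Q ⊕ (- 1ℤ) ⊛ P ≡ (- 1ℤ) ⊛ (P ⊕ (- 1ℤ) ⊛ Q)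
    lemma (mat a b c d) (mat e f g h) = mat-≡ (poly a e) (poly b f) (poly c g) (poly d h)

  O2-⊠ : ∀ A → O2 ⊠ A ≡ O2
  O2-⊠ (mat a b c d) = mat-≡ (poly a c) (poly b d) (poly a c) (poly b d)
    where
    poly : ∀ a c → 0ℤ * a + 0ℤ * c ≡ 0ℤ
    poly = solve-∀

  comm-self : ∀ A → comm A A ≡ O2
  comm-self A = ⊕-self (A ⊠ A)

  comm-⊕ʳ : ∀ A B C → comm A (B ⊕ C) ≡ comm A B ⊕ comm A C
  comm-⊕ʳ A B C = trans (cong₂ (λ P Q → P ⊕ (- 1ℤ) ⊛ Q) (⊠-distribˡ A B C) (⊠-distribʳ A B C))
                        (lemma (A ⊠ B) (A ⊠ C) (B ⊠ A) (C ⊠ A))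
    where
    poly : ∀ p q r s → p + q + (- 1ℤ) * (r + s) ≡ p + (- 1ℤ) * r + (q + (- 1ℤ) * s)
    poly = solve-∀
    lemma : ∀ P Q X Y → (P ⊕ Q) ⊕ (- 1ℤ) ⊛ (X ⊕ Y) ≡ (P ⊕ (- 1ℤ) ⊛ X) ⊕ (Q ⊕ (- 1ℤ) ⊛ Y)
    lemma (mat a b c d) (mat e f g h) (mat i j k l) (mat m n o p) =
      mat-≡ (poly a e i m) (poly b f j n) (poly c g k o) (poly d h l p)

  comm-⊛ʳ : ∀ k A B → comm A (k ⊛ B) ≡ k ⊛ comm A B
  comm-⊛ʳ k A B = trans (cong₂ (λ P Q → P ⊕ (- 1ℤ) ⊛ Q) (⊠-⊛ k A B) (⊛-⊠ k B A)) (lemma (A ⊠ B) (B ⊠ A))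
    where
    poly : ∀ k p q → k * p + (- 1ℤ) * (k * q) ≡ k * (p + (- 1ℤ) * q)
    poly = solve-∀
    lemma : ∀ P Q → k ⊛ P ⊕ (- 1ℤ) ⊛ (k ⊛ Q) ≡ k ⊛ (P ⊕ (- 1ℤ) ⊛ Q)
    lemma (mat a b c d) (mat e f g h) = mat-≡ (poly k a e) (poly k b f) (poly k c g) (poly k d h)

  -- Put C = xy - yx. Both C and C y have trace 0, so the polarised Cayley-Hamilton identity reduces
  -- to C y + y C = tr(y) C, and tr(y) - y is the adjugate of y.
  comm-⊠ : ∀ x y → comm x y ⊠ y ≡ ad y ⊠ comm x y
  comm-⊠ (mat a b c d) (mat e f g h) =
    mat-≡ (p₁ a b c d e f g h) (p₂ a b c d e f g h) (p₃ a b c d e f g h) (p₄ a b c d e f g h)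
    where
    p₁ : ∀ a b c d e f g h →
      (a * e + b * g + (- 1ℤ) * (e * a + f * c)) * e + (a * f + b * h + (- 1ℤ) * (e * b + f * d)) * g
        ≡ h * (a * e + b * g + (- 1ℤ) * (e * a + f * c)) + (- f) * (c * e + d * g + (- 1ℤ) * (g * a + h * c))
    p₁ = solve-∀
    p₂ : ∀ a b c d e f g h →
      (a * e + b * g + (- 1ℤ) * (e * a + f * c)) * f + (a * f + b * h + (- 1ℤ) * (e * b + f * d)) * h
        ≡ h * (a * f + b * h + (- 1ℤ) * (e * b + f * d)) + (- f) * (c * f + d * h + (- 1ℤ) * (g * b + h * d))
    p₂ = solve-∀
    p₃ : ∀ a b c d e f g h →
      (c * e + d * g + (- 1ℤ) * (g * a + h * c)) * e + (c * f + d * h + (- 1ℤ) * (g * b + h * d)) * g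
        ≡ (- g) * (a * e + b * g + (- 1ℤ) * (e * a + f * c)) + e * (c * e + d * g + (- 1ℤ) * (g * a + h * c))
    p₃ = solve-∀
    p₄ : ∀ a b c d e f g h →
      (c * e + d * g + (- 1ℤ) * (g * a + h * c)) * f + (c * f + d * h + (- 1ℤ) * (g * b + h * d)) * h
        ≡ (- g) * (a * f + b * h + (- 1ℤ) * (e * b + f * d)) + e * (c * f + d * h + (- 1ℤ) * (g * b + h * d))
    p₄ = solve-∀

-- Commutators in the algebra spanned by 1, x, y, xy.

module _ (x y : M2) where

  -- The commutators of elements of the algebra spanned by 1, x, y, xy are left multiples of xy - yx,
  -- because (xy - yx) y = ad y (xy - yx).
  LeftMultiple : M2 → Set
  LeftMultiple A = ∃ λ Z → A ≡ Z ⊠ comm x y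

  lm-⊕ : ∀ {A B} → LeftMultiple A → LeftMultiple B → LeftMultiple (A ⊕ B)
  lm-⊕ (Z , refl) (Z' , refl) = Z ⊕ Z' , sym (⊠-distribʳ (comm x y) Z Z')

  lm-⊛ : ∀ k {A} → LeftMultiple A → LeftMultiple (k ⊛ A)
  lm-⊛ k (Z , refl) = k ⊛ Z , sym (⊛-⊠ k Z (comm x y))

  lm-O : LeftMultiple O2
  lm-O = O2 , sym (O2-⊠ (comm x y))

  span : ℤ → ℤ → ℤ → ℤ → M2
  span α β γ δ = α ⊛ I2 ⊕ β ⊛ x ⊕ γ ⊛ y ⊕ δ ⊛ (x ⊠ y)

  comm-linearʳ : (P : M2 → Set) → (∀ {A B} → P A → P B → P (A ⊕ B)) → (∀ k {A} → P A → P (k ⊛ A)) →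
    ∀ A α β γ δ → P (comm A I2) → P (comm A x) → P (comm A y) → P (comm A (x ⊠ y)) → P (comm A (span α β γ δ))
  comm-linearʳ P plus times A α β γ δ p₁ p₂ p₃ p₄ =
    subst P (sym (trans (comm-⊕ʳ A _ _) (cong₂ _⊕_ (comm-⊛ʳ α A I2)
      (trans (comm-⊕ʳ A _ _) (cong₂ _⊕_ (comm-⊛ʳ β A x)
        (trans (comm-⊕ʳ A _ _) (cong₂ _⊕_ (comm-⊛ʳ γ A y) (comm-⊛ʳ δ A (x ⊠ y)))))))))
      (plus (times α p₁) (plus (times β p₂) (plus (times γ p₃) (times δ p₄))))

  lm-swap : ∀ A B → LeftMultiple (comm A B) → LeftMultiple (comm B A)
  lm-swap A B p = subst LeftMultiple (sym (comm-swap A B)) (lm-⊛ (- 1ℤ) p)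

  lm-I : ∀ A → LeftMultiple (comm A I2)
  lm-I A = subst LeftMultiple (sym (trans (cong₂ (λ P Q → P ⊕ (- 1ℤ) ⊛ Q) (⊠-identityʳ A) (⊠-identityˡ A)) (⊕-self A))) lm-O

  lm-self : ∀ A → LeftMultiple (comm A A)
  lm-self A = subst LeftMultiple (sym (comm-self A)) lm-O

  lm-x-y : LeftMultiple (comm x y)
  lm-x-y = I2 , sym (⊠-identityˡ (comm x y))

  lm-x-xy : LeftMultiple (comm x (x ⊠ y))
  lm-x-xy = x , trans (cong (λ z → x ⊠ (x ⊠ y) ⊕ (- 1ℤ) ⊛ z) (⊠-assoc x y x))
    (trans (cong (x ⊠ (x ⊠ y) ⊕_) (sym (⊠-⊛ (- 1ℤ) x (y ⊠ x)))) (sym (⊠-distribˡ x (x ⊠ y) _)))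

  lm-y-xy : LeftMultiple (comm y (x ⊠ y))
  lm-y-xy = (- 1ℤ) ⊛ ad y , trans (cong (_⊕ (- 1ℤ) ⊛ ((x ⊠ y) ⊠ y)) (sym (⊠-assoc y x y)))
    (trans (⊠-negate (y ⊠ x) (x ⊠ y) y) (trans (cong ((- 1ℤ) ⊛_) (comm-⊠ x y)) (sym (⊛-⊠ (- 1ℤ) (ad y) (comm x y)))))

  lm-span : ∀ α β γ δ α' β' γ' δ' → LeftMultiple (comm (span α β γ δ) (span α' β' γ' δ'))
  lm-span α β γ δ α' β' γ' δ' = comm-linearʳ LeftMultiple lm-⊕ lm-⊛ A α' β' γ' δ' (lm-I A)
    (row x (lm-self x) (lm-x-y) (lm-x-xy))
    (row y (lm-swap x y lm-x-y) (lm-self y) lm-y-xy)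
    (row (x ⊠ y) (lm-swap x (x ⊠ y) lm-x-xy) (lm-swap y (x ⊠ y) lm-y-xy) (lm-self (x ⊠ y)))
    where
    A = span α β γ δ
    row : ∀ C → LeftMultiple (comm C x) → LeftMultiple (comm C y) → LeftMultiple (comm C (x ⊠ y)) → LeftMultiple (comm A C)
    row C p q r = lm-swap C A (comm-linearʳ LeftMultiple lm-⊕ lm-⊛ C α β γ δ (lm-I C) p q r)

-- The span of 1, x, y, xy is closed under multiplication as soon as squares and reversed products can be
-- rewritten linearly (Cayley-Hamilton and its polarisation).
module Span {Mat : Set} (_⊠_ _⊕_ : Mat → Mat → Mat) (_⊛_ : ℤ → Mat → Mat) (I : Mat) (t d : Mat → ℤ)
  (_≋_ : Mat → Mat → Set)
  (≋-reflexive : ∀ {A B} → A ≡ B → A ≋ B) (≋-sym : ∀ {A B} → A ≋ B → B ≋ A)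
  (≋-trans : ∀ {A B C} → A ≋ B → B ≋ C → A ≋ C)
  (≋-⊠ : ∀ {A B C D} → A ≋ B → C ≋ D → (A ⊠ C) ≋ (B ⊠ D))
  (≋-⊕ : ∀ {A B C D} → A ≋ B → C ≋ D → (A ⊕ C) ≋ (B ⊕ D))
  (≋-⊛ : ∀ k {A B} → A ≋ B → (k ⊛ A) ≋ (k ⊛ B))
  (⊠-assoc : ∀ A B C → ((A ⊠ B) ⊠ C) ≡ (A ⊠ (B ⊠ C)))
  (⊠-identityˡ : ∀ A → (I ⊠ A) ≡ A) (⊠-identityʳ : ∀ A → (A ⊠ I) ≡ A)
  (⊠-distribˡ : ∀ A B C → (A ⊠ (B ⊕ C)) ≡ ((A ⊠ B) ⊕ (A ⊠ C)))
  (⊠-distribʳ : ∀ A B C → ((B ⊕ C) ⊠ A) ≡ ((B ⊠ A) ⊕ (C ⊠ A)))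
  (⊠-⊛ : ∀ k A B → (A ⊠ (k ⊛ B)) ≡ (k ⊛ (A ⊠ B))) (⊛-⊠ : ∀ k A B → ((k ⊛ A) ⊠ B) ≡ (k ⊛ (A ⊠ B)))
  (⊛-⊛ : ∀ k l A → (k ⊛ (l ⊛ A)) ≡ ((k * l) ⊛ A))
  (⊛-distribˡ : ∀ k A B → (k ⊛ (A ⊕ B)) ≡ ((k ⊛ A) ⊕ (k ⊛ B)))
  (⊛-distribʳ : ∀ k l A → ((k ⊛ A) ⊕ (l ⊛ A)) ≡ ((k + l) ⊛ A))
  (⊕-medial : ∀ A B C D → ((A ⊕ B) ⊕ (C ⊕ D)) ≡ ((A ⊕ C) ⊕ (B ⊕ D)))
  (⊛-identity : ∀ A → (1ℤ ⊛ A) ≡ A)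
  (0⊛-⊕ : ∀ A B → ((0ℤ ⊛ A) ⊕ B) ≡ B) (⊕-0⊛ : ∀ A B → (B ⊕ (0ℤ ⊛ A)) ≡ B)
  (cayley-hamilton : ∀ A → (A ⊠ A) ≡ ((t A ⊛ A) ⊕ ((- d A) ⊛ I)))
  (swap : ∀ A B → (B ⊠ A) ≡ (((- 1ℤ) ⊛ (A ⊠ B)) ⊕ ((t B ⊛ A) ⊕ ((t A ⊛ B) ⊕ ((t (A ⊠ B) - t A * t B) ⊛ I)))))
  (x y : Mat) where

  span′ : ℤ → ℤ → ℤ → ℤ → Mat
  span′ α β γ δ = (α ⊛ I) ⊕ ((β ⊛ x) ⊕ ((γ ⊛ y) ⊕ (δ ⊛ (x ⊠ y))))

  InB : Mat → Set
  InB A = ∃ λ α → ∃ λ β → ∃ λ γ → ∃ λ δ → A ≋ span′ α β γ δ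

  InB-≋ : ∀ {A B} → A ≋ B → InB A → InB B
  InB-≋ p (α , β , γ , δ , r) = α , β , γ , δ , ≋-trans (≋-sym p) r

  InB-≡ : ∀ {A B} → B ≡ A → InB A → InB B
  InB-≡ p = InB-≋ (≋-reflexive (sym p))

  InB-⊕ : ∀ {A B} → InB A → InB B → InB (A ⊕ B)
  InB-⊕ (α , β , γ , δ , p) (α' , β' , γ' , δ' , p') = α + α' , β + β' , γ + γ' , δ + δ' ,
    ≋-trans (≋-⊕ p p') (≋-reflexive (collect α α' I (collect β β' x (collect γ γ' y (⊛-distribʳ δ δ' (x ⊠ y))))))
    where
    collect : ∀ k l A {B C D} → (B ⊕ C) ≡ D → (((k ⊛ A) ⊕ B) ⊕ ((l ⊛ A) ⊕ C)) ≡ (((k + l) ⊛ A) ⊕ D)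
    collect k l A {B} {C} eq = trans (⊕-medial (k ⊛ A) B (l ⊛ A) C) (cong₂ _⊕_ (⊛-distribʳ k l A) eq)

  InB-⊛ : ∀ k {A} → InB A → InB (k ⊛ A)
  InB-⊛ k (α , β , γ , δ , p) = k * α , k * β , k * γ , k * δ ,
    ≋-trans (≋-⊛ k p) (≋-reflexive (push α I (push β x (push γ y (⊛-⊛ k δ (x ⊠ y))))))
    where
    push : ∀ l A {B C} → (k ⊛ B) ≡ C → (k ⊛ ((l ⊛ A) ⊕ B)) ≡ (((k * l) ⊛ A) ⊕ C)
    push l A {B} eq = trans (⊛-distribˡ k (l ⊛ A) B) (cong₂ _⊕_ (⊛-⊛ k l A) eq)

  InB-I : InB I
  InB-I = 1ℤ , 0ℤ , 0ℤ , 0ℤ , ≋-sym (≋-reflexive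
    (trans (cong ((1ℤ ⊛ I) ⊕_) (trans (0⊛-⊕ x _) (0⊛-⊕ y _))) (trans (⊕-0⊛ _ _) (⊛-identity I))))

  InB-x : InB x
  InB-x = 0ℤ , 1ℤ , 0ℤ , 0ℤ , ≋-sym (≋-reflexive
    (trans (0⊛-⊕ I _) (trans (cong ((1ℤ ⊛ x) ⊕_) (0⊛-⊕ y _)) (trans (⊕-0⊛ _ _) (⊛-identity x)))))

  InB-y : InB y
  InB-y = 0ℤ , 0ℤ , 1ℤ , 0ℤ , ≋-sym (≋-reflexive
    (trans (0⊛-⊕ I _) (trans (0⊛-⊕ x _) (trans (⊕-0⊛ _ _) (⊛-identity y)))))

  InB-xy : InB (x ⊠ y)
  InB-xy = 0ℤ , 0ℤ , 0ℤ , 1ℤ , ≋-sym (≋-reflexive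
    (trans (0⊛-⊕ I _) (trans (0⊛-⊕ x _) (trans (0⊛-⊕ y _) (⊛-identity (x ⊠ y))))))

  InB-square : ∀ {A} → InB A → InB (A ⊠ A)
  InB-square {A} p = InB-≡ (cayley-hamilton A) (InB-⊕ (InB-⊛ (t A) p) (InB-⊛ (- d A) InB-I))

  private
    κ = t (x ⊠ y) - t x * t y

    distribute : ∀ A α β γ δ → (A ⊠ span′ α β γ δ)
      ≡ ((α ⊛ A) ⊕ ((β ⊛ (A ⊠ x)) ⊕ ((γ ⊛ (A ⊠ y)) ⊕ (δ ⊛ (A ⊠ (x ⊠ y))))))
    distribute A α β γ δ = trans (⊠-distribˡ A _ _) (cong₂ _⊕_ (trans (⊠-⊛ α A I) (cong (α ⊛_) (⊠-identityʳ A)))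
      (trans (⊠-distribˡ A _ _) (cong₂ _⊕_ (⊠-⊛ β A x)
        (trans (⊠-distribˡ A _ _) (cong₂ _⊕_ (⊠-⊛ γ A y) (⊠-⊛ δ A (x ⊠ y)))))))

    left-multiple : ∀ A → InB A → InB (A ⊠ x) → InB (A ⊠ y) → InB (A ⊠ (x ⊠ y)) → ∀ {B} → InB B → InB (A ⊠ B)
    left-multiple A p p₁ p₂ p₃ (α , β , γ , δ , eq) = InB-≋ (≋-sym (≋-⊠ (≋-reflexive refl) eq))
      (InB-≡ (distribute A α β γ δ) (InB-⊕ (InB-⊛ α p) (InB-⊕ (InB-⊛ β p₁) (InB-⊕ (InB-⊛ γ p₂) (InB-⊛ δ p₃)))))

  InB-x⊠ : ∀ {B} → InB B → InB (x ⊠ B)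
  InB-x⊠ = left-multiple x InB-x (InB-square InB-x) InB-xy
    (InB-≡ (trans (sym (⊠-assoc x x y)) (trans (cong (_⊠ y) (cayley-hamilton x)) (trans (⊠-distribʳ y _ _)
             (cong₂ _⊕_ (⊛-⊠ (t x) x y) (trans (⊛-⊠ (- d x) I y) (cong ((- d x) ⊛_) (⊠-identityˡ y)))))))
           (InB-⊕ (InB-⊛ (t x) InB-xy) (InB-⊛ (- d x) InB-y)))

  InB-y⊠ : ∀ {B} → InB B → InB (y ⊠ B)
  InB-y⊠ = left-multiple y InB-y
    (InB-≡ (swap x y) (InB-⊕ (InB-⊛ (- 1ℤ) InB-xy) (InB-⊕ (InB-⊛ (t y) InB-x) (InB-⊕ (InB-⊛ (t x) InB-y) (InB-⊛ κ InB-I)))))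
    (InB-square InB-y)
    (InB-≡ (trans (sym (⊠-assoc y x y)) (trans (cong (_⊠ y) (swap x y)) (trans (⊠-distribʳ y _ _)
             (cong₂ _⊕_ (trans (⊛-⊠ (- 1ℤ) (x ⊠ y) y) (cong ((- 1ℤ) ⊛_) (⊠-assoc x y y)))
               (trans (⊠-distribʳ y _ _) (cong₂ _⊕_ (⊛-⊠ (t y) x y)
                 (trans (⊠-distribʳ y _ _) (cong₂ _⊕_ (⊛-⊠ (t x) y y)
                   (trans (⊛-⊠ κ I y) (cong (κ ⊛_) (⊠-identityˡ y)))))))))))
           (InB-⊕ (InB-⊛ (- 1ℤ) (InB-x⊠ (InB-square InB-y)))
             (InB-⊕ (InB-⊛ (t y) InB-xy) (InB-⊕ (InB-⊛ (t x) (InB-square InB-y)) (InB-⊛ κ InB-y)))))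

  InB-⊠ : ∀ {A B} → InB A → InB B → InB (A ⊠ B)
  InB-⊠ {A} {B} (α , β , γ , δ , p) b = InB-≋ (≋-sym (≋-⊠ p (≋-reflexive refl))) (InB-≡ expand
    (InB-⊕ (InB-⊛ α b) (InB-⊕ (InB-⊛ β (InB-x⊠ b)) (InB-⊕ (InB-⊛ γ (InB-y⊠ b)) (InB-⊛ δ (InB-x⊠ (InB-y⊠ b)))))))
    where
    expand : (span′ α β γ δ ⊠ B) ≡ ((α ⊛ B) ⊕ ((β ⊛ (x ⊠ B)) ⊕ ((γ ⊛ (y ⊠ B)) ⊕ (δ ⊛ (x ⊠ (y ⊠ B))))))
    expand = trans (⊠-distribʳ B _ _) (cong₂ _⊕_ (trans (⊛-⊠ α I B) (cong (α ⊛_) (⊠-identityˡ B)))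
      (trans (⊠-distribʳ B _ _) (cong₂ _⊕_ (⊛-⊠ β x B)
        (trans (⊠-distribʳ B _ _) (cong₂ _⊕_ (⊛-⊠ γ y B) (trans (⊛-⊠ δ (x ⊠ y) B) (cong (δ ⊛_) (⊠-assoc x y B))))))))

-- Matrices modulo q.

module Mod (q : ℤ) where

  infix 4 _≡ᵐ_ _≋_

  -- A record instead of the bare divisibility, so that `i` and `j` can be inferred from the type.
  record _≡ᵐ_ (i j : ℤ) : Set where
    constructor mk≡ᵐ
    field
      difference : q ∣ i - j

  open _≡ᵐ_ public

  ≡ᵐ-reflexive : ∀ {i j} → i ≡ j → i ≡ᵐ j
  ≡ᵐ-reflexive {i} refl = mk≡ᵐ (divides 0ℤ (poly i q))
    where
    poly : ∀ i q → i - i ≡ 0ℤ * q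
    poly = solve-∀

  ≡ᵐ-refl : ∀ i → i ≡ᵐ i
  ≡ᵐ-refl i = ≡ᵐ-reflexive refl

  ≡ᵐ-sym : ∀ {i j} → i ≡ᵐ j → j ≡ᵐ i
  ≡ᵐ-sym {i} {j} (mk≡ᵐ p) = mk≡ᵐ (subst (q ∣_) (poly i j) (∣m⇒∣-m p))
    where
    poly : ∀ i j → - (i - j) ≡ j - i
    poly = solve-∀

  ≡ᵐ-trans : ∀ {i j k} → i ≡ᵐ j → j ≡ᵐ k → i ≡ᵐ k
  ≡ᵐ-trans {i} {j} {k} (mk≡ᵐ p) (mk≡ᵐ r) = mk≡ᵐ (subst (q ∣_) (poly i j k) (∣m∣n⇒∣m+n p r))
    where
    poly : ∀ i j k → (i - j) + (j - k) ≡ i - k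
    poly = solve-∀

  ≡ᵐ-+ : ∀ {i j k l} → i ≡ᵐ j → k ≡ᵐ l → i + k ≡ᵐ j + l
  ≡ᵐ-+ {i} {j} {k} {l} (mk≡ᵐ p) (mk≡ᵐ r) = mk≡ᵐ (subst (q ∣_) (poly i j k l) (∣m∣n⇒∣m+n p r))
    where
    poly : ∀ i j k l → (i - j) + (k - l) ≡ (i + k) - (j + l)
    poly = solve-∀

  ≡ᵐ-* : ∀ {i j k l} → i ≡ᵐ j → k ≡ᵐ l → i * k ≡ᵐ j * l
  ≡ᵐ-* {i} {j} {k} {l} (mk≡ᵐ p) (mk≡ᵐ r) = mk≡ᵐ (subst (q ∣_) (poly i j k l) (∣m∣n⇒∣m+n (∣m⇒∣m*n k p) (∣n⇒∣m*n j r)))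
    where
    poly : ∀ i j k l → (i - j) * k + j * (k - l) ≡ i * k - j * l
    poly = solve-∀

  ≡ᵐ-neg : ∀ {i j} → i ≡ᵐ j → - i ≡ᵐ - j
  ≡ᵐ-neg {i} {j} (mk≡ᵐ p) = mk≡ᵐ (subst (q ∣_) (poly i j) (∣m⇒∣-m p))
    where
    poly : ∀ i j → - (i - j) ≡ - i - - j
    poly = solve-∀

  ≡ᵐ-∣ : ∀ {i j} → i ≡ᵐ j → q ∣ j → q ∣ i
  ≡ᵐ-∣ {i} {j} (mk≡ᵐ p) r = subst (q ∣_) (poly i j) (∣m∣n⇒∣m+n p r)
    where
    poly : ∀ i j → (i - j) + j ≡ i
    poly = solve-∀

  record _≋_ (A B : M2) : Set where
    constructor ≋-mk
    field
      ≋a : M2.a A ≡ᵐ M2.a B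
      ≋b : M2.b A ≡ᵐ M2.b B
      ≋c : M2.c A ≡ᵐ M2.c B
      ≋d : M2.d A ≡ᵐ M2.d B

  ≋-refl : ∀ A → A ≋ A
  ≋-refl A = ≋-mk (≡ᵐ-refl _) (≡ᵐ-refl _) (≡ᵐ-refl _) (≡ᵐ-refl _)

  ≋-reflexive : ∀ {A B} → A ≡ B → A ≋ B
  ≋-reflexive {A} refl = ≋-refl A

  ≋-sym : ∀ {A B} → A ≋ B → B ≋ A
  ≋-sym (≋-mk p q r s) = ≋-mk (≡ᵐ-sym p) (≡ᵐ-sym q) (≡ᵐ-sym r) (≡ᵐ-sym s)

  ≋-trans : ∀ {A B C} → A ≋ B → B ≋ C → A ≋ C
  ≋-trans (≋-mk p q r s) (≋-mk p' q' r' s') = ≋-mk (≡ᵐ-trans p p') (≡ᵐ-trans q q') (≡ᵐ-trans r r') (≡ᵐ-trans s s')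

  opaque
    unfolding _⊠_ _⊕_ _⊛_ tr dt

    ≋-⊠ : ∀ {A B C D} → A ≋ B → C ≋ D → A ⊠ C ≋ B ⊠ D
    ≋-⊠ (≋-mk a b c d) (≋-mk e f g h) =
      ≋-mk (≡ᵐ-+ (≡ᵐ-* a e) (≡ᵐ-* b g)) (≡ᵐ-+ (≡ᵐ-* a f) (≡ᵐ-* b h)) (≡ᵐ-+ (≡ᵐ-* c e) (≡ᵐ-* d g)) (≡ᵐ-+ (≡ᵐ-* c f) (≡ᵐ-* d h))

    ≋-⊕ : ∀ {A B C D} → A ≋ B → C ≋ D → A ⊕ C ≋ B ⊕ D
    ≋-⊕ (≋-mk a b c d) (≋-mk e f g h) = ≋-mk (≡ᵐ-+ a e) (≡ᵐ-+ b f) (≡ᵐ-+ c g) (≡ᵐ-+ d h)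

    ≋-⊛ : ∀ {k l A B} → k ≡ᵐ l → A ≋ B → k ⊛ A ≋ l ⊛ B
    ≋-⊛ k (≋-mk a b c d) = ≋-mk (≡ᵐ-* k a) (≡ᵐ-* k b) (≡ᵐ-* k c) (≡ᵐ-* k d)

    dt-≋ : ∀ {A B} → A ≋ B → dt A ≡ᵐ dt B
    dt-≋ (≋-mk a b c d) = ≡ᵐ-+ (≡ᵐ-* a d) (≡ᵐ-neg (≡ᵐ-* b c))

    tr-≋ : ∀ {A B} → A ≋ B → tr A ≡ᵐ tr B
    tr-≋ (≋-mk a b c d) = ≡ᵐ-+ a d

  ≋-⊠ˡ : ∀ C {A B} → A ≋ B → C ⊠ A ≋ C ⊠ B
  ≋-⊠ˡ C p = ≋-⊠ (≋-refl C) p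

  ≋-⊠ʳ : ∀ C {A B} → A ≋ B → A ⊠ C ≋ B ⊠ C
  ≋-⊠ʳ C p = ≋-⊠ p (≋-refl C)

  ≋-⊛ˡ : ∀ k {A B} → A ≋ B → k ⊛ A ≋ k ⊛ B
  ≋-⊛ˡ k p = ≋-⊛ (≡ᵐ-refl k) p

  comm-≋ : ∀ {A B C D} → A ≋ B → C ≋ D → comm A C ≋ comm B D
  comm-≋ p r = ≋-⊕ (≋-⊠ p r) (≋-⊛ (≡ᵐ-refl (- 1ℤ)) (≋-⊠ r p))

  module Algebra (x y : M2) where

    open Span _⊠_ _⊕_ _⊛_ I2 tr dt _≋_ ≋-reflexive ≋-sym ≋-trans ≋-⊠ ≋-⊕ ≋-⊛ˡ
      ⊠-assoc ⊠-identityˡ ⊠-identityʳ ⊠-distribˡ ⊠-distribʳ ⊠-⊛ ⊛-⊠ ⊛-⊛ ⊛-distribˡ ⊛-distribʳ ⊕-medial ⊛-identity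
      0⊛-⊕ ⊕-0⊛ cayley-hamilton swap x y public using (InB; InB-≋; InB-≡; InB-⊕; InB-⊛; InB-I; InB-x; InB-y; InB-⊠)

    InB-ad : ∀ {A} → InB A → InB (ad A)
    InB-ad {A} p = InB-≡ (ad-tr A) (InB-⊕ (InB-⊛ (tr A) InB-I) (InB-⊛ (- 1ℤ) p))

    -- Modulo q the commutator of `A` and `B` has the form Z (xy - yx), and determinants multiply.
    dt-comm-InB : ∀ {A B} → q ∣ dt (comm x y) → InB A → InB B → q ∣ dt (comm A B)
    dt-comm-InB d (α , β , γ , δ , p) (α' , β' , γ' , δ' , p') with lm-span x y α β γ δ α' β' γ' δ'
    ... | Z , eq = ≡ᵐ-∣ (dt-≋ (comm-≋ p p'))
      (subst (q ∣_) (sym (trans (cong dt eq) (dt-⊠ Z (comm x y)))) (∣n⇒∣m*n (dt Z) d))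

module Residues (q : ℕ) .{{_ : NonZero q}} where

  open Mod (+ q)

  residue-≡ᵐ : ∀ i → i ≡ᵐ + (i %ℕ q)
  residue-≡ᵐ i = mk≡ᵐ (divides (i /ℕ q) (trans (cong (_- + (i %ℕ q)) (a≡a%ℕn+[a/ℕn]*n i q)) (poly (+ (i %ℕ q)) (i /ℕ q * + q))))
    where
    poly : ∀ r s → r + s - r ≡ s
    poly = solve-∀

  toFin : ℤ → Fin q
  toFin i = fromℕ< (n%ℕd<d i q)

  toFin-≡ᵐ : ∀ i → i ≡ᵐ + toℕ (toFin i)
  toFin-≡ᵐ i = subst (λ n → i ≡ᵐ + n) (sym (toℕ-fromℕ< (n%ℕd<d i q))) (residue-≡ᵐ i)

  toFin-injective : ∀ {i j} → toFin i ≡ toFin j → i ≡ᵐ j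
  toFin-injective {i} {j} eq = ≡ᵐ-trans (toFin-≡ᵐ i) (≡ᵐ-trans (≡ᵐ-reflexive (cong (λ k → + toℕ k) eq)) (≡ᵐ-sym (toFin-≡ᵐ j)))

  Q : ℕ
  Q = q ℕ.* (q ℕ.* (q ℕ.* q))

  encode : M2 → Fin Q
  encode (mat a b c d) = combine (toFin a) (combine (toFin b) (combine (toFin c) (toFin d)))

  private
    q² = q ℕ.* q
    q³ = q ℕ.* q²

    head² : Fin q² → ℤ
    head² k = + toℕ (proj₁ (remQuot {q} q k))
    last² : Fin q² → ℤ
    last² k = + toℕ (proj₂ (remQuot {q} q k))
    head³ : Fin q³ → ℤ
    head³ j = + toℕ (proj₁ (remQuot {q} q² j))
    tail³ : Fin q³ → Fin q²
    tail³ j = proj₂ (remQuot {q} q² j)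
    head⁴ : Fin Q → ℤ
    head⁴ i = + toℕ (proj₁ (remQuot {q} q³ i))
    tail⁴ : Fin Q → Fin q³
    tail⁴ i = proj₂ (remQuot {q} q³ i)

  decode : Fin Q → M2
  decode i = mat (head⁴ i) (head³ (tail⁴ i)) (head² (tail³ (tail⁴ i))) (last² (tail³ (tail⁴ i)))

  decode-encode : ∀ A → decode (encode A) ≋ A
  decode-encode (mat a b c d) = ≋-trans (≋-reflexive digits) (≋-sym (≋-mk (toFin-≡ᵐ a) (toFin-≡ᵐ b) (toFin-≡ᵐ c) (toFin-≡ᵐ d)))
    where
    cd = combine (toFin c) (toFin d)
    bcd = combine (toFin b) cd
    t⁴ : tail⁴ (combine (toFin a) bcd) ≡ bcd
    t⁴ = cong proj₂ (remQuot-combine (toFin a) bcd)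
    t³ : tail³ (tail⁴ (combine (toFin a) bcd)) ≡ cd
    t³ = trans (cong tail³ t⁴) (cong proj₂ (remQuot-combine (toFin b) cd))
    digits : decode (encode (mat a b c d)) ≡ mat (+ toℕ (toFin a)) (+ toℕ (toFin b)) (+ toℕ (toFin c)) (+ toℕ (toFin d))
    digits = mat-≡ (cong (λ z → + toℕ (proj₁ z)) (remQuot-combine (toFin a) bcd))
      (trans (cong head³ t⁴) (cong (λ z → + toℕ (proj₁ z)) (remQuot-combine (toFin b) cd)))
      (trans (cong head² t³) (cong (λ z → + toℕ (proj₁ z)) (remQuot-combine (toFin c) (toFin d))))
      (trans (cong last² t³) (cong (λ z → + toℕ (proj₂ z)) (remQuot-combine (toFin c) (toFin d))))

  encode-injective : ∀ {A B} → encode A ≡ encode B → A ≋ B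
  encode-injective {A} {B} eq = ≋-trans (≋-sym (decode-encode A)) (≋-trans (≋-reflexive (cong decode eq)) (decode-encode B))

module ModDec (q : ℕ) .{{_ : NonZero q}} (x y : M2) where

  open Mod (+ q)
  open Algebra x y
  open Residues q using (toFin; toFin-≡ᵐ)

  _≋?_ : ∀ A B → Dec (A ≋ B)
  A ≋? B = map′ (λ (p , q , r , s) → ≋-mk p q r s) (λ (≋-mk p q r s) → p , q , r , s)
    (_ ≡ᵐ? _ ×-dec _ ≡ᵐ? _ ×-dec _ ≡ᵐ? _ ×-dec _ ≡ᵐ? _)
    where
    _≡ᵐ?_ : ∀ i j → Dec (i ≡ᵐ j)
    i ≡ᵐ? j = map′ mk≡ᵐ difference (+ q ∣? (i - j))

  opaque

    -- Decidability matters because the indicator weights of a coset and the search along a path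
    -- both branch on membership. Coefficients count only modulo q, so finitely many have to be
    -- tried.
    InB? : ∀ A → Dec (InB A)
    InB? A = map′
      (λ (i , j , k , l , p) → + toℕ i , + toℕ j , + toℕ k , + toℕ l , p)
      (λ (α , β , γ , δ , p) → toFin α , toFin β , toFin γ , toFin δ , ≋-trans p
        (≋-⊕ (≋-⊛ (toFin-≡ᵐ α) (≋-refl I2)) (≋-⊕ (≋-⊛ (toFin-≡ᵐ β) (≋-refl x))
          (≋-⊕ (≋-⊛ (toFin-≡ᵐ γ) (≋-refl y)) (≋-⊛ (toFin-≡ᵐ δ) (≋-refl (x ⊠ y)))))))
      (any? λ (i : Fin q) → any? λ (j : Fin q) → any? λ (k : Fin q) → any? λ (l : Fin q) →
        A ≋? span x y (+ toℕ i) (+ toℕ j) (+ toℕ k) (+ toℕ l))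

-- A family of integral representations.

module Rep (a : ℤ) where

  -- `ρS` has trace 0 and determinant -1, hence square 1, and `ρU` has trace -1 and determinant 1,
  -- hence cube 1. So every `a` gives a representation of PSL₂(ℤ) with determinants ±1. The
  -- determinant -1 is what allows an involution other than ±1.
  ρS ρU : M2
  ρS = mat a (- (1ℤ + a)) (a - 1ℤ) (- a)
  ρU = mat 0ℤ 1ℤ (- 1ℤ) (- 1ℤ)

  ρ : Word → M2
  ρ []      = I2
  ρ (S ∷ w) = ρS ⊠ ρ w
  ρ (U ∷ w) = ρU ⊠ ρ w

  ρ-++ : ∀ v w → ρ (v ++ w) ≡ ρ v ⊠ ρ w
  ρ-++ []      w = sym (⊠-identityˡ (ρ w))
  ρ-++ (S ∷ v) w = trans (cong (ρS ⊠_) (ρ-++ v w)) (sym (⊠-assoc ρS (ρ v) (ρ w)))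
  ρ-++ (U ∷ v) w = trans (cong (ρU ⊠_) (ρ-++ v w)) (sym (⊠-assoc ρU (ρ v) (ρ w)))

  opaque
   unfolding _⊠_ dt

   ρUUU : ρU ⊠ (ρU ⊠ ρU) ≡ I2
   ρUUU = refl

   dt-ρU : dt ρU ≡ 1ℤ
   dt-ρU = refl

   dt-ρS : dt ρS ≡ - 1ℤ
   dt-ρS = poly a
    where
    poly : ∀ a → a * (- a) - (- (1ℤ + a)) * (a - 1ℤ) ≡ - 1ℤ
    poly = solve-∀

   dt-I2 : dt I2 ≡ 1ℤ
   dt-I2 = refl

   ρSS : ρS ⊠ ρS ≡ I2
   ρSS = mat-≡ (p₁ a) (p₂ a) (p₃ a) (p₄ a)
    where
    p₁ : ∀ a → a * a + (- (1ℤ + a)) * (a - 1ℤ) ≡ 1ℤ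
    p₁ = solve-∀
    p₂ : ∀ a → a * (- (1ℤ + a)) + (- (1ℤ + a)) * (- a) ≡ 0ℤ
    p₂ = solve-∀
    p₃ : ∀ a → (a - 1ℤ) * a + (- a) * (a - 1ℤ) ≡ 0ℤ
    p₃ = solve-∀
    p₄ : ∀ a → (a - 1ℤ) * (- (1ℤ + a)) + (- a) * (- a) ≡ 1ℤ
    p₄ = solve-∀

  ρ-R : ∀ {σ v w} → R σ v w → ρ v ≡ ρ w
  ρ-R R-refl         = refl
  ρ-R (R-sym p)      = sym (ρ-R p)
  ρ-R (R-trans p p') = trans (ρ-R p) (ρ-R p')
  ρ-R (R-cons S p)   = cong (ρS ⊠_) (ρ-R p)
  ρ-R (R-cons U p)   = cong (ρU ⊠_) (ρ-R p)
  ρ-R (R-SS {w})     = trans (sym (⊠-assoc ρS ρS (ρ w))) (trans (cong (_⊠ ρ w) ρSS) (⊠-identityˡ (ρ w)))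
  ρ-R (R-UUU {w})    = trans (cong (ρU ⊠_) (sym (⊠-assoc ρU ρU (ρ w))))
    (trans (sym (⊠-assoc ρU (ρU ⊠ ρU) (ρ w))) (trans (cong (_⊠ ρ w) ρUUU) (⊠-identityˡ (ρ w))))

  ρ-∼ : ∀ {v w} → v ∼ w → ρ v ≡ ρ w
  ρ-∼ (σ , p) = ρ-R p

  dt²-ρ : ∀ w → dt (ρ w) * dt (ρ w) ≡ 1ℤ
  dt²-ρ []      = cong₂ _*_ dt-I2 dt-I2
  dt²-ρ (S ∷ w) = trans (cong (λ z → z * z) (trans (dt-⊠ ρS (ρ w)) (cong (_* dt (ρ w)) dt-ρS))) (trans (poly (dt (ρ w))) (dt²-ρ w))
    where
    poly : ∀ z → (- 1ℤ) * z * ((- 1ℤ) * z) ≡ z * z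
    poly = solve-∀
  dt²-ρ (U ∷ w) = trans (cong (λ z → z * z) (trans (dt-⊠ ρU (ρ w)) (trans (cong (_* dt (ρ w)) dt-ρU) (*-identityˡ (dt (ρ w)))))) (dt²-ρ w)

  ρ-inverseˡ : ∀ w → ρ (winv w) ⊠ ρ w ≡ I2
  ρ-inverseˡ w = trans (sym (ρ-++ (winv w) w)) (ρ-∼ (winv-inverseˡ w))

  ρ-winv : ∀ w → ρ (winv w) ≡ dt (ρ w) ⊛ ad (ρ w)
  ρ-winv w = sym (begin
    D ⊛ ad A                       ≡⟨ cong (D ⊛_) (sym (⊠-identityˡ (ad A))) ⟩
    D ⊛ (I2 ⊠ ad A)                ≡⟨ cong (λ z → D ⊛ (z ⊠ ad A)) (sym (ρ-inverseˡ w)) ⟩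
    D ⊛ ((B ⊠ A) ⊠ ad A)           ≡⟨ cong (D ⊛_) (trans (⊠-assoc B A (ad A)) (cong (B ⊠_) (⊠-ad A))) ⟩
    D ⊛ (B ⊠ (D ⊛ I2))              ≡⟨ cong (D ⊛_) (trans (⊠-⊛ D B I2) (cong (D ⊛_) (⊠-identityʳ B))) ⟩
    D ⊛ (D ⊛ B)                     ≡⟨ ⊛-⊛ D D B ⟩
    (D * D) ⊛ B                     ≡⟨ cong (_⊛ B) (dt²-ρ w) ⟩
    1ℤ ⊛ B                          ≡⟨ ⊛-identity B ⟩
    B                               ∎)
    where
    open ≡-Reasoning
    A = ρ w
    B = ρ (winv w)
    D = dt A

  -- Polarise the determinant of P - Q for P = A B and Q = B A. As determinants are ±1, the adjugate
  -- of B A is its inverse up to the factor det A det B, and P times the inverse of Q is the group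
  -- commutator.
  dt-comm-ρ : ∀ v w → dt (comm (ρ v) (ρ w)) ≡ (dt (ρ v) * dt (ρ w)) * (+ 2 - tr (ρ (commW v w)))
  dt-comm-ρ v w = begin
    dt (comm A B)                                               ≡⟨ dt-difference (A ⊠ B) (B ⊠ A) ⟩
    dt (A ⊠ B) + dt (B ⊠ A) - tr ((A ⊠ B) ⊠ ad (B ⊠ A))       ≡⟨ cong₂ (λ x y → x - y) (cong₂ _+_ (dt-⊠ A B) (dt-⊠ B A)) trace ⟩
    D * E + E * D - (D * E) * tr (ρ (commW v w))                 ≡⟨ poly D E (tr (ρ (commW v w))) ⟩
    (D * E) * (+ 2 - tr (ρ (commW v w)))                         ∎
    where
    open ≡-Reasoning
    A = ρ v
    B = ρ w
    D = dt A
    E = dt B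
    poly : ∀ D E t → D * E + E * D - (D * E) * t ≡ (D * E) * ((1ℤ + 1ℤ) - t)
    poly = solve-∀
    word : ρ (commW v w) ≡ (D * E) ⊛ ((A ⊠ B) ⊠ ad (B ⊠ A))
    word = begin
      ρ (commW v w)                                  ≡⟨ trans (ρ-++ v _) (cong (A ⊠_) (trans (ρ-++ w _) (cong (B ⊠_) (ρ-++ (winv v) (winv w))))) ⟩
      A ⊠ (B ⊠ (ρ (winv v) ⊠ ρ (winv w)))            ≡⟨ sym (⊠-assoc A B _) ⟩
      (A ⊠ B) ⊠ (ρ (winv v) ⊠ ρ (winv w))            ≡⟨ cong₂ (λ X Y → (A ⊠ B) ⊠ (X ⊠ Y)) (ρ-winv v) (ρ-winv w) ⟩
      (A ⊠ B) ⊠ ((D ⊛ ad A) ⊠ (E ⊛ ad B))          ≡⟨ cong ((A ⊠ B) ⊠_) (trans (⊛-⊠ D (ad A) _) (cong (D ⊛_) (⊠-⊛ E (ad A) (ad B)))) ⟩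
      (A ⊠ B) ⊠ (D ⊛ (E ⊛ (ad A ⊠ ad B)))          ≡⟨ cong ((A ⊠ B) ⊠_) (trans (⊛-⊛ D E _) (cong ((D * E) ⊛_) (sym (ad-⊠ B A)))) ⟩
      (A ⊠ B) ⊠ ((D * E) ⊛ ad (B ⊠ A))              ≡⟨ ⊠-⊛ (D * E) (A ⊠ B) (ad (B ⊠ A)) ⟩
      (D * E) ⊛ ((A ⊠ B) ⊠ ad (B ⊠ A))              ∎
    trace : tr ((A ⊠ B) ⊠ ad (B ⊠ A)) ≡ (D * E) * tr (ρ (commW v w))
    trace = sym (begin
      (D * E) * tr (ρ (commW v w))                   ≡⟨ cong (λ z → (D * E) * z) (trans (cong tr word) (tr-⊛ (D * E) _)) ⟩
      (D * E) * ((D * E) * T)                        ≡⟨ regroup D E T ⟩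
      (D * D) * (E * E) * T                          ≡⟨ cong₂ (λ x y → x * y * T) (dt²-ρ v) (dt²-ρ w) ⟩
      1ℤ * T                                         ≡⟨ *-identityˡ T ⟩
      T                                              ∎)
      where
      T = tr ((A ⊠ B) ⊠ ad (B ⊠ A))
      regroup : ∀ D E T → (D * E) * ((D * E) * T) ≡ (D * D) * (E * E) * T
      regroup = solve-∀

  tr-conj : ∀ c w → tr (ρ (c ++ (w ++ winv c))) ≡ tr (ρ w)
  tr-conj c w = begin
    tr (ρ (c ++ (w ++ winv c)))           ≡⟨ cong tr (ρ-++ c _) ⟩
    tr (ρ c ⊠ ρ (w ++ winv c))            ≡⟨ tr-cyclic (ρ c) _ ⟩
    tr (ρ (w ++ winv c) ⊠ ρ c)            ≡⟨ cong (λ z → tr (z ⊠ ρ c)) (ρ-++ w (winv c)) ⟩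
    tr ((ρ w ⊠ ρ (winv c)) ⊠ ρ c)         ≡⟨ cong tr (trans (⊠-assoc (ρ w) _ _) (trans (cong (ρ w ⊠_) (ρ-inverseˡ c)) (⊠-identityʳ (ρ w)))) ⟩
    tr (ρ w)                              ∎
    where open ≡-Reasoning

  module _ (q : ℤ) where

    open Mod q

    -- Since det (XY - YX) = ± (2 - tr [X, Y]) when X and Y have determinant ±1.
    commutator-trace : ∀ x y v w → q ∣ + 2 - tr (ρ (commW x y)) → Algebra.InB (ρ x) (ρ y) (ρ v) → Algebra.InB (ρ x) (ρ y) (ρ w) →
                       q ∣ + 2 - tr (ρ (commW v w))
    commutator-trace x y v w d bv bw = subst (q ∣_) unscale (∣n⇒∣m*n D scaled)
      where
      D = dt (ρ v) * dt (ρ w)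
      scaled : q ∣ D * (+ 2 - tr (ρ (commW v w)))
      scaled = subst (q ∣_) (dt-comm-ρ v w)
        (Algebra.dt-comm-InB (ρ x) (ρ y) (subst (q ∣_) (sym (dt-comm-ρ x y)) (∣n⇒∣m*n (dt (ρ x) * dt (ρ y)) d)) bv bw)
      regroup : ∀ D E t → D * E * (D * E * t) ≡ (D * D) * (E * E) * t
      regroup = solve-∀
      unscale : D * (D * (+ 2 - tr (ρ (commW v w)))) ≡ + 2 - tr (ρ (commW v w))
      unscale = trans (regroup (dt (ρ v)) (dt (ρ w)) _)
        (trans (cong₂ (λ x y → x * y * (+ 2 - tr (ρ (commW v w)))) (dt²-ρ v) (dt²-ρ w)) (*-identityˡ _))

-- Growth of traces with the number of turns.

record Within (lo hi : ℕ) (A : M2) : Set where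
  constructor within
  field
    p q r s : ℕ
    eq      : A ≡ mat (+ p) (+ q) (+ r) (+ s)
    p-lo : lo ℕ.≤ p
    p-hi : p ℕ.≤ hi
    q-lo : lo ℕ.≤ q
    q-hi : q ℕ.≤ hi
    r-lo : lo ℕ.≤ r
    r-hi : r ℕ.≤ hi
    s-lo : lo ℕ.≤ s
    s-hi : s ℕ.≤ hi

opaque
 unfolding _⊠_ tr

 within-⊠ : ∀ {lo hi lo' hi' A B} → Within lo hi A → Within lo' hi' B →
            Within (lo ℕ.* lo' ℕ.+ lo ℕ.* lo') (hi ℕ.* hi' ℕ.+ hi ℕ.* hi') (A ⊠ B)
 within-⊠ (within p q r s refl pl ph ql qh rl rh s≥ sh) (within p' q' r' s' refl pl' ph' ql' qh' rl' rh' s≥' sh') =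
   within (p ℕ.* p' ℕ.+ q ℕ.* r') (p ℕ.* q' ℕ.+ q ℕ.* s') (r ℕ.* p' ℕ.+ s ℕ.* r') (r ℕ.* q' ℕ.+ s ℕ.* s')
     (mat-≡ (entry p p' q r') (entry p q' q s') (entry r p' s r') (entry r q' s s'))
     (bound pl pl' ql rl') (bound ph ph' qh rh') (bound pl ql' ql s≥') (bound ph qh' qh sh')
     (bound rl pl' s≥ rl') (bound rh ph' sh rh') (bound rl ql' s≥ s≥') (bound rh qh' sh sh')
   where
   entry : ∀ i j k l → + i * + j + + k * + l ≡ + (i ℕ.* j ℕ.+ k ℕ.* l)
   entry i j k l = sym (trans (pos-+ (i ℕ.* j) (k ℕ.* l)) (cong₂ _+_ (pos-* i j) (pos-* k l)))
   bound : ∀ {a b c d e f g h} → a ℕ.≤ e → b ℕ.≤ f → c ℕ.≤ g → d ℕ.≤ h → a ℕ.* b ℕ.+ c ℕ.* d ℕ.≤ e ℕ.* f ℕ.+ g ℕ.* h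
   bound a b c d = ℕₚ.+-mono-≤ (ℕₚ.*-mono-≤ a b) (ℕₚ.*-mono-≤ c d)

 tr-mat : ∀ p q r s → tr (mat p q r s) ≡ p + s
 tr-mat p q r s = refl

 tr-neg : ∀ A → tr (neg A) ≡ - tr A
 tr-neg (mat p q r s) = poly p s
  where
  poly : ∀ p s → - p + - s ≡ - (p + s)
  poly = solve-∀

 ⊠-sgˡ : ∀ σ A B → sg σ A ⊠ B ≡ sg σ (A ⊠ B)
 ⊠-sgˡ = sg-⊗ˡ

 ⊠-sgʳ : ∀ σ A B → A ⊠ sg σ B ≡ sg σ (A ⊠ B)
 ⊠-sgʳ false A B = refl
 ⊠-sgʳ true (mat a b c d) (mat e f g h) = mat-≡ (poly a b e g) (poly a b f h) (poly c d e g) (poly c d f h)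
  where
  poly : ∀ a b e g → a * (- e) + b * (- g) ≡ - (a * e + b * g)
  poly = solve-∀

within-weaken : ∀ {lo hi lo' hi' A} → lo' ℕ.≤ lo → hi ℕ.≤ hi' → Within lo hi A → Within lo' hi' A
within-weaken l h (within p q r s eq pl ph ql qh rl rh s≥ sh) = within p q r s eq
  (ℕₚ.≤-trans l pl) (ℕₚ.≤-trans ph h) (ℕₚ.≤-trans l ql) (ℕₚ.≤-trans qh h)
  (ℕₚ.≤-trans l rl) (ℕₚ.≤-trans rh h) (ℕₚ.≤-trans l s≥) (ℕₚ.≤-trans sh h)

^-distrib-* : ∀ m n k → (m ℕ.* n) ℕ.^ k ≡ m ℕ.^ k ℕ.* n ℕ.^ k
^-distrib-* m n zero    = refl
^-distrib-* m n (suc k) = trans (cong (m ℕ.* n ℕ.*_) (^-distrib-* m n k)) (regroup m n (m ℕ.^ k) (n ℕ.^ k))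
  where
  regroup : ∀ m n x y → m ℕ.* n ℕ.* (x ℕ.* y) ≡ m ℕ.* x ℕ.* (n ℕ.* y)
  regroup = ℕ-Solver.solve-∀

module Growth (b : ℕ) (3≤b : 3 ℕ.≤ b) where

  open Rep (+ suc b)

  -- These are the images of `S U` and, up to sign, `S U U` for the parameter a = b + 1. All entries
  -- have the same sign and lie between b and 3 b; they are written as sums starting with `b` to
  -- match the bounds `small` and `large`.
  stepMat : Turn → M2
  stepMat ℓ = mat (+ (b ℕ.+ 2)) (+ (b ℕ.+ (b ℕ.+ 3))) (+ (b ℕ.+ 1)) (+ (b ℕ.+ (b ℕ.+ 1)))
  stepMat ʳ = mat (+ (b ℕ.+ (b ℕ.+ 3))) (+ (b ℕ.+ 1)) (+ (b ℕ.+ (b ℕ.+ 1))) (+ (b ℕ.+ 0))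

  turnSign : Turn → Bool
  turnSign ℓ = false
  turnSign ʳ = true

  private
    3b = b ℕ.+ (b ℕ.+ b)

    2≤b : 2 ℕ.≤ b
    2≤b = ℕₚ.≤-trans (s≤s (s≤s z≤n)) 3≤b
    1≤b : 1 ℕ.≤ b
    1≤b = ℕₚ.≤-trans (s≤s z≤n) 3≤b

    small : ∀ {k} → k ℕ.≤ b → b ℕ.+ k ℕ.≤ 3b
    small k≤b = ℕₚ.+-monoʳ-≤ b (ℕₚ.≤-trans k≤b (ℕₚ.m≤m+n b b))
    large : ∀ {k} → k ℕ.≤ b → b ℕ.+ (b ℕ.+ k) ℕ.≤ 3b
    large k≤b = ℕₚ.+-monoʳ-≤ b (ℕₚ.+-monoʳ-≤ b k≤b)

  within-step : ∀ ε → Within b 3b (stepMat ε)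
  within-step ℓ = within _ _ _ _ refl (ℕₚ.m≤m+n b _) (small 2≤b) (ℕₚ.m≤m+n b _) (large 3≤b)
                                      (ℕₚ.m≤m+n b _) (small 1≤b) (ℕₚ.m≤m+n b _) (large 1≤b)
  within-step ʳ = within _ _ _ _ refl (ℕₚ.m≤m+n b _) (large 3≤b) (ℕₚ.m≤m+n b _) (small 1≤b)
                                      (ℕₚ.m≤m+n b _) (large 1≤b) (ℕₚ.m≤m+n b _) (small z≤n)

  opaque
   unfolding _⊠_

   ρ-step : ∀ ε → ρ (S ∷ uw ε) ≡ sg (turnSign ε) (stepMat ε)
   ρ-step ℓ = trans (cong (ρS ⊠_) (⊠-identityʳ ρU)) (lemma (+ b))
     where
     p₁ : ∀ b → (1ℤ + b) * 0ℤ + (- (1ℤ + (1ℤ + b))) * (- 1ℤ) ≡ b + (1ℤ + 1ℤ)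
     p₁ = solve-∀
     p₂ : ∀ b → (1ℤ + b) * 1ℤ + (- (1ℤ + (1ℤ + b))) * (- 1ℤ) ≡ b + (b + (1ℤ + 1ℤ + 1ℤ))
     p₂ = solve-∀
     p₃ : ∀ b → (1ℤ + b - 1ℤ) * 0ℤ + (- (1ℤ + b)) * (- 1ℤ) ≡ b + 1ℤ
     p₃ = solve-∀
     p₄ : ∀ b → (1ℤ + b - 1ℤ) * 1ℤ + (- (1ℤ + b)) * (- 1ℤ) ≡ b + (b + 1ℤ)
     p₄ = solve-∀
     lemma : ∀ b → mat (1ℤ + b) (- (1ℤ + (1ℤ + b))) (1ℤ + b - 1ℤ) (- (1ℤ + b)) ⊠ ρU
                 ≡ mat (b + (1ℤ + 1ℤ)) (b + (b + (1ℤ + 1ℤ + 1ℤ))) (b + 1ℤ) (b + (b + 1ℤ))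
     lemma b = mat-≡ (p₁ b) (p₂ b) (p₃ b) (p₄ b)
   ρ-step ʳ = lemma (+ b)
     where
     p₁ : ∀ b → (1ℤ + b) * (- 1ℤ) + (- (1ℤ + (1ℤ + b))) * 1ℤ ≡ - (b + (b + (1ℤ + 1ℤ + 1ℤ)))
     p₁ = solve-∀
     p₂ : ∀ b → (1ℤ + b) * (- 1ℤ) + (- (1ℤ + (1ℤ + b))) * 0ℤ ≡ - (b + 1ℤ)
     p₂ = solve-∀
     p₃ : ∀ b → (1ℤ + b - 1ℤ) * (- 1ℤ) + (- (1ℤ + b)) * 1ℤ ≡ - (b + (b + 1ℤ))
     p₃ = solve-∀
     p₄ : ∀ b → (1ℤ + b - 1ℤ) * (- 1ℤ) + (- (1ℤ + b)) * 0ℤ ≡ - (b + 0ℤ)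
     p₄ = solve-∀
     lemma : ∀ b → mat (1ℤ + b) (- (1ℤ + (1ℤ + b))) (1ℤ + b - 1ℤ) (- (1ℤ + b)) ⊠ mat (- 1ℤ) (- 1ℤ) 1ℤ 0ℤ
                 ≡ neg (mat (b + (b + (1ℤ + 1ℤ + 1ℤ))) (b + 1ℤ) (b + (b + 1ℤ)) (b + 0ℤ))
     lemma b = mat-≡ (p₁ b) (p₂ b) (p₃ b) (p₄ b)

  ρ-W-cons : ∀ ε es → ρ (W (ε ∷ es)) ≡ sg (turnSign ε) (stepMat ε) ⊠ ρ (W es)
  ρ-W-cons ε es = trans (ρ-++ (S ∷ uw ε) (W es)) (cong (_⊠ ρ (W es)) (ρ-step ε))

  -- An entry of a product of nonnegative matrices is a sum of two products. This multiplies the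
  -- upper bound by 2 · 3 b = 6 b; for the lower bound one of the two summands suffices.
  growth : ∀ ε es → ∃ λ σ → ∃ λ A → ρ (W (ε ∷ es)) ≡ sg σ A ×
           Within (b ℕ.^ suc (length es)) ((6 ℕ.* b) ℕ.^ suc (length es)) A
  growth ε [] = turnSign ε , stepMat ε , trans (ρ-W-cons ε []) (⊠-identityʳ _) ,
    within-weaken (ℕₚ.≤-reflexive (ℕₚ.*-identityʳ b)) hi (within-step ε)
    where
    double : ∀ b → 6 ℕ.* b ℕ.* 1 ≡ b ℕ.+ (b ℕ.+ b) ℕ.+ (b ℕ.+ (b ℕ.+ b))
    double = ℕ-Solver.solve-∀
    hi : 3b ℕ.≤ 6 ℕ.* b ℕ.* 1
    hi = subst (3b ℕ.≤_) (sym (double b)) (ℕₚ.m≤m+n 3b 3b)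
  growth ε (ε' ∷ es) with growth ε' es
  ... | σ , A , eq , w = turnSign ε xor σ , stepMat ε ⊠ A ,
    trans (ρ-W-cons ε (ε' ∷ es)) (trans (cong (sg (turnSign ε) (stepMat ε) ⊠_) eq) (signs (turnSign ε) σ)) ,
    within-weaken (ℕₚ.m≤m+n _ _) (ℕₚ.≤-reflexive (double b _)) (within-⊠ (within-step ε) w)
    where
    signs : ∀ σ τ → sg σ (stepMat ε) ⊠ sg τ A ≡ sg (σ xor τ) (stepMat ε ⊠ A)
    signs σ τ = trans (⊠-sgˡ σ (stepMat ε) (sg τ A)) (trans (cong (sg σ) (⊠-sgʳ τ (stepMat ε) A)) (sg-sg σ τ _))
    double : ∀ b h → (b ℕ.+ (b ℕ.+ b)) ℕ.* h ℕ.+ (b ℕ.+ (b ℕ.+ b)) ℕ.* h ≡ 6 ℕ.* b ℕ.* h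
    double = ℕ-Solver.solve-∀

  private
    abs-tr-sg : ∀ σ A → ∣ tr (sg σ A) ∣ ≡ ∣ tr A ∣
    abs-tr-sg false A = refl
    abs-tr-sg true A = trans (cong ∣_∣ (tr-neg A)) (∣-i∣≡∣i∣ (tr A))

  trace-bounds : ∀ ε es → let l = suc (length es) ; t = ∣ tr (ρ (W (ε ∷ es))) ∣ in
    2 ℕ.* b ℕ.^ l ℕ.≤ t × t ℕ.≤ 2 ℕ.* (6 ℕ.* b) ℕ.^ l
  trace-bounds ε es with growth ε es
  ... | σ , A , eq , within p q r s refl pl ph _ _ _ _ s≥ sh rewrite eq | abs-tr-sg σ A | tr-mat (+ p) (+ q) (+ r) (+ s) =
    twice-≤ pl s≥ , ≤-twice ph sh
    where
    2* : ∀ k → 2 ℕ.* k ≡ k ℕ.+ k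
    2* = ℕ-Solver.solve-∀
    twice-≤ : ∀ {k m n} → k ℕ.≤ m → k ℕ.≤ n → 2 ℕ.* k ℕ.≤ m ℕ.+ n
    twice-≤ {k} {m} {n} p q = subst (λ z → z ℕ.≤ m ℕ.+ n) (sym (2* k)) (ℕₚ.+-mono-≤ p q)
    ≤-twice : ∀ {k m n} → m ℕ.≤ k → n ℕ.≤ k → m ℕ.+ n ℕ.≤ 2 ℕ.* k
    ≤-twice {k} {m} {n} p q = subst (λ z → m ℕ.+ n ℕ.≤ z) (sym (2* k)) (ℕₚ.+-mono-≤ p q)

  modulus : List Turn → ℕ
  modulus es = ∣ + 2 - tr (ρ (W es)) ∣

  trace≤modulus+2 : ∀ es → ∣ tr (ρ (W es)) ∣ ℕ.≤ 2 ℕ.+ modulus es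
  trace≤modulus+2 es = subst (λ z → z ℕ.≤ 2 ℕ.+ modulus es) (cong ∣_∣ (poly (tr (ρ (W es))))) (∣i-j∣≤∣i∣+∣j∣ (+ 2) (+ 2 - tr (ρ (W es))))
    where
    poly : ∀ t → (1ℤ + 1ℤ) - ((1ℤ + 1ℤ) - t) ≡ t
    poly = solve-∀

  12≤trace : ∀ ε es → 6 ℕ.≤ b → 12 ℕ.≤ ∣ tr (ρ (W (ε ∷ es))) ∣
  12≤trace ε es 6≤b = ℕₚ.≤-trans (ℕₚ.*-monoʳ-≤ 2 (ℕₚ.≤-trans 6≤b (ℕₚ.m≤m*n b (b ℕ.^ length es))))
                                 (proj₁ (trace-bounds ε es))
    where
    instance
      _ = ℕₚ.m^n≢0 b (length es) {{ℕ.>-nonZero (ℕₚ.≤-trans (s≤s z≤n) 3≤b)}}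

  modulus-nonZero : ∀ ε es → 6 ℕ.≤ b → ℕ.NonZero (modulus (ε ∷ es))
  modulus-nonZero ε es 6≤b = ℕ.>-nonZero (ℕₚ.+-cancelˡ-≤ 2 1 _
    (ℕₚ.≤-trans (s≤s (s≤s (s≤s z≤n))) (ℕₚ.≤-trans (12≤trace ε es 6≤b) (trace≤modulus+2 (ε ∷ es)))))

  -- The exponent in b makes 2 b^(n+1), the lower bound for the trace of n+1 turns, exceed the upper bound 2 (6 b)^n for fewer turns.
  short-trace : ∀ ε es ε' es' → b ≡ 6 ℕ.^ suc (length es) → length es' ℕ.< length es →
                ¬ (+ modulus (ε ∷ es) ∣ + 2 - tr (ρ (W (ε' ∷ es'))))
  short-trace ε es ε' es' b≡ shorter div = ℕₚ.<⇒≱ contradiction' chain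
    where
    open ℕₚ.≤-Reasoning
    n = length es
    X = (6 ℕ.* b) ℕ.^ n
    instance
      b≢0 = ℕ.>-nonZero (ℕₚ.≤-trans (s≤s z≤n) 3≤b)
      6b≢0 = ℕₚ.m*n≢0 6 b
    6≤b : 6 ℕ.≤ b
    6≤b = subst (6 ℕ.≤_) (sym b≡) (ℕₚ.m≤m*n 6 (6 ℕ.^ n) {{ℕₚ.m^n≢0 6 n}})
    X>0 : 0 ℕ.< X
    X>0 = ℕₚ.m^n>0 (6 ℕ.* b) n
    d' = ∣ + 2 - tr (ρ (W (ε' ∷ es'))) ∣
    d'≢0 : d' ≢ 0
    d'≢0 eq = ℕₚ.<⇒≱ (s≤s (s≤s (s≤s z≤n))) (begin
      12                                 ≤⟨ 12≤trace ε' es' 6≤b ⟩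
      ∣ tr (ρ (W (ε' ∷ es'))) ∣          ≤⟨ trace≤modulus+2 (ε' ∷ es') ⟩
      2 ℕ.+ d'                           ≡⟨ cong (2 ℕ.+_) eq ⟩
      2                                  ∎)
    q≤d' : modulus (ε ∷ es) ℕ.≤ d'
    q≤d' = ∣⇒≤ {{ℕ.≢-nonZero d'≢0}} (∣⇒∣ᵤ div)
    lower : 12 ℕ.* X ℕ.≤ ∣ tr (ρ (W (ε ∷ es))) ∣
    lower = begin
      12 ℕ.* (6 ℕ.* b) ℕ.^ n                ≡⟨ cong (12 ℕ.*_) (^-distrib-* 6 b n) ⟩
      12 ℕ.* (6 ℕ.^ n ℕ.* b ℕ.^ n)          ≡⟨ regroup (6 ℕ.^ n) (b ℕ.^ n) ⟩
      2 ℕ.* (6 ℕ.^ suc n ℕ.* b ℕ.^ n)       ≡⟨ cong (λ z → 2 ℕ.* (z ℕ.* b ℕ.^ n)) (sym b≡) ⟩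
      2 ℕ.* b ℕ.^ suc n                     ≤⟨ proj₁ (trace-bounds ε es) ⟩
      ∣ tr (ρ (W (ε ∷ es))) ∣               ∎
      where
      regroup : ∀ x y → 12 ℕ.* (x ℕ.* y) ≡ 2 ℕ.* (6 ℕ.* x ℕ.* y)
      regroup = ℕ-Solver.solve-∀
    chain : 12 ℕ.* X ℕ.≤ 4 ℕ.+ 2 ℕ.* X
    chain = begin
      12 ℕ.* X                                         ≤⟨ lower ⟩
      ∣ tr (ρ (W (ε ∷ es))) ∣                          ≤⟨ trace≤modulus+2 (ε ∷ es) ⟩
      2 ℕ.+ modulus (ε ∷ es)                           ≤⟨ ℕₚ.+-monoʳ-≤ 2 q≤d' ⟩
      2 ℕ.+ d'                                         ≤⟨ ℕₚ.+-monoʳ-≤ 2 (∣i-j∣≤∣i∣+∣j∣ (+ 2) (tr (ρ (W (ε' ∷ es'))))) ⟩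
      4 ℕ.+ ∣ tr (ρ (W (ε' ∷ es'))) ∣                  ≤⟨ ℕₚ.+-monoʳ-≤ 4 (proj₂ (trace-bounds ε' es')) ⟩
      4 ℕ.+ 2 ℕ.* (6 ℕ.* b) ℕ.^ suc (length es')       ≤⟨ ℕₚ.+-monoʳ-≤ 4 (ℕₚ.*-monoʳ-≤ 2 (ℕₚ.^-monoʳ-≤ (6 ℕ.* b) shorter)) ⟩
      4 ℕ.+ 2 ℕ.* X                                    ∎
    contradiction' : 4 ℕ.+ 2 ℕ.* X ℕ.< 12 ℕ.* X
    contradiction' = begin-strict
      4 ℕ.+ 2 ℕ.* X          ≤⟨ ℕₚ.+-monoˡ-≤ (2 ℕ.* X) (ℕₚ.*-monoʳ-≤ 4 X>0) ⟩
      4 ℕ.* X ℕ.+ 2 ℕ.* X    <⟨ ℕₚ.m<m+n _ (ℕₚ.≤-trans X>0 (ℕₚ.m≤n*m X 6)) ⟩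
      4 ℕ.* X ℕ.+ 2 ℕ.* X ℕ.+ 6 ℕ.* X  ≡⟨ regroup X ⟩
      12 ℕ.* X               ∎
      where
      regroup : ∀ x → 4 ℕ.* x ℕ.+ 2 ℕ.* x ℕ.+ 6 ℕ.* x ≡ 12 ℕ.* x
      regroup = ℕ-Solver.solve-∀

-- The character that sees the sign.

-- `S` ↦ 1 and `U` ↦ 2 respects S² = U³ modulo 4 and gives -1 the value 2, while commutators get 0.
-- It is the abelianisation ℤ/12 of SL₂(ℤ) reduced to ℤ/4.
χ : Word → ℤ
χ []      = 0ℤ
χ (S ∷ w) = 1ℤ + χ w
χ (U ∷ w) = + 2 + χ w

χ-++ : ∀ v w → χ (v ++ w) ≡ χ v + χ w
χ-++ []      w = sym (+-identityˡ (χ w))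
χ-++ (S ∷ v) w = trans (cong (_+_ 1ℤ) (χ-++ v w)) (sym (+-assoc 1ℤ (χ v) (χ w)))
χ-++ (U ∷ v) w = trans (cong (_+_ (+ 2)) (χ-++ v w)) (sym (+-assoc (+ 2) (χ v) (χ w)))

χ-sign : Bool → ℤ
χ-sign false = 0ℤ
χ-sign true  = + 2

module Mod4 = Mod (+ 4)

χ-R : ∀ {σ v w} → R σ v w → χ v Mod4.≡ᵐ χ w + χ-sign σ
χ-R (R-refl {w}) = Mod4.≡ᵐ-reflexive (poly (χ w))
  where
  poly : ∀ x → x ≡ x + 0ℤ
  poly = solve-∀
χ-R (R-sym {false} {v} {w} p) = Mod4.≡ᵐ-trans (Mod4.≡ᵐ-reflexive (poly (χ w)))
  (Mod4.≡ᵐ-trans (Mod4.≡ᵐ-sym (χ-R p)) (Mod4.≡ᵐ-reflexive (poly (χ v))))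
  where
  poly : ∀ x → x ≡ x + 0ℤ
  poly = solve-∀
χ-R (R-sym {true} {v} {w} p) = Mod4.≡ᵐ-trans (Mod4.mk≡ᵐ (divides (- 1ℤ) (poly (χ w))))
  (Mod4.≡ᵐ-+ (Mod4.≡ᵐ-sym (χ-R p)) (Mod4.≡ᵐ-reflexive {+ 2} refl))
  where
  poly : ∀ x → x - (x + (1ℤ + 1ℤ) + (1ℤ + 1ℤ)) ≡ (- 1ℤ) * (1ℤ + 1ℤ + (1ℤ + 1ℤ))
  poly = solve-∀
χ-R (R-trans {σ} {τ} {w = w} p p') = Mod4.≡ᵐ-trans (χ-R p) (Mod4.≡ᵐ-trans (Mod4.≡ᵐ-+ (χ-R p') (Mod4.≡ᵐ-reflexive {χ-sign σ} refl)) (signs σ τ))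
  where
  p₀₀ : ∀ x → x + 0ℤ + 0ℤ ≡ x + 0ℤ
  p₀₀ = solve-∀
  p₀₁ : ∀ x y → x + y + 0ℤ ≡ x + y
  p₀₁ = solve-∀
  p₁₀ : ∀ x y → x + 0ℤ + y ≡ x + y
  p₁₀ = solve-∀
  p₁₁ : ∀ x → x + (1ℤ + 1ℤ) + (1ℤ + 1ℤ) - (x + 0ℤ) ≡ 1ℤ * (1ℤ + 1ℤ + (1ℤ + 1ℤ))
  p₁₁ = solve-∀
  signs : ∀ σ τ → χ w + χ-sign τ + χ-sign σ Mod4.≡ᵐ χ w + χ-sign (σ xor τ)
  signs false false = Mod4.≡ᵐ-reflexive (p₀₀ (χ w))
  signs false true  = Mod4.≡ᵐ-reflexive (p₀₁ (χ w) (+ 2))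
  signs true  false = Mod4.≡ᵐ-reflexive (p₁₀ (χ w) (+ 2))
  signs true  true  = Mod4.mk≡ᵐ (divides 1ℤ (p₁₁ (χ w)))
χ-R (R-cons {σ} {v} {w} S p) = Mod4.≡ᵐ-trans (Mod4.≡ᵐ-+ (Mod4.≡ᵐ-reflexive {1ℤ} refl) (χ-R p)) (Mod4.≡ᵐ-reflexive (sym (+-assoc 1ℤ (χ w) (χ-sign σ))))
χ-R (R-cons {σ} {v} {w} U p) = Mod4.≡ᵐ-trans (Mod4.≡ᵐ-+ (Mod4.≡ᵐ-reflexive {+ 2} refl) (χ-R p)) (Mod4.≡ᵐ-reflexive (sym (+-assoc (+ 2) (χ w) (χ-sign σ))))
χ-R (R-SS {w}) = Mod4.≡ᵐ-reflexive (poly (χ w))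
  where
  poly : ∀ x → 1ℤ + (1ℤ + x) ≡ x + (1ℤ + 1ℤ)
  poly = solve-∀
χ-R (R-UUU {w}) = Mod4.mk≡ᵐ (divides 1ℤ (poly (χ w)))
  where
  poly : ∀ x → (1ℤ + 1ℤ) + ((1ℤ + 1ℤ) + ((1ℤ + 1ℤ) + x)) - (x + (1ℤ + 1ℤ)) ≡ 1ℤ * (1ℤ + 1ℤ + (1ℤ + 1ℤ))
  poly = solve-∀

χ-R₀ : ∀ {v w} → R false v w → χ v Mod4.≡ᵐ χ w
χ-R₀ {v} {w} p = Mod4.≡ᵐ-trans (χ-R p) (Mod4.≡ᵐ-reflexive (poly (χ w)))
  where
  poly : ∀ i → i + 0ℤ ≡ i
  poly = solve-∀

-- Weights on a Cayley graph and normal subgroups of finite index.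

module Weighted (a : ℤ) (q M : ℕ) .{{_ : NonZero q}} .{{_ : NonZero M}} where

  open Rep a
  open Mod (+ q) using (_≋_; ≋-reflexive; ≋-sym; ≋-trans; ≋-⊠; ≋-⊠ˡ; ≋-⊠ʳ)
  open Mod (+ M) renaming (_≡ᵐ_ to _≡ᴹ_; ≡ᵐ-reflexive to ≡ᴹ-reflexive; ≡ᵐ-sym to ≡ᴹ-sym; ≡ᵐ-trans to ≡ᴹ-trans; ≡ᵐ-+ to ≡ᴹ-+) using ()

  -- Weights on the edges of the Cayley graph of the image of ρ mod q, added up along the path read by a word.
  record Weights : Set where
    constructor weights
    field
      wS wU : M2 → ℤ

  open Weights

  wt : Weights → M2 → Word → ℤ
  wt w A []      = 0ℤ
  wt w A (S ∷ v) = wS w A + wt w (A ⊠ ρS) v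
  wt w A (U ∷ v) = wU w A + wt w (A ⊠ ρU) v

  -- The conditions under which the weight of a closed path depends, modulo M, on the group element only.
  record Valid (w : Weights) : Set where
    field
      S-cycle : ∀ A → wS w A + wS w (A ⊠ ρS) ≡ᴹ 0ℤ
      U-cycle : ∀ A → wU w A + (wU w (A ⊠ ρU) + wU w ((A ⊠ ρU) ⊠ ρU)) ≡ᴹ 0ℤ
      S-resp  : ∀ {A B} → A ≋ B → wS w A ≡ wS w B
      U-resp  : ∀ {A B} → A ≋ B → wU w A ≡ wU w B

  open Valid

  wt-++ : ∀ w A u v → wt w A (u ++ v) ≡ wt w A u + wt w (A ⊠ ρ u) v
  wt-++ w A [] v = sym (trans (+-identityˡ _) (cong (λ B → wt w B v) (⊠-identityʳ A)))
  wt-++ w A (S ∷ u) v = trans (cong (_+_ (wS w A)) (trans (wt-++ w (A ⊠ ρS) u v)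
    (cong (λ B → wt w (A ⊠ ρS) u + wt w B v) (⊠-assoc A ρS (ρ u))))) (sym (+-assoc (wS w A) _ _))
  wt-++ w A (U ∷ u) v = trans (cong (_+_ (wU w A)) (trans (wt-++ w (A ⊠ ρU) u v)
    (cong (λ B → wt w (A ⊠ ρU) u + wt w B v) (⊠-assoc A ρU (ρ u))))) (sym (+-assoc (wU w A) _ _))

  wt-≋ : ∀ {w} → Valid w → ∀ {A B} v → A ≋ B → wt w A v ≡ wt w B v
  wt-≋ valid []      p = refl
  wt-≋ valid (S ∷ v) p = cong₂ _+_ (S-resp valid p) (wt-≋ valid v (≋-⊠ʳ _ p))
  wt-≋ valid (U ∷ v) p = cong₂ _+_ (U-resp valid p) (wt-≋ valid v (≋-⊠ʳ _ p))

  wt-R : ∀ {w} → Valid w → ∀ {σ u v} A → R σ u v → wt w A u ≡ᴹ wt w A v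
  wt-R valid A R-refl         = ≡ᴹ-reflexive refl
  wt-R valid A (R-sym p)      = ≡ᴹ-sym (wt-R valid A p)
  wt-R valid A (R-trans p p') = ≡ᴹ-trans (wt-R valid A p) (wt-R valid A p')
  wt-R {w} valid A (R-cons S p) = ≡ᴹ-+ (≡ᴹ-reflexive {wS w A} refl) (wt-R valid (A ⊠ ρS) p)
  wt-R {w} valid A (R-cons U p) = ≡ᴹ-+ (≡ᴹ-reflexive {wU w A} refl) (wt-R valid (A ⊠ ρU) p)
  wt-R {w} valid A (R-SS {v}) = ≡ᴹ-trans (≡ᴹ-reflexive (sym (+-assoc (wS w A) _ _)))
    (≡ᴹ-trans (≡ᴹ-+ (S-cycle valid A) (≡ᴹ-reflexive (cong (λ B → wt w B v)
      (trans (⊠-assoc A ρS ρS) (trans (cong (A ⊠_) ρSS) (⊠-identityʳ A)))))) (≡ᴹ-reflexive (+-identityˡ _)))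
  wt-R {w} valid A (R-UUU {v}) = ≡ᴹ-trans (≡ᴹ-reflexive (regroup (wU w A) (wU w (A ⊠ ρU)) (wU w ((A ⊠ ρU) ⊠ ρU)) (wt w (((A ⊠ ρU) ⊠ ρU) ⊠ ρU) v)))
    (≡ᴹ-trans (≡ᴹ-+ (U-cycle valid A) (≡ᴹ-reflexive (cong (λ B → wt w B v)
      (trans (⊠-assoc (A ⊠ ρU) ρU ρU) (trans (⊠-assoc A ρU (ρU ⊠ ρU)) (trans (cong (A ⊠_) ρUUU) (⊠-identityʳ A))))))) (≡ᴹ-reflexive (+-identityˡ _)))
    where
    regroup : ∀ x y z t → x + (y + (z + t)) ≡ x + (y + z) + t
    regroup = solve-∀

  wt-∼ : ∀ {w} → Valid w → ∀ {u v} A → u ∼ v → wt w A u ≡ᴹ wt w A v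
  wt-∼ valid A (σ , p) = wt-R valid A p

  -- Left translation of the Cayley graph. Since translates of valid weights are valid, agreement of
  -- all weights at the base point `I2` carries over to every starting point, which makes `_≐_`
  -- compatible with concatenation.
  shift : M2 → Weights → Weights
  shift B w = weights (λ A → wS w (B ⊠ A)) (λ A → wU w (B ⊠ A))

  shift-valid : ∀ B {w} → Valid w → Valid (shift B w)
  shift-valid B {w} valid = record
    { S-cycle = λ A → subst (λ C → wS w (B ⊠ A) + wS w C ≡ᴹ 0ℤ) (⊠-assoc B A ρS) (S-cycle valid (B ⊠ A))
    ; U-cycle = λ A → subst₂ (λ C D → wU w (B ⊠ A) + (wU w C + wU w D) ≡ᴹ 0ℤ) (⊠-assoc B A ρU)
                  (trans (cong (_⊠ ρU) (⊠-assoc B A ρU)) (⊠-assoc B (A ⊠ ρU) ρU)) (U-cycle valid (B ⊠ A))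
    ; S-resp = λ p → S-resp valid (≋-⊠ˡ _ p)
    ; U-resp = λ p → U-resp valid (≋-⊠ˡ _ p)
    }

  wt-shift : ∀ B w A v → wt (shift B w) A v ≡ wt w (B ⊠ A) v
  wt-shift B w A []      = refl
  wt-shift B w A (S ∷ v) = cong (_+_ (wS w (B ⊠ A))) (trans (wt-shift B w (A ⊠ ρS) v) (cong (λ C → wt w C v) (sym (⊠-assoc B A ρS))))
  wt-shift B w A (U ∷ v) = cong (_+_ (wU w (B ⊠ A))) (trans (wt-shift B w (A ⊠ ρU) v) (cong (λ C → wt w C v) (sym (⊠-assoc B A ρU))))

  infix 4 _≐_
  -- All valid weights are compared, not those of one coset graph: `x` and `y`, and with them the
  -- group L, come from the quotient that this relation defines.
  record _≐_ (u v : Word) : Set where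
    constructor ≐-mk
    field
      same-ρ  : ρ u ≋ ρ v
      same-wt : ∀ {w} → Valid w → wt w I2 u ≡ᴹ wt w I2 v

  open _≐_ public

  ≐-refl : ∀ {u} → u ≐ u
  ≐-refl = ≐-mk (≋-reflexive refl) (λ _ → ≡ᴹ-reflexive refl)

  ≐-sym : ∀ {u v} → u ≐ v → v ≐ u
  ≐-sym (≐-mk p f) = ≐-mk (≋-sym p) (λ valid → ≡ᴹ-sym (f valid))

  ≐-trans : ∀ {u v w} → u ≐ v → v ≐ w → u ≐ w
  ≐-trans (≐-mk p f) (≐-mk p' f') = ≐-mk (≋-trans p p') (λ valid → ≡ᴹ-trans (f valid) (f' valid))

  ≐-∼ : ∀ {u v} → u ∼ v → u ≐ v
  ≐-∼ p = ≐-mk (≋-reflexive (ρ-∼ p)) (λ valid → wt-∼ valid I2 p)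

  ≐-wt : ∀ {w u v} → Valid w → ∀ A → u ≐ v → wt w A u ≡ᴹ wt w A v
  ≐-wt {w} {u} {v} valid A p = ≡ᴹ-trans (≡ᴹ-reflexive (sym (based u)))
    (≡ᴹ-trans (same-wt p (shift-valid A valid)) (≡ᴹ-reflexive (based v)))
    where
    based : ∀ v → wt (shift A w) I2 v ≡ wt w A v
    based v = trans (wt-shift A w I2 v) (cong (λ B → wt w B v) (⊠-identityʳ A))

  ≐-++ : ∀ {s t u v} → s ≐ t → u ≐ v → s ++ u ≐ t ++ v
  ≐-++ {s} {t} {u} {v} p p' = ≐-mk
    (≋-trans (≋-reflexive (ρ-++ s u)) (≋-trans (≋-⊠ (same-ρ p) (same-ρ p')) (≋-reflexive (sym (ρ-++ t v)))))
    (λ {w} valid → ≡ᴹ-trans (≡ᴹ-reflexive (wt-++ w I2 s u)) (≡ᴹ-trans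
      (≡ᴹ-+ (same-wt p valid) (≡ᴹ-trans (≐-wt valid (I2 ⊠ ρ s) p') (≡ᴹ-reflexive (wt-≋ valid v (≋-⊠ˡ _ (same-ρ p))))))
      (≡ᴹ-reflexive (sym (wt-++ w I2 t v)))))

  ≐-winv : ∀ {v} → v ≐ [] → winv v ≐ []
  ≐-winv {v} p = ≐-trans (≐-∼ (∼-reflexive (sym (++-identityʳ (winv v)))))
    (≐-trans (≐-++ (≐-refl {winv v}) (≐-sym p)) (≐-∼ (winv-inverseˡ v)))

  ≐-conj : ∀ g {v} → v ≐ [] → g ++ (v ++ winv g) ≐ []
  ≐-conj g p = ≐-trans (≐-++ (≐-refl {g}) (≐-++ p (≐-refl {winv g}))) (≐-∼ (winv-inverseʳ g))

  ≐-cancel : ∀ {u v} → u ≐ v → winv u ++ v ≐ []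
  ≐-cancel {u} p = ≐-trans (≐-++ (≐-refl {winv u}) (≐-sym p)) (≐-∼ (winv-inverseˡ u))

  module Rq = Residues q
  module RM = Residues M

  -- Modulo `M` a valid weight amounts to two tables indexed by the matrices modulo `q`. The
  -- quantifier over weights in `_≐_` is thus a finite conjunction, which is the source of finite
  -- index.
  tables : ℕ
  tables = (M ℕ.^ Rq.Q) ℕ.* (M ℕ.^ Rq.Q)

  fromTables : Fin (M ℕ.^ Rq.Q) × Fin (M ℕ.^ Rq.Q) → Weights
  fromTables (i , j) = weights (λ A → + toℕ (finToFun i (Rq.encode A))) (λ A → + toℕ (finToFun j (Rq.encode A)))

  decodeW : Fin tables → Weights
  decodeW i = fromTables (remQuot {M ℕ.^ Rq.Q} (M ℕ.^ Rq.Q) i)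

  encodeW : Weights → Fin tables
  encodeW w = combine (funToFin (λ j → RM.toFin (wS w (Rq.decode j)))) (funToFin (λ j → RM.toFin (wU w (Rq.decode j))))

  decodeW-encodeW : ∀ w → Valid w → ∀ A → (wS (decodeW (encodeW w)) A ≡ᴹ wS w A) × (wU (decodeW (encodeW w)) A ≡ᴹ wU w A)
  decodeW-encodeW w valid A =
    subst (λ z → (wS (fromTables z) A ≡ᴹ wS w A) × (wU (fromTables z) A ≡ᴹ wU w A)) (sym (remQuot-combine (funToFin f) (funToFin g)))
      ( ≡ᴹ-trans (entry f (wS w (Rq.decode (Rq.encode A))) refl) (≡ᴹ-reflexive (S-resp valid (Rq.decode-encode A)))
      , ≡ᴹ-trans (entry g (wU w (Rq.decode (Rq.encode A))) refl) (≡ᴹ-reflexive (U-resp valid (Rq.decode-encode A))))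
    where
    f g : Fin Rq.Q → Fin M
    f j = RM.toFin (wS w (Rq.decode j))
    g j = RM.toFin (wU w (Rq.decode j))
    entry : ∀ (h : Fin Rq.Q → Fin M) i → h (Rq.encode A) ≡ RM.toFin i → + toℕ (finToFun (funToFin h) (Rq.encode A)) ≡ᴹ i
    entry h i eq = ≡ᴹ-trans (≡ᴹ-reflexive (cong (λ z → + toℕ z) (trans (finToFun-funToFin h (Rq.encode A)) eq))) (≡ᴹ-sym (RM.toFin-≡ᵐ i))

  wt-≡ᴹ : ∀ w w' → (∀ A → (wS w A ≡ᴹ wS w' A) × (wU w A ≡ᴹ wU w' A)) → ∀ A v → wt w A v ≡ᴹ wt w' A v
  wt-≡ᴹ w w' p A []      = ≡ᴹ-reflexive refl
  wt-≡ᴹ w w' p A (S ∷ v) = ≡ᴹ-+ (proj₁ (p A)) (wt-≡ᴹ w w' p (A ⊠ ρS) v)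
  wt-≡ᴹ w w' p A (U ∷ v) = ≡ᴹ-+ (proj₂ (p A)) (wt-≡ᴹ w w' p (A ⊠ ρU) v)

  -- Every table is recorded, valid or not, so the code may split a class of `_≐_`; `shorten` relies
  -- only on equal codes implying congruence.
  Φ : Word → Fin (Rq.Q ℕ.* M ℕ.^ tables)
  Φ v = combine (Rq.encode (ρ v)) (funToFin (λ i → RM.toFin (wt (decodeW i) I2 v)))

  Φ-separates : ∀ {u v} → Φ u ≡ Φ v → u ≐ v
  Φ-separates {u} {v} eq with combine-injective (Rq.encode (ρ u)) _ (Rq.encode (ρ v)) _ eq
  ... | eq₁ , eq₂ = ≐-mk (Rq.encode-injective eq₁) same
    where
    entry : ∀ i → wt (decodeW i) I2 u ≡ᴹ wt (decodeW i) I2 v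
    entry i = RM.toFin-injective (trans (sym (finToFun-funToFin _ i)) (trans (cong (λ t → finToFun t i) eq₂) (finToFun-funToFin _ i)))
    same : ∀ {w} → Valid w → wt w I2 u ≡ᴹ wt w I2 v
    same {w} valid = ≡ᴹ-trans (≡ᴹ-sym (wt-≡ᴹ _ w (decodeW-encodeW w valid) I2 u))
      (≡ᴹ-trans (entry (encodeW w)) (wt-≡ᴹ _ w (decodeW-encodeW w valid) I2 v))

  ≐-wd-· : ∀ g h → wd (g · h) ≐ wd g ++ wd h
  ≐-wd-· g h = ≐-∼ (false , R-wd-· g h)

  ≐-wd-inv : ∀ g → wd (inv g) ≐ winv (wd g)
  ≐-wd-inv g = ≐-∼ (∼-wd-inv g)

  N-PSL : Profinite.FINormal PSL₂ℤ
  N-PSL = record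
    { mem      = λ g → wd g ≐ []
    ; mem-resp = λ {g} {h} eq p → ≐-trans (≐-∼ (∼-sym (∼-wd-PSL g h eq))) p
    ; mem-ε    = ≐-∼ (false , R-wd-one)
    ; mem-∙    = λ {g} {h} p p' → ≐-trans (≐-wd-· g h) (≐-++ p p')
    ; mem-⁻¹   = λ {g} p → ≐-trans (≐-wd-inv g) (≐-winv p)
    ; normal   = λ g {n} p → conj g n p
    ; reps     = map toSL (wordsOfLength≤ (Rq.Q ℕ.* M ℕ.^ tables))
    ; covers   = covers-by-short-words _≐_ ≐-refl ≐-trans (λ w p → ≐-++ p (≐-refl {w})) Φ Φ-separates (λ r g → wd (inv r · g) ≐ []) quotient
    }
    where
    conj : ∀ g n → wd n ≐ [] → wd ((g · n) · inv g) ≐ []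
    conj g n p = ≐-trans (≐-wd-· (g · n) (inv g)) (≐-trans (≐-++ (≐-wd-· g n) (≐-wd-inv g))
      (≐-trans (≐-∼ (∼-reflexive (++-assoc (wd g) (wd n) (winv (wd g))))) (≐-conj (wd g) p)))
    quotient : ∀ v g → v ≐ wd g → wd (inv (toSL v) · g) ≐ []
    quotient v g p = ≐-trans (≐-wd-· (inv (toSL v)) g) (≐-trans (≐-++ (≐-wd-inv (toSL v)) (≐-refl {wd g}))
      (≐-cancel (≐-trans (≐-∼ (false , R-wd-toSL v)) p)))

  infix 4 _≑_
  -- Both `ρ` and the weights factor through `_∼_` and are blind to the sign, hence the additional
  -- character for SL₂(ℤ).
  _≑_ : Word → Word → Set
  u ≑ v = (u ≐ v) × (χ u Mod4.≡ᵐ χ v)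

  ≑-trans : ∀ {u v w} → u ≑ v → v ≑ w → u ≑ w
  ≑-trans (p , c) (p' , c') = ≐-trans p p' , Mod4.≡ᵐ-trans c c'

  ≑-refl : ∀ {u} → u ≑ u
  ≑-refl = ≐-refl , Mod4.≡ᵐ-reflexive refl

  ≑-R : ∀ {u v} → R false u v → u ≑ v
  ≑-R p = ≐-∼ (false , p) , χ-R₀ p

  ≑-++ : ∀ {s t u v} → s ≑ t → u ≑ v → s ++ u ≑ t ++ v
  ≑-++ {s} {t} {u} {v} (p , c) (p' , c') = ≐-++ p p' , Mod4.≡ᵐ-trans (Mod4.≡ᵐ-reflexive (χ-++ s u))
    (Mod4.≡ᵐ-trans (Mod4.≡ᵐ-+ c c') (Mod4.≡ᵐ-reflexive (sym (χ-++ t v))))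

  ≑-sym : ∀ {u v} → u ≑ v → v ≑ u
  ≑-sym (p , c) = ≐-sym p , Mod4.≡ᵐ-sym c

  ≑-inv : ∀ g → wd (inv g) ++ wd g ≑ []
  ≑-inv g = ≑-R (R-wd-inverseˡ g)

  ≑-inv-trivial : ∀ g → wd g ≑ [] → wd (inv g) ≑ []
  ≑-inv-trivial g p = ≑-trans (subst (_≑ wd (inv g) ++ []) (++-identityʳ (wd (inv g))) ≑-refl)
    (≑-trans (≑-++ (≑-refl {wd (inv g)}) (≑-sym p)) (≑-inv g))

  N-SL : Profinite.FINormal SL₂ℤ
  N-SL = record
    { mem      = λ g → wd g ≑ []
    ; mem-resp = λ {g} {h} eq p → ≑-trans (≑-R (R-sym (R-wd-cong g h eq))) p
    ; mem-ε    = ≑-R R-wd-one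
    ; mem-∙    = λ {g} {h} p p' → ≑-trans (≑-R (R-wd-· g h)) (≑-++ p p')
    ; mem-⁻¹   = λ {g} p → ≑-inv-trivial g p
    ; normal   = λ g {n} p → conj g n p
    ; reps     = map toSL (wordsOfLength≤ (Rq.Q ℕ.* M ℕ.^ tables ℕ.* 4))
    ; covers   = covers-by-short-words _≑_ ≑-refl ≑-trans (λ w p → ≑-++ p (≑-refl {w})) Φ₄ separates (λ r g → wd (inv r · g) ≑ []) quotient
    }
    where
    module R4 = Residues 4
    Φ₄ : Word → Fin (Rq.Q ℕ.* M ℕ.^ tables ℕ.* 4)
    Φ₄ v = combine (Φ v) (R4.toFin (χ v))
    separates : ∀ {u v} → Φ₄ u ≡ Φ₄ v → u ≑ v
    separates {u} {v} eq with combine-injective (Φ u) (R4.toFin (χ u)) (Φ v) (R4.toFin (χ v)) eq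
    ... | eq₁ , eq₂ = Φ-separates eq₁ , R4.toFin-injective eq₂
    conj : ∀ g n → wd n ≑ [] → wd ((g · n) · inv g) ≑ []
    conj g n p = ≑-trans (≑-R (R-wd-· (g · n) (inv g)))
      (≑-trans (≑-++ (≑-trans (≑-R (R-wd-· g n)) (≑-trans (≑-++ (≑-refl {wd g}) p)
                        (subst (wd g ++ [] ≑_) (++-identityʳ (wd g)) ≑-refl))) (≑-refl {wd (inv g)}))
      (≑-trans (≑-R (R-sym (R-wd-· g (inv g)))) (≑-R (R-complete _ [] false (trans (mt-wd (g · inv g)) (Group.inverseʳ SL₂ℤ g))))))
    quotient : ∀ v g → v ≑ wd g → wd (inv (toSL v) · g) ≑ []
    quotient v g p = ≑-trans (≑-R (R-wd-· (inv (toSL v)) g))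
      (≑-trans (≑-++ (≑-refl {wd (inv (toSL v))}) (≑-sym (≑-trans (≑-R (R-wd-toSL v)) p))) (≑-inv (toSL v)))

-- Conjugation and cyclic reduction.

∼-assoc : ∀ u v w → (u ++ v) ++ w ∼ u ++ (v ++ w)
∼-assoc u v w = ∼-reflexive (++-assoc u v w)

∼-assoc˘ : ∀ u v w → u ++ (v ++ w) ∼ (u ++ v) ++ w
∼-assoc˘ u v w = ∼-sym (∼-assoc u v w)

winv-++ : ∀ u v → winv (u ++ v) ≡ winv v ++ winv u
winv-++ []      v = sym (++-identityʳ (winv v))
winv-++ (S ∷ u) v = trans (cong (_++ (S ∷ [])) (winv-++ u v)) (++-assoc (winv v) (winv u) (S ∷ []))
winv-++ (U ∷ u) v = trans (cong (_++ (U ∷ U ∷ [])) (winv-++ u v)) (++-assoc (winv v) (winv u) (U ∷ U ∷ []))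

winv-cong : ∀ {u v} → u ∼ v → winv u ∼ winv v
winv-cong {u} {v} p = ∼-inverse-unique (winv u) v (∼-trans (∼-++ˡ (winv u) (∼-sym p)) (winv-inverseˡ u))

winv-involutive : ∀ u → winv (winv u) ∼ u
winv-involutive u = ∼-sym (∼-inverse-unique u (winv u) (winv-inverseʳ u))

commW-cong : ∀ {t u v w} → t ∼ u → v ∼ w → commW t v ∼ commW u w
commW-cong p q = ∼-++ p (∼-++ q (∼-++ (winv-cong p) (winv-cong q)))

cj : Word → Word → Word
cj c w = c ++ (w ++ winv c)

cj-cong : ∀ c {v w} → v ∼ w → cj c v ∼ cj c w
cj-cong c p = ∼-++ˡ c (∼-++ʳ (winv c) p)

cj-++ : ∀ c v w → cj c (v ++ w) ∼ cj c v ++ cj c w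
cj-++ c v w = ∼-sym (∼-trans (∼-assoc c (v ++ winv c) (cj c w)) (∼-++ˡ c
  (∼-trans (∼-assoc v (winv c) (cj c w)) (∼-trans (∼-++ˡ v (winv-cancelˡ c (w ++ winv c))) (∼-assoc˘ v w (winv c))))))

cj-winv : ∀ c w → cj c (winv w) ∼ winv (cj c w)
cj-winv c w = ∼-inverse-unique (cj c (winv w)) (cj c w) (∼-trans (∼-sym (cj-++ c (winv w) w))
  (∼-trans (cj-cong c (winv-inverseˡ w)) (winv-inverseʳ c)))

cj-commW : ∀ c v w → cj c (commW v w) ∼ commW (cj c v) (cj c w)
cj-commW c v w = ∼-trans (cj-++ c v _) (∼-++ˡ (cj c v) (∼-trans (cj-++ c w _) (∼-++ˡ (cj c w)
  (∼-trans (cj-++ c (winv v) (winv w)) (∼-++ (cj-winv c v) (cj-winv c w))))))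

rotate : ∀ u v → u ++ v ∼ cj u (v ++ u)
rotate u v = ∼-++ˡ u (∼-sym (∼-trans (∼-assoc v u (winv u))
  (∼-trans (∼-++ˡ v (winv-inverseʳ u)) (∼-reflexive (++-identityʳ v)))))

cj-cj : ∀ c e w → cj c (cj e w) ∼ cj (c ++ e) w
cj-cj c e w = ∼-trans (∼-++ˡ c (∼-trans (∼-assoc e (w ++ winv e) (winv c)) (∼-++ˡ e
    (∼-trans (∼-assoc w (winv e) (winv c)) (∼-reflexive (cong (w ++_) (sym (winv-++ c e))))))))
  (∼-assoc˘ c e (w ++ winv (c ++ e)))

IsCommW : Word → Set
IsCommW w = ∃ λ u → ∃ λ v → w ∼ commW u v

commutator-cong : ∀ {v w} → v ∼ w → IsCommW w → IsCommW v
commutator-cong p (x , y , q) = x , y , ∼-trans p q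

commutator-cj : ∀ c {w} → IsCommW w → IsCommW (cj c w)
commutator-cj c (x , y , p) = cj c x , cj c y , ∼-trans (cj-cong c p) (cj-commW c x y)

W-++ : ∀ es fs → W (es ++ fs) ≡ W es ++ W fs
W-++ []       fs = refl
W-++ (ε ∷ es) fs = cong (S ∷_) (trans (cong (uw ε ++_) (W-++ es fs)) (sym (++-assoc (uw ε) (W es) (W fs))))

data CyclicForm (w : Word) (k : ℕ) : Set where
  power-of-U : ∀ c z → w ∼ cj c (uz z) → CyclicForm w k
  just-S     : ∀ c → w ∼ cj c (S ∷ []) → CyclicForm w k
  hyperbolic : ∀ c ε es → w ∼ cj c (W (ε ∷ es)) → suc (length es) ℕ.≤ k → CyclicForm w k

cyclic-cj : ∀ c {v w k l} → v ∼ cj c w → k ℕ.≤ l → CyclicForm w k → CyclicForm v l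
cyclic-cj c p le (power-of-U e z q)     = power-of-U (c ++ e) z (∼-trans p (∼-trans (cj-cong c q) (cj-cj c e _)))
cyclic-cj c p le (just-S e q)           = just-S (c ++ e) (∼-trans p (∼-trans (cj-cong c q) (cj-cj c e _)))
cyclic-cj c p le (hyperbolic e ε es q b) =
  hyperbolic (c ++ e) ε es (∼-trans p (∼-trans (cj-cong c q) (cj-cj c e _))) (ℕₚ.≤-trans b le)

turnZ : Turn → Z3
turnZ ℓ = z1
turnZ ʳ = z2

cj-[] : ∀ w → w ∼ cj [] w
cj-[] w = ∼-reflexive (sym (++-identityʳ w))

hyperbolic-∷ʳ : ∀ {w k} es ε → w ∼ W (es ∷ʳ ε) → suc (length es) ℕ.≤ k → CyclicForm w k
hyperbolic-∷ʳ [] ε p le = hyperbolic [] ε [] (∼-trans p (cj-[] _)) le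
hyperbolic-∷ʳ (ε' ∷ es) ε p le = hyperbolic [] ε' (es ∷ʳ ε) (∼-trans p (cj-[] _))
  (ℕₚ.≤-trans (ℕₚ.≤-reflexive (cong suc (trans (length-++ es) (ℕₚ.+-comm (length es) 1)))) le)

-- Rotating the leading `S` and its turn to the end makes two letters `S` meet and cancel, which
-- leaves fewer turns followed by a power of `U`. The recursion is an argument because this case and
-- `cyclic-U` alternate.
cyclic-S : ∀ es → (∀ fs z → length fs ℕ.< suc (length es) → CyclicForm (W fs ++ uz z) (length fs)) →
           CyclicForm (W es ++ S ∷ []) (suc (length es))
cyclic-S [] rec = just-S [] (cj-[] (S ∷ []))
cyclic-S (ε ∷ es) rec = cyclic-cj (S ∷ uw ε)
  (∼-trans (∼-reflexive (cong (S ∷_) (++-assoc (uw ε) (W es) (S ∷ []))))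
  (∼-trans (rotate (S ∷ uw ε) (W es ++ S ∷ [])) (cj-cong (S ∷ uw ε)
    (∼-trans (∼-assoc (W es) (S ∷ []) (S ∷ uw ε)) (∼-++ˡ (W es) (∼-trans ∼-SS (∼-reflexive (turn ε))))))))
  (ℕₚ.≤-trans (ℕₚ.n≤1+n _) (ℕₚ.n≤1+n _)) (rec es (turnZ ε) (ℕₚ.n≤1+n _))
  where
  turn : ∀ ε → uw ε ≡ uz (turnZ ε)
  turn ℓ = refl
  turn ʳ = refl

-- The trailing power of `U` merges with the last turn. Either a turn results and the word is
-- cyclically reduced, or the two cancel and expose a final `S`.
cyclic-U : ∀ es z → Acc ℕ._<_ (length es) → CyclicForm (W es ++ uz z) (length es)
cyclic-U es z rs with initLast es
cyclic-U .[] z rs | [] = power-of-U [] z (cj-[] (uz z))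
cyclic-U .(es ∷ʳ ε) z (acc rs) | es ∷ʳ′ ε = merge ε z
  where
  len : length (es ∷ʳ ε) ≡ suc (length es)
  len = trans (length-++ es) (ℕₚ.+-comm (length es) 1)
  last-turn : ∀ {ε z} v → uw ε ++ uz z ∼ v → W (es ∷ʳ ε) ++ uz z ∼ W es ++ S ∷ v
  last-turn {ε} {z} v p = ∼-trans (∼-reflexive (trans (cong (_++ uz z) (W-++ es (ε ∷ []))) (++-assoc (W es) (W (ε ∷ [])) (uz z))))
    (∼-++ˡ (W es) (∼-cons S (∼-trans (∼-reflexive (cong (_++ uz z) (++-identityʳ (uw ε)))) p)))
  new-turn : ∀ {ε z} ε' → uw ε ++ uz z ∼ uw ε' → CyclicForm (W (es ∷ʳ ε) ++ uz z) (length (es ∷ʳ ε))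
  new-turn {ε} {z} ε' p = hyperbolic-∷ʳ es ε' (∼-trans (last-turn {ε} {z} (uw ε') p)
    (∼-reflexive (sym (trans (W-++ es (ε' ∷ [])) (cong (λ v → W es ++ S ∷ v) (++-identityʳ (uw ε')))))))
    (ℕₚ.≤-reflexive (sym (trans (length-++ es) (ℕₚ.+-comm (length es) 1))))
  no-turn : ∀ {ε z} → uw ε ++ uz z ∼ [] → CyclicForm (W (es ∷ʳ ε) ++ uz z) (length (es ∷ʳ ε))
  no-turn {ε} {z} p = cyclic-cj [] (∼-trans (last-turn {ε} {z} [] p) (cj-[] _))
    (ℕₚ.≤-reflexive (sym (trans (length-++ es) (ℕₚ.+-comm (length es) 1)))) (cyclic-S es (λ fs z' lt → cyclic-U fs z' (rs (subst (length fs ℕ.<_) (sym len) lt))))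
  merge : ∀ ε z → CyclicForm (W (es ∷ʳ ε) ++ uz z) (length (es ∷ʳ ε))
  merge ℓ z0 = new-turn {ℓ} {z0} ℓ ∼-refl
  merge ʳ z0 = new-turn {ʳ} {z0} ʳ ∼-refl
  merge ℓ z1 = new-turn {ℓ} {z1} ʳ ∼-refl
  merge ℓ z2 = no-turn {ℓ} {z2} ∼-UUU
  merge ʳ z1 = no-turn {ʳ} {z1} ∼-UUU
  merge ʳ z2 = new-turn {ʳ} {z2} ℓ ∼-UUU

cyclic : ∀ w → CyclicForm w (#S w)
cyclic w with normalise w
... | e , es , false , p , le = cyclic-cj (uz e)
  (∼-trans p (∼-trans (rotate (uz e) (W es ++ [])) (cj-cong (uz e) (∼-reflexive (cong (_++ uz e) (++-identityʳ (W es)))))))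
  (ℕₚ.≤-trans (ℕₚ.≤-reflexive (sym (ℕₚ.+-identityʳ _))) le) (cyclic-U es e (<-wellFounded _))
... | z0 , es , true , p , le = cyclic-cj [] (∼-trans p (cj-[] _))
  (ℕₚ.≤-trans (ℕₚ.≤-reflexive (ℕₚ.+-comm 1 (length es))) le) (cyclic-S es (λ fs z lt → cyclic-U fs z (<-wellFounded _)))
... | z1 , es , true , p , le = cyclic-cj (U ∷ []) (∼-trans p (∼-trans (rotate (U ∷ []) _) (cj-cong (U ∷ [])
    (∼-reflexive (trans (++-assoc (W es) (S ∷ []) (U ∷ [])) (sym (W-++ es (ℓ ∷ []))))))))
    (ℕₚ.≤-trans (ℕₚ.≤-reflexive (ℕₚ.+-comm 1 (length es))) le) (hyperbolic-∷ʳ es ℓ ∼-refl ℕₚ.≤-refl)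
... | z2 , es , true , p , le = cyclic-cj (U ∷ U ∷ []) (∼-trans p (∼-trans (rotate (U ∷ U ∷ []) _) (cj-cong (U ∷ U ∷ [])
    (∼-reflexive (trans (++-assoc (W es) (S ∷ []) (U ∷ U ∷ [])) (sym (W-++ es (ʳ ∷ []))))))))
    (ℕₚ.≤-trans (ℕₚ.≤-reflexive (ℕₚ.+-comm 1 (length es))) le) (hyperbolic-∷ʳ es ʳ ∼-refl ℕₚ.≤-refl)

-- Reading a path turn by turn.

next : Word → Turn → Word
next u ε = u ++ (S ∷ uw ε)

-- Hit P u es: the path from u reading W es satisfies P just before one of its letters S.
data Hit (P : Word → Set) : Word → List Turn → Set where
  here  : ∀ {u ε es} → P u → Hit P u (ε ∷ es)
  there : ∀ {u ε es} → Hit P (next u ε) es → Hit P u (ε ∷ es)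

hit? : ∀ {P} → (∀ u → Dec (P u)) → ∀ u es → Dec (Hit P u es)
hit? P? u []       = no λ ()
hit? P? u (ε ∷ es) = map′ (λ { (inj₁ p) → here p ; (inj₂ p) → there p }) (λ { (here p) → inj₁ p ; (there p) → inj₂ p })
  (P? u ⊎-dec hit? P? (next u ε) es)

next-++ : ∀ u ε v → next u ε ++ v ≡ u ++ (S ∷ (uw ε ++ v))
next-++ u ε v = ++-assoc u (S ∷ uw ε) v

hit-split : ∀ {P u es} → Hit P u es → ∃ λ pre → ∃ λ ε → ∃ λ post → es ≡ pre ++ ε ∷ post × P (u ++ W pre)
hit-split {P} {u} (here {ε = ε} {es} p) = [] , ε , es , refl , subst P (sym (++-identityʳ u)) p
hit-split {P} {u} (there {ε = ε} h) with hit-split h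
... | pre , ε' , post , eq , p = ε ∷ pre , ε' , post , cong (ε ∷_) eq , subst P (next-++ u ε (W pre)) p

commW-swap : ∀ g h r → g ++ (h ++ r) ∼ commW g h ++ (h ++ (g ++ r))
commW-swap g h r = ∼-sym (∼-trans (∼-reflexive (trans (++-assoc g _ _) (cong (g ++_)
    (trans (++-assoc h _ _) (cong (h ++_) (++-assoc (winv g) (winv h) _))))))
  (∼-++ˡ g (∼-++ˡ h (∼-trans (∼-++ˡ (winv g) (winv-cancelˡ h (g ++ r))) (winv-cancelˡ g r)))))

-- Null-homologous loops in the coset graph of L.

module Core (a : ℤ) (q : ℕ) .{{_ : NonZero q}} (n : ℕ) (x y : Word) where

  open Rep a
  -- The factor 6 provides elements of order 2 and 3 modulo `M`, needed where `S` or `U` fixes a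
  -- coset. The factor `suc n` is the largest number of turns considered, so a positive count of
  -- crossings stays below `M` and cannot vanish modulo `M`.
  M : ℕ
  M = 6 ℕ.* suc n

  open Weighted a q M
  open Weights
  open Valid
  open Mod (+ q) using (_≋_; ≋-⊠ʳ; ≋-sym)
  open Mod (+ M) using () renaming (_≡ᵐ_ to _≡ᴹ_; mk≡ᵐ to mk≡ᴹ; difference to differenceᴹ; ≡ᵐ-reflexive to ≡ᴹ-reflexive; ≡ᵐ-sym to ≡ᴹ-sym; ≡ᵐ-trans to ≡ᴹ-trans; ≡ᵐ-+ to ≡ᴹ-+)
  open Mod.Algebra (+ q) (ρ x) (ρ y)
  open ModDec q (ρ x) (ρ y) using (InB?)

  InB-winv : ∀ w → InB (ρ w) → InB (ρ (winv w))
  InB-winv w p = InB-≡ (ρ-winv w) (InB-⊛ (dt (ρ w)) (InB-ad p))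

  -- u and v are in the same coset L u = L v of the group L of words whose image lies in the algebra spanned by x and y.
  record Same (u v : Word) : Set where
    constructor same
    field
      inB : InB (ρ (u ++ winv v))

  same-∼ : ∀ {u u' v v'} → u ∼ u' → v ∼ v' → Same u v → Same u' v'
  same-∼ p q (same r) = same (InB-≡ (sym (ρ-∼ (∼-++ p (winv-cong q)))) r)

  same-refl : ∀ {u} → Same u u
  same-refl {u} = same (InB-≡ (ρ-∼ (winv-inverseʳ u)) InB-I)

  same-sym : ∀ {u v} → Same u v → Same v u
  same-sym {u} {v} (same r) = same (InB-≡
    (ρ-∼ (∼-sym (∼-trans (∼-reflexive (winv-++ u (winv v))) (∼-++ʳ (winv u) (winv-involutive v)))))
    (InB-winv (u ++ winv v) r))

  same-trans : ∀ {u v w} → Same u v → Same v w → Same u w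
  same-trans {u} {v} {w} (same p) (same r) = same (InB-≡
    (trans (ρ-∼ (∼-sym (∼-trans (∼-assoc u (winv v) (v ++ winv w)) (∼-++ˡ u (winv-cancelˡ v (winv w)))))) (ρ-++ (u ++ winv v) (v ++ winv w)))
    (InB-⊠ p r))

  same-++ : ∀ {u v} w → Same u v → Same (u ++ w) (v ++ w)
  same-++ {u} {v} w (same p) = same (InB-≡ (ρ-∼
    (∼-trans (∼-reflexive (trans (cong ((u ++ w) ++_) (winv-++ v w)) (++-assoc u w _))) (∼-++ˡ u (winv-cancelʳ w (winv v))))) p)

  same? : ∀ u v → Dec (Same u v)
  same? u v = map′ same Same.inB (InB? (ρ (u ++ winv v)))

  Loop : Word → Word → Set
  Loop c g = Same (c ++ g) c

  loop-∼ : ∀ {c g h} → g ∼ h → Loop c g → Loop c h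
  loop-∼ {c} p = same-∼ (∼-++ˡ c p) ∼-refl

  loop-++ : ∀ {c g h} → Loop c g → Loop c h → Loop c (g ++ h)
  loop-++ {c} {g} {h} p r = same-∼ (∼-assoc c g h) ∼-refl (same-trans (same-++ h p) r)

  loop-winv : ∀ {c g} → Loop c g → Loop c (winv g)
  loop-winv {c} {g} p = same-sym (same-∼ (∼-trans (∼-assoc c g (winv g))
    (∼-trans (∼-++ˡ c (winv-inverseʳ g)) (∼-reflexive (++-identityʳ c)))) ∼-refl (same-++ (winv g) p))

  loop-cancel : ∀ {c g h} → Loop c g → Loop c (g ++ h) → Loop c h
  loop-cancel {c} {g} {h} p r = loop-∼ (winv-cancelˡ g h) (loop-++ (loop-winv p) r)

  loop-commW : ∀ {c g h} → Loop c g → Loop c h → Loop c (commW g h)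
  loop-commW p r = loop-++ p (loop-++ r (loop-++ (loop-winv p) (loop-winv r)))

  loop-InB : ∀ {c g} → Loop c g → InB (ρ (cj c g))
  loop-InB {c} {g} (same p) = InB-≡ (ρ-∼ (∼-assoc˘ c g (winv c))) p

  -- These weights descend from the Cayley graph to the coset graph of L.
  record Invariant (w : Weights) : Set where
    field
      S-inv : ∀ {u v} → Same u v → wS w (ρ u) ≡ wS w (ρ v)
      U-inv : ∀ {u v} → Same u v → wU w (ρ u) ≡ wU w (ρ v)

  open Invariant

  ρ-snoc-S : ∀ u → ρ u ⊠ ρS ≡ ρ (u ++ S ∷ [])
  ρ-snoc-S u = sym (trans (ρ-++ u (S ∷ [])) (cong (ρ u ⊠_) (⊠-identityʳ ρS)))

  ρ-snoc-U : ∀ u → ρ u ⊠ ρU ≡ ρ (u ++ U ∷ [])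
  ρ-snoc-U u = sym (trans (ρ-++ u (U ∷ [])) (cong (ρ u ⊠_) (⊠-identityʳ ρU)))

  wt-same : ∀ {w} → Invariant w → ∀ {u v} k → Same u v → wt w (ρ u) k ≡ wt w (ρ v) k
  wt-same inv [] p = refl
  wt-same {w} inv {u} {v} (S ∷ k) p = cong₂ _+_ (S-inv inv p) (trans (cong (λ A → wt w A k) (ρ-snoc-S u))
    (trans (wt-same inv k (same-++ (S ∷ []) p)) (cong (λ A → wt w A k) (sym (ρ-snoc-S v)))))
  wt-same {w} inv {u} {v} (U ∷ k) p = cong₂ _+_ (U-inv inv p) (trans (cong (λ A → wt w A k) (ρ-snoc-U u))
    (trans (wt-same inv k (same-++ (U ∷ []) p)) (cong (λ A → wt w A k) (sym (ρ-snoc-U v)))))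

  wt-append : ∀ w u k l → wt w (ρ u) (k ++ l) ≡ wt w (ρ u) k + wt w (ρ (u ++ k)) l
  wt-append w u k l = trans (wt-++ w (ρ u) k l) (cong (λ A → wt w (ρ u) k + wt w A l) (sym (ρ-++ u k)))

  wt-loop : ∀ {w} → Invariant w → ∀ {c g} h → Loop c g → wt w (ρ c) (g ++ h) ≡ wt w (ρ c) g + wt w (ρ c) h
  wt-loop {w} inv {c} {g} h p = trans (wt-append w c g h) (cong (_+_ (wt w (ρ c) g)) (wt-same inv h p))

  -- On loops at a fixed coset a valid invariant weight is a homomorphism to the abelian group ℤ/M.
  wt-commW : ∀ {w} → Valid w → Invariant w → ∀ {c g h} → Loop c g → Loop c h → wt w (ρ c) (commW g h) ≡ᴹ 0ℤ
  wt-commW {w} valid inv {c} {g} {h} p r = ≡ᴹ-trans (≡ᴹ-reflexive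
    (trans (wt-loop inv (h ++ (winv g ++ winv h)) p) (cong (_+_ G)
      (trans (wt-loop inv (winv g ++ winv h) r) (cong (_+_ H) (wt-loop inv (winv h) (loop-winv p)))))))
    (≡ᴹ-trans (≡ᴹ-reflexive (regroup G H G' H')) (≡ᴹ-trans (≡ᴹ-+ (inverse p) (inverse r)) (≡ᴹ-reflexive refl)))
    where
    G = wt w (ρ c) g
    H = wt w (ρ c) h
    G' = wt w (ρ c) (winv g)
    H' = wt w (ρ c) (winv h)
    regroup : ∀ a b c d → a + (b + (c + d)) ≡ (a + c) + (b + d)
    regroup = solve-∀
    inverse : ∀ {g} → Loop c g → wt w (ρ c) g + wt w (ρ c) (winv g) ≡ᴹ 0ℤ
    inverse {g} p = ≡ᴹ-trans (≡ᴹ-reflexive (sym (wt-loop inv (winv g) p))) (wt-∼ valid (ρ c) (winv-inverseʳ g))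

  -- The loop read by k at the coset of c is null-homologous, as far as the weights modulo M can tell.
  record NZ (c k : Word) : Set where
    constructor nz
    field
      loop : Loop c k
      null : ∀ {w} → Valid w → Invariant w → wt w (ρ c) k ≡ᴹ 0ℤ

  open NZ

  nz-∼ : ∀ {c k k'} → k ∼ k' → NZ c k → NZ c k'
  nz-∼ {c} p (nz l f) = nz (loop-∼ p l) (λ valid inv → ≡ᴹ-trans (wt-∼ valid (ρ c) (∼-sym p)) (f valid inv))

  nz-commW : ∀ {c g h k} → Loop c g → Loop c h → NZ c (commW g h ++ k) → NZ c k
  nz-commW {c} {g} {h} {k} p r (nz l f) = nz (loop-cancel (loop-commW p r) l)
    (λ {w} valid inv → ≡ᴹ-trans (≡ᴹ-reflexive (sym (+-identityˡ (wt w (ρ c) k))))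
      (≡ᴹ-trans (≡ᴹ-+ (≡ᴹ-sym (wt-commW valid inv p r)) (≡ᴹ-reflexive refl))
      (≡ᴹ-trans (≡ᴹ-reflexive (sym (wt-loop inv k (loop-commW p r)))) (f valid inv))))

  nz-rotate : ∀ {c} u v → NZ c (u ++ v) → NZ (c ++ u) (v ++ u)
  nz-rotate {c} u v (nz l f) = nz
    (same-∼ (∼-trans (∼-assoc c (u ++ v) u) (∼-trans (∼-++ˡ c (∼-assoc u v u)) (∼-assoc˘ c u (v ++ u)))) ∼-refl (same-++ u l))
    (λ {w} valid inv → ≡ᴹ-trans (≡ᴹ-reflexive (trans (wt-append w (c ++ u) v u)
        (trans (cong (_+_ (wt w (ρ (c ++ u)) v)) (wt-same inv u (same-∼ (∼-assoc˘ c u v) ∼-refl l)))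
        (trans (swap-+ (wt w (ρ (c ++ u)) v) (wt w (ρ c) u)) (sym (wt-append w c u v)))))) (f valid inv))
    where
    swap-+ : ∀ a b → a + b ≡ b + a
    swap-+ = solve-∀

  nz-cj : ∀ {c} e k → NZ c (cj e k) → NZ (c ++ e) k
  nz-cj e k p = nz-∼ (∼-trans (∼-assoc k (winv e) e) (∼-trans (∼-++ˡ k (winv-inverseˡ e)) (∼-reflexive (++-identityʳ k))))
    (nz-rotate e (k ++ winv e) p)

  not-divisible : ∀ k → 0 ℕ.< k → k ℕ.< M → ¬ (+ k ≡ᴹ 0ℤ)
  not-divisible k 0<k k<M p = ℕₚ.<⇒≱ k<M (∣⇒≤ {{ℕ.>-nonZero 0<k}} (∣⇒∣ᵤ (subst (+ M ∣_) (+-identityʳ (+ k)) (differenceᴹ p))))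

  ½M ⅓M : ℕ
  ½M = 3 ℕ.* suc n
  ⅓M = 2 ℕ.* suc n

  private
    doubled : ∀ z → + ½M * z + + ½M * z ≡ᴹ 0ℤ
    doubled z = mk≡ᴹ (divides z (trans (poly (+ ½M) z) (cong (λ k → z * + k) (sym (halves (suc n))))))
      where
      poly : ∀ h z → h * z + h * z - 0ℤ ≡ z * (h + h)
      poly = solve-∀
      halves : ∀ n → 6 ℕ.* n ≡ 3 ℕ.* n ℕ.+ 3 ℕ.* n
      halves = ℕ-Solver.solve-∀
    tripled : ∀ z → + ⅓M * z + (+ ⅓M * z + + ⅓M * z) ≡ᴹ 0ℤ
    tripled z = mk≡ᴹ (divides z (trans (poly (+ ⅓M) z) (cong (λ k → z * + k) (sym (thirds (suc n))))))
      where
      poly : ∀ h z → h * z + (h * z + h * z) - 0ℤ ≡ z * (h + (h + h))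
      poly = solve-∀
      thirds : ∀ n → 6 ℕ.* n ≡ 2 ℕ.* n ℕ.+ (2 ℕ.* n ℕ.+ 2 ℕ.* n)
      thirds = ℕ-Solver.solve-∀

  multiple< : ∀ k → k ℕ.< 6 → k ℕ.* suc n ℕ.< M
  multiple< k k<6 = ℕₚ.*-monoˡ-< (suc n) k<6

  ⊠ρSρS : ∀ A → (A ⊠ ρS) ⊠ ρS ≡ A
  ⊠ρSρS A = trans (⊠-assoc A ρS ρS) (trans (cong (A ⊠_) ρSS) (⊠-identityʳ A))

  ⊠ρUρUρU : ∀ A → ((A ⊠ ρU) ⊠ ρU) ⊠ ρU ≡ A
  ⊠ρUρUρU A = trans (⊠-assoc (A ⊠ ρU) ρU ρU) (trans (⊠-assoc A ρU (ρU ⊠ ρU)) (trans (cong (A ⊠_) ρUUU) (⊠-identityʳ A)))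

  -- Detects the abelianisation ℤ/2 × ℤ/3.
  constant : Weights
  constant = weights (λ _ → + ½M * 1ℤ) (λ _ → + ⅓M * 1ℤ)

  constant-valid : Valid constant
  constant-valid = record
    { S-cycle = λ _ → doubled 1ℤ ; U-cycle = λ _ → tripled 1ℤ ; S-resp = λ _ → refl ; U-resp = λ _ → refl }

  constant-invariant : Invariant constant
  constant-invariant = record { S-inv = λ _ → refl ; U-inv = λ _ → refl }

  module Indicator (p : Word) where

    -- Membership in the coset of `p`, phrased for matrices because weights are functions of
    -- matrices and not of words.
    In : M2 → Set
    In A = InB (A ⊠ ρ (winv p))

    ind : M2 → ℤ
    ind A with InB? (A ⊠ ρ (winv p))
    ... | yes _ = 1ℤ
    ... | no  _ = 0ℤ

    ind-yes : ∀ {A} → In A → ind A ≡ 1ℤ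
    ind-yes {A} r with InB? (A ⊠ ρ (winv p))
    ... | yes _ = refl
    ... | no ¬r = ⊥-elim (¬r r)

    ind-no : ∀ {A} → ¬ In A → ind A ≡ 0ℤ
    ind-no {A} ¬r with InB? (A ⊠ ρ (winv p))
    ... | yes r = ⊥-elim (¬r r)
    ... | no  _ = refl

    ind-cong : ∀ {A B} → (In A → In B) → (In B → In A) → ind A ≡ ind B
    ind-cong {A} {B} f g with InB? (A ⊠ ρ (winv p)) | InB? (B ⊠ ρ (winv p))
    ... | yes _ | yes _ = refl
    ... | no  _ | no  _ = refl
    ... | yes r | no ¬r = ⊥-elim (¬r (f r))
    ... | no ¬r | yes r = ⊥-elim (¬r (g r))

    ind-≋ : ∀ {A B} → A ≋ B → ind A ≡ ind B
    ind-≋ eq = ind-cong (InB-≋ (≋-⊠ʳ _ eq)) (InB-≋ (≋-sym (≋-⊠ʳ _ eq)))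

    same⇒In : ∀ {u} → Same u p → In (ρ u)
    same⇒In {u} (same r) = InB-≡ (sym (ρ-++ u (winv p))) r

    In⇒same : ∀ {u} → In (ρ u) → Same u p
    In⇒same {u} r = same (InB-≡ (ρ-++ u (winv p)) r)

    ind-same : ∀ {u v} → Same u v → ind (ρ u) ≡ ind (ρ v)
    ind-same r = ind-cong (λ i → same⇒In (same-trans (same-sym r) (In⇒same i))) (λ i → same⇒In (same-trans r (In⇒same i)))

    ind-same-S : ∀ {u v} → Same u v → ind (ρ u ⊠ ρS) ≡ ind (ρ v ⊠ ρS)
    ind-same-S {u} {v} r = trans (cong ind (ρ-snoc-S u)) (trans (ind-same (same-++ (S ∷ []) r)) (cong ind (sym (ρ-snoc-S v))))

    ind-same-U : ∀ {u v} → Same u v → ind (ρ u ⊠ ρU) ≡ ind (ρ v ⊠ ρU)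
    ind-same-U {u} {v} r = trans (cong ind (ρ-snoc-U u)) (trans (ind-same (same-++ (U ∷ []) r)) (cong ind (sym (ρ-snoc-U v))))

    ind-same-UU : ∀ {u v} → Same u v → ind ((ρ u ⊠ ρU) ⊠ ρU) ≡ ind ((ρ v ⊠ ρU) ⊠ ρU)
    ind-same-UU {u} {v} r = trans (cong (λ A → ind (A ⊠ ρU)) (ρ-snoc-U u))
      (trans (ind-same-U (same-++ (U ∷ []) r)) (cong (λ A → ind (A ⊠ ρU)) (sym (ρ-snoc-U v))))

    -- The net number of crossings out of the coset of p.
    outflow : Weights
    outflow = weights (λ A → ind A - ind (A ⊠ ρS)) (λ _ → 0ℤ)

    outflow-valid : Valid outflow
    outflow-valid = record
      { S-cycle = λ A → ≡ᴹ-reflexive (trans (cong (λ B → ind A - ind (A ⊠ ρS) + (ind (A ⊠ ρS) - ind B)) (⊠ρSρS A)) (poly (ind A) (ind (A ⊠ ρS))))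
      ; U-cycle = λ _ → ≡ᴹ-reflexive refl
      ; S-resp = λ eq → cong₂ _-_ (ind-≋ eq) (ind-≋ (≋-⊠ʳ ρS eq))
      ; U-resp = λ _ → refl }
      where
      poly : ∀ a b → a - b + (b - a) ≡ 0ℤ
      poly = solve-∀

    outflow-invariant : Invariant outflow
    outflow-invariant = record { S-inv = λ r → cong₂ _-_ (ind-same r) (ind-same-S r) ; U-inv = λ _ → refl }

    -- The parity of the number of crossings, when S fixes the coset of p.
    parity : Weights
    parity = weights (λ A → + ½M * (ind A * ind (A ⊠ ρS))) (λ _ → 0ℤ)

    parity-valid : Valid parity
    parity-valid = record
      { S-cycle = λ A → ≡ᴹ-trans (≡ᴹ-reflexive (cong (λ z → + ½M * (ind A * ind (A ⊠ ρS)) + + ½M * z)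
          (trans (cong (λ B → ind (A ⊠ ρS) * ind B) (⊠ρSρS A)) (*-comm' (ind (A ⊠ ρS)) (ind A))))) (doubled (ind A * ind (A ⊠ ρS)))
      ; U-cycle = λ _ → ≡ᴹ-reflexive refl
      ; S-resp = λ eq → cong (λ z → + ½M * z) (cong₂ _*_ (ind-≋ eq) (ind-≋ (≋-⊠ʳ ρS eq)))
      ; U-resp = λ _ → refl }
      where
      *-comm' : ∀ a b → a * b ≡ b * a
      *-comm' = solve-∀

    parity-invariant : Invariant parity
    parity-invariant = record { S-inv = λ r → cong (λ z → + ½M * z) (cong₂ _*_ (ind-same r) (ind-same-S r)) ; U-inv = λ _ → refl }

    -- The turns made at the coset of p modulo 3, when U fixes it.
    turning : Weights
    turning = weights (λ _ → 0ℤ) (λ A → + ⅓M * (ind A * (ind (A ⊠ ρU) * ind ((A ⊠ ρU) ⊠ ρU))))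

    turning-cycle : ∀ A → wU turning (A ⊠ ρU) ≡ wU turning A
    turning-cycle A = trans (cong (λ B → + ⅓M * (ind (A ⊠ ρU) * (ind ((A ⊠ ρU) ⊠ ρU) * ind B))) (⊠ρUρUρU A))
      (cong (λ z → + ⅓M * z) (poly (ind A) (ind (A ⊠ ρU)) (ind ((A ⊠ ρU) ⊠ ρU))))
      where
      poly : ∀ a b c → b * (c * a) ≡ a * (b * c)
      poly = solve-∀

    turning-valid : Valid turning
    turning-valid = record
      { S-cycle = λ _ → ≡ᴹ-reflexive refl
      ; U-cycle = λ A → ≡ᴹ-trans (≡ᴹ-reflexive (cong (_+_ (wU turning A)) (cong₂ _+_ (turning-cycle A)
                    (trans (turning-cycle (A ⊠ ρU)) (turning-cycle A))))) (tripled (ind A * (ind (A ⊠ ρU) * ind ((A ⊠ ρU) ⊠ ρU))))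
      ; S-resp = λ _ → refl
      ; U-resp = λ eq → cong (λ z → + ⅓M * z) (cong₂ _*_ (ind-≋ eq)
                    (cong₂ _*_ (ind-≋ (≋-⊠ʳ ρU eq)) (ind-≋ (≋-⊠ʳ ρU (≋-⊠ʳ ρU eq))))) }

    turning-invariant : Invariant turning
    turning-invariant = record { S-inv = λ _ → refl
      ; U-inv = λ r → cong (λ z → + ⅓M * z) (cong₂ _*_ (ind-same r) (cong₂ _*_ (ind-same-U r) (ind-same-UU r))) }

  wt-W : ∀ w u ε es → wt w (ρ u) (W (ε ∷ es)) ≡ wS w (ρ u) + (wt w (ρ u ⊠ ρS) (uw ε) + wt w (ρ (next u ε)) (W es))
  wt-W w u ε es = cong (_+_ (wS w (ρ u))) (trans (wt-++ w (ρ u ⊠ ρS) (uw ε) (W es))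
    (cong (λ A → wt w (ρ u ⊠ ρS) (uw ε) + wt w A (W es)) (sym (trans (ρ-++ u (S ∷ uw ε)) (sym (⊠-assoc (ρ u) ρS (ρ (uw ε))))))))

  wt-zero : ∀ {w P} → (∀ u ε → ¬ P u → wS w (ρ u) + wt w (ρ u ⊠ ρS) (uw ε) ≡ 0ℤ) →
            ∀ u es → ¬ Hit P u es → wt w (ρ u) (W es) ≡ 0ℤ
  wt-zero step u [] miss = refl
  wt-zero {w} step u (ε ∷ es) miss = trans (wt-W w u ε es) (trans (sym (+-assoc (wS w (ρ u)) _ _))
    (cong₂ _+_ (step u ε (λ p → miss (here p))) (wt-zero {w} step (next u ε) es (λ h → miss (there h)))))

  module _ (p : Word) where

    open Indicator p

    -- As S² = 1, the `S` read at such a `u` runs backwards through the edge that the `S` read at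
    -- `p` traverses.
    Opposite : Word → Set
    Opposite u = Same (u ++ S ∷ []) p

    ind-Opposite : ∀ {u} → Opposite u → ind (ρ u ⊠ ρS) ≡ 1ℤ
    ind-Opposite {u} r = trans (cong ind (ρ-snoc-S u)) (ind-yes (same⇒In r))

    ind-¬Opposite : ∀ {u} → ¬ Opposite u → ind (ρ u ⊠ ρS) ≡ 0ℤ
    ind-¬Opposite {u} ¬r = trans (cong ind (ρ-snoc-S u)) (ind-no (λ i → ¬r (In⇒same i)))

    ind-bit : ∀ A → ∃ λ k → k ℕ.≤ 1 × ind A ≡ + k
    ind-bit A with InB? (A ⊠ ρ (winv p))
    ... | yes _ = 1 , s≤s z≤n , refl
    ... | no  _ = 0 , z≤n , refl

    no-U : ∀ (f : M2 → ℤ) A ε → wt (weights f (λ _ → 0ℤ)) A (uw ε) ≡ 0ℤ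
    no-U f A ℓ = refl
    no-U f A ʳ = refl

    -- Without opposite crossings every `S` contributes 0 or 1, so the sum is a genuine natural
    -- number bounded by the length and not merely a residue.
    outflow-count : ∀ u es → ¬ Hit Opposite u es → ∃ λ k → k ℕ.≤ length es × wt outflow (ρ u) (W es) ≡ + k
    outflow-count u [] miss = 0 , z≤n , refl
    outflow-count u (ε ∷ es) miss with ind-bit (ρ u) | outflow-count (next u ε) es (λ h → miss (there h))
    ... | k , k≤1 , eq | l , l≤ , eq' = k ℕ.+ l , ℕₚ.+-mono-≤ k≤1 l≤ , trans (wt-W outflow u ε es) (trans
      (cong₂ _+_ (trans (cong₂ _-_ eq (ind-¬Opposite {u} (λ r → miss (here r)))) (+-identityʳ (+ k)))
                 (cong₂ _+_ (no-U _ (ρ u ⊠ ρS) ε) eq')) (cong (_+_ (+ k)) (+-identityˡ (+ l))))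

    parity-step : ∀ u ε → ¬ Opposite u → wS parity (ρ u) + wt parity (ρ u ⊠ ρS) (uw ε) ≡ 0ℤ
    parity-step u ε ¬r = trans (cong₂ _+_ (cong (λ z → + ½M * (ind (ρ u) * z)) (ind-¬Opposite {u} ¬r)) (no-U _ (ρ u ⊠ ρS) ε)) (poly (+ ½M) (ind (ρ u)))
      where
      poly : ∀ h i → h * (i * 0ℤ) + 0ℤ ≡ 0ℤ
      poly = solve-∀

  -- Without an opposite crossing, parity (if S fixes the coset of p) or outflow (otherwise) would not vanish on the path.
  partner : ∀ c pre ε post → length (pre ++ ε ∷ post) ℕ.≤ suc n → NZ c (W (pre ++ ε ∷ post)) →
            let p = c ++ W pre in Hit (Opposite p) c pre ⊎ Hit (Opposite p) (next p ε) post
  partner c pre ε post len z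
    with hit? (λ u → same? (u ++ S ∷ []) (c ++ W pre)) c pre | hit? (λ u → same? (u ++ S ∷ []) (c ++ W pre)) (next (c ++ W pre) ε) post
  ... | yes h | _     = inj₁ h
  ... | no _  | yes h = inj₂ h
  ... | no ¬h | no ¬h' with same? ((c ++ W pre) ++ S ∷ []) (c ++ W pre)
  ...   | yes self = ⊥-elim (not-divisible ½M (s≤s z≤n) (multiple< 3 (s≤s (s≤s (s≤s (s≤s z≤n)))))
            (≡ᴹ-trans (≡ᴹ-reflexive (sym total)) (null z parity-valid parity-invariant)))
    where
    p = c ++ W pre
    open Indicator p
    poly : ∀ h → 0ℤ + (h * (1ℤ * 1ℤ) + (0ℤ + 0ℤ)) ≡ h
    poly = solve-∀
    total : wt parity (ρ c) (W (pre ++ ε ∷ post)) ≡ + ½M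
    total = trans (cong (wt parity (ρ c)) (W-++ pre (ε ∷ post))) (trans (wt-append parity c (W pre) (W (ε ∷ post)))
      (trans (cong₂ _+_ (wt-zero {parity} (parity-step p) c pre ¬h) (trans (wt-W parity p ε post)
        (cong₂ _+_ (cong (λ z → + ½M * z) (cong₂ _*_ (ind-yes (same⇒In {p} same-refl)) (ind-Opposite p {p} self)))
          (cong₂ _+_ (no-U p _ (ρ p ⊠ ρS) ε) (wt-zero {parity} (parity-step p) (next p ε) post ¬h'))))) (poly (+ ½M))))
  ...   | no ¬self with outflow-count (c ++ W pre) c pre ¬h | outflow-count (c ++ W pre) (next (c ++ W pre) ε) post ¬h'
  ...     | k , k≤ , eq | l , l≤ , eq' = ⊥-elim (not-divisible (k ℕ.+ suc l) (ℕₚ.≤-trans (s≤s z≤n) (ℕₚ.m≤n+m (suc l) k)) small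
            (≡ᴹ-trans (≡ᴹ-reflexive (sym total)) (null z outflow-valid outflow-invariant)))
    where
    p = c ++ W pre
    open Indicator p
    small : k ℕ.+ suc l ℕ.< M
    small = ℕₚ.≤-<-trans (ℕₚ.≤-trans (ℕₚ.+-mono-≤ k≤ (s≤s l≤)) (subst (ℕ._≤ suc n) (length-++ pre) len))
      (subst (ℕ._< M) (ℕₚ.+-identityʳ (suc n)) (multiple< 1 (s≤s (s≤s z≤n))))
    poly : ∀ k l → k + (1ℤ - 0ℤ + (0ℤ + l)) ≡ k + (1ℤ + l)
    poly = solve-∀
    total : wt outflow (ρ c) (W (pre ++ ε ∷ post)) ≡ + (k ℕ.+ suc l)
    total = trans (cong (wt outflow (ρ c)) (W-++ pre (ε ∷ post))) (trans (wt-append outflow c (W pre) (W (ε ∷ post)))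
      (trans (cong₂ _+_ eq (trans (wt-W outflow p ε post)
        (cong₂ _+_ (cong₂ _-_ (ind-yes (same⇒In {p} same-refl)) (ind-¬Opposite p {p} ¬self)) (cong₂ _+_ (no-U p _ (ρ p ⊠ ρS) ε) eq'))))
        (poly (+ k) (+ l))))

  module _ (v : Word) (loopU : Loop v (U ∷ [])) where

    open Indicator v

    TurnAt : Word → Set
    TurnAt u = Same (u ++ S ∷ []) v

    turning-step : ∀ u ε → ¬ TurnAt u → wS turning (ρ u) + wt turning (ρ u ⊠ ρS) (uw ε) ≡ 0ℤ
    turning-step u ε ¬r = lemma ε
      where
      A = ρ u ⊠ ρS
      poly : ∀ h i → h * (0ℤ * i) ≡ 0ℤ
      poly = solve-∀
      null₁ : wU turning A ≡ 0ℤ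
      null₁ = trans (cong (λ z → + ⅓M * (z * (ind (A ⊠ ρU) * ind ((A ⊠ ρU) ⊠ ρU))))
                (trans (cong ind (ρ-snoc-S u)) (ind-no (λ i → ¬r (In⇒same i))))) (poly (+ ⅓M) (ind (A ⊠ ρU) * ind ((A ⊠ ρU) ⊠ ρU)))
      lemma : ∀ ε → wS turning (ρ u) + wt turning A (uw ε) ≡ 0ℤ
      lemma ℓ = cong (λ z → 0ℤ + (z + 0ℤ)) null₁
      lemma ʳ = cong₂ (λ z t → 0ℤ + (z + (t + 0ℤ))) null₁ (trans (turning-cycle A) null₁)

    turning-here : ∀ u → TurnAt u → wU turning (ρ u ⊠ ρS) ≡ + ⅓M
    turning-here u r = trans (cong (wU turning) (ρ-snoc-S u)) (trans (U-inv turning-invariant r)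
      (trans (cong (λ z → + ⅓M * z) (cong₂ _*_ (ind-yes (same⇒In {v} same-refl)) (cong₂ _*_ at₁ at₂))) (poly (+ ⅓M))))
      where
      poly : ∀ h → h * (1ℤ * (1ℤ * 1ℤ)) ≡ h
      poly = solve-∀
      at₁ : ind (ρ v ⊠ ρU) ≡ 1ℤ
      at₁ = trans (cong ind (ρ-snoc-U v)) (ind-yes (same⇒In loopU))
      at₂ : ind ((ρ v ⊠ ρU) ⊠ ρU) ≡ 1ℤ
      at₂ = trans (cong (λ B → ind (B ⊠ ρU)) (ρ-snoc-U v)) (trans (ind-same-U loopU) at₁)

  -- If the first turn were the only one made at this coset, which `U` fixes, the weight `turning`
  -- of the path would be one or two thirds of `M`, neither of which is 0 modulo `M`.
  another-turn : ∀ c ε post → Loop (c ++ S ∷ []) (U ∷ []) → NZ c (W (ε ∷ post)) →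
                 Hit (λ u → Same (u ++ S ∷ []) (c ++ S ∷ [])) (next c ε) post
  another-turn c ε post loopU z with hit? (λ u → same? (u ++ S ∷ []) (c ++ S ∷ [])) (next c ε) post
  ... | yes h = h
  ... | no ¬h = ⊥-elim (impossible ε refl)
    where
    v = c ++ S ∷ []
    open Indicator v
    A = ρ c ⊠ ρS
    one-turn : wU turning A ≡ + ⅓M
    one-turn = turning-here v loopU c same-refl
    total : wt turning (ρ c) (W (ε ∷ post)) ≡ 0ℤ + (wt turning A (uw ε) + 0ℤ)
    total = trans (wt-W turning c ε post) (cong (λ z → 0ℤ + (wt turning A (uw ε) + z)) (wt-zero {turning} (turning-step v loopU) (next c ε) post ¬h))
    zero-total : 0ℤ + (wt turning A (uw ε) + 0ℤ) ≡ᴹ 0ℤ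
    zero-total = ≡ᴹ-trans (≡ᴹ-reflexive (sym total)) (null z turning-valid turning-invariant)
    clean₁ : ∀ h → h ≡ 0ℤ + (h + 0ℤ + 0ℤ)
    clean₁ = solve-∀
    clean₂ : ∀ h → h + h ≡ 0ℤ + (h + (h + 0ℤ) + 0ℤ)
    clean₂ = solve-∀
    impossible : ∀ ε' → ε ≡ ε' → ⊥
    impossible ℓ refl = not-divisible ⅓M (s≤s z≤n) (multiple< 2 (s≤s (s≤s (s≤s z≤n))))
      (≡ᴹ-trans (≡ᴹ-reflexive (trans (clean₁ (+ ⅓M)) (cong (λ z → 0ℤ + (z + 0ℤ + 0ℤ)) (sym one-turn)))) zero-total)
    impossible ʳ refl = not-divisible (⅓M ℕ.+ ⅓M) (s≤s z≤n)
      (subst (ℕ._< M) (four (suc n)) (multiple< 4 (s≤s (s≤s (s≤s (s≤s (s≤s z≤n)))))))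
      (≡ᴹ-trans (≡ᴹ-reflexive (trans (clean₂ (+ ⅓M))
        (cong₂ (λ z t → 0ℤ + (z + (t + 0ℤ) + 0ℤ)) (sym one-turn) (sym (trans (turning-cycle A) one-turn))))) zero-total)
      where
      four : ∀ n → 4 ℕ.* n ≡ 2 ℕ.* n ℕ.+ 2 ℕ.* n
      four = ℕ-Solver.solve-∀

-- Surgery on closed paths.

-- The constructors tell where `z` stands relative to `x` when one list is split at both.
data Position {A : Set} (xs : List A) (x : A) (ys zs : List A) (z : A) (ws : List A) : Set where
  before : ∀ s → xs ≡ zs ++ z ∷ s → ws ≡ s ++ x ∷ ys → Position xs x ys zs z ws
  at     : xs ≡ zs → x ≡ z → ys ≡ ws → Position xs x ys zs z ws
  after  : ∀ s → zs ≡ xs ++ x ∷ s → ys ≡ s ++ z ∷ ws → Position xs x ys zs z ws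

position : ∀ {A : Set} (xs : List A) x ys zs z ws → xs ++ x ∷ ys ≡ zs ++ z ∷ ws → Position xs x ys zs z ws
position []        x ys []        z ws eq with ∷-injective eq
... | refl , refl = at refl refl refl
position []        x ys (z' ∷ zs) z ws eq with ∷-injective eq
... | refl , refl = after zs refl refl
position (x' ∷ xs) x ys []        z ws eq with ∷-injective eq
... | refl , refl = before xs refl refl
position (x' ∷ xs) x ys (z' ∷ zs) z ws eq with ∷-injective eq
... | refl , eq' with position xs x ys zs z ws eq'
...   | before s p r = before s (cong (x' ∷_) p) r
...   | at p r t     = at (cong (x' ∷_) p) r t
...   | after s p r  = after s (cong (x' ∷_) p) r

module Descent (a : ℤ) (q : ℕ) .{{_ : NonZero q}} (n : ℕ) (x y : Word) where

  open Rep a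
  open Core a q n x y
  open Mod (+ M) using () renaming (_≡ᵐ_ to _≡ᴹ_)

  Opp : Word → List Turn → List Turn → Set
  Opp c pre pre' = Same ((c ++ W pre) ++ S ∷ []) (c ++ W pre')

  opp-sym : ∀ c {pre pre'} → Opp c pre pre' → Opp c pre' pre
  opp-sym c {pre} {pre'} r = same-sym (same-∼ (∼-trans (∼-assoc (c ++ W pre) (S ∷ []) (S ∷ []))
    (∼-trans (∼-++ˡ (c ++ W pre) ∼-SS) (∼-reflexive (++-identityʳ (c ++ W pre))))) ∼-refl (same-++ (S ∷ []) r))

  state-++ : ∀ c pre post → c ++ W (pre ++ post) ≡ (c ++ W pre) ++ W post
  state-++ c pre post = trans (cong (c ++_) (W-++ pre post)) (sym (++-assoc c (W pre) (W post)))

  partner-split : ∀ c pre ε post → length (pre ++ ε ∷ post) ℕ.≤ suc n → NZ c (W (pre ++ ε ∷ post)) →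
    (∃ λ pre' → ∃ λ ε' → ∃ λ s → pre ≡ pre' ++ ε' ∷ s × Opp c pre' pre) ⊎
    (∃ λ s → ∃ λ ε' → ∃ λ post' → post ≡ s ++ ε' ∷ post' × Opp c (pre ++ ε ∷ s) pre)
  partner-split c pre ε post len z with partner c pre ε post len z
  ... | inj₁ h with hit-split h
  ...   | pre' , ε' , s , eq , r = inj₁ (pre' , ε' , s , eq , r)
  partner-split c pre ε post len z | inj₂ h with hit-split h
  ...   | s , ε' , post' , eq , r = inj₂ (s , ε' , post' , eq ,
    subst (λ u → Same (u ++ S ∷ []) (c ++ W pre)) (trans (next-++ (c ++ W pre) ε (W s)) (sym (state-++ c pre (ε ∷ s)))) r)

  -- In `linked` the first and third of four crossings are opposite, and so are the second and
  -- fourth: the pairs interleave. In `backtrack` the path traverses an edge, makes one turn and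
  -- would return through the same edge, so this turn, and with it `U`, fixes the coset in between.
  data Crossing (c : Word) (es : List Turn) : Set where
    linked : ∀ P t₁ A t₂ B t₃ C t₄ D → es ≡ P ++ ((t₁ ∷ A) ++ ((t₂ ∷ B) ++ ((t₃ ∷ C) ++ (t₄ ∷ D)))) →
             Opp c (P ++ ((t₁ ∷ A) ++ (t₂ ∷ B))) P →
             Opp c (P ++ ((t₁ ∷ A) ++ ((t₂ ∷ B) ++ (t₃ ∷ C)))) (P ++ (t₁ ∷ A)) → Crossing c es
    backtrack : ∀ P ε Q → es ≡ P ++ (ε ∷ Q) → Opp c (P ++ (ε ∷ [])) P → Crossing c es

  -- A pair of opposite crossings at minimal distance is either adjacent or linked with the pair of an inner crossing.
  find : ∀ c P ε X ε' Y → Acc ℕ._<_ (length X) → let es = P ++ ((ε ∷ X) ++ (ε' ∷ Y)) in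
         length es ℕ.≤ suc n → NZ c (W es) → Opp c (P ++ (ε ∷ X)) P → Crossing c es
  find c P ε [] ε' Y _ len z r = backtrack P ε (ε' ∷ Y) refl r
  find c P ε (η ∷ X) ε' Y (acc rs) len z r
    with partner-split c (P ++ ε ∷ []) η (X ++ ε' ∷ Y) (subst (λ es → length es ℕ.≤ suc n) regroup len) (subst (λ es → NZ c (W es)) regroup z)
    where
    regroup : P ++ ((ε ∷ η ∷ X) ++ (ε' ∷ Y)) ≡ (P ++ ε ∷ []) ++ η ∷ (X ++ ε' ∷ Y)
    regroup = sym (++-assoc P (ε ∷ []) (η ∷ (X ++ ε' ∷ Y)))
  ... | inj₁ (pre' , ε₁ , s , eq , r') = inner (position P ε [] pre' ε₁ s eq)
    where
    es = P ++ ((ε ∷ η ∷ X) ++ (ε' ∷ Y))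
    inner : Position P ε [] pre' ε₁ s → Crossing c es
    inner (before t refl _) = linked pre' ε₁ t ε [] η X ε' Y
      (++-assoc pre' (ε₁ ∷ t) _)
      (subst₂ (Opp c) (++-assoc pre' (ε₁ ∷ t) (ε ∷ [])) refl (opp-sym c {pre'} {(pre' ++ ε₁ ∷ t) ++ ε ∷ []} r'))
      (subst₂ (Opp c) (++-assoc pre' (ε₁ ∷ t) (ε ∷ η ∷ X)) refl r)
    inner (at refl _ _) = backtrack P ε (η ∷ X ++ ε' ∷ Y) refl (opp-sym c {P} {P ++ ε ∷ []} r')
    inner (after [] _ ())
    inner (after (_ ∷ _) _ ())
  ... | inj₂ (s , ε₁ , post' , eq , r') = inner (position X ε' Y s ε₁ post' eq)
    where
    es = P ++ ((ε ∷ η ∷ X) ++ (ε' ∷ Y))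
    inner : Position X ε' Y s ε₁ post' → Crossing c es
    inner (before t refl refl) = subst (Crossing c) regroup
      (find c (P ++ ε ∷ []) η s ε₁ (t ++ ε' ∷ Y)
        (rs (s≤s (ℕₚ.≤-trans (ℕₚ.m≤m+n (length s) _) (ℕₚ.≤-reflexive (sym (length-++ s))))))
        (subst (λ es → length es ℕ.≤ suc n) (sym regroup) len) (subst (λ es → NZ c (W es)) (sym regroup) z) r')
      where
      regroup : (P ++ ε ∷ []) ++ ((η ∷ s) ++ (ε₁ ∷ (t ++ ε' ∷ Y))) ≡ P ++ ((ε ∷ η ∷ (s ++ ε₁ ∷ t)) ++ (ε' ∷ Y))
      regroup = trans (++-assoc P (ε ∷ []) _) (cong (λ l → P ++ ε ∷ η ∷ l) (sym (++-assoc s (ε₁ ∷ t) (ε' ∷ Y))))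
    inner (at refl refl refl) = subst (Crossing c) (++-assoc P (ε ∷ []) _)
      (find c (P ++ ε ∷ []) η X ε' Y (rs ℕₚ.≤-refl)
        (subst (λ es → length es ℕ.≤ suc n) (sym (++-assoc P (ε ∷ []) _)) len) (subst (λ es → NZ c (W es)) (sym (++-assoc P (ε ∷ []) _)) z) r')
    inner (after t refl refl) = linked P ε [] η X ε' t ε₁ post'
      (cong (λ l → P ++ ε ∷ η ∷ l) refl) r
      (subst₂ (Opp c) (++-assoc P (ε ∷ []) (η ∷ (X ++ ε' ∷ t))) refl r')

  crossing : ∀ c ε es → length (ε ∷ es) ℕ.≤ suc n → NZ c (W (ε ∷ es)) → Crossing c (ε ∷ es)
  crossing c ε es len z with partner-split c [] ε es len z
  ... | inj₁ ([] , _ , _ , () , _)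
  ... | inj₁ (_ ∷ _ , _ , _ , () , _)
  ... | inj₂ (s , ε' , post' , refl , r) = find c [] ε s ε' post' (<-wellFounded _) len z r

  -- The conjugator `e` is kept apart from `K` because the descent measures only `K`; moving the
  -- base point along `e` turns `K` itself into a null-homologous loop.
  record Reduction (es : List Turn) : Set where
    field
      c G H K e t : Word
      loop-G  : Loop c G
      loop-H  : Loop c H
      nz-K    : NZ c (cj e K)
      fewer   : #S K ℕ.< length es
      factor  : W es ∼ cj t (commW G H ++ cj e K)

  rotate-W : ∀ P Q → W (P ++ Q) ∼ cj (W P) (W (Q ++ P))
  rotate-W P Q = ∼-trans (∼-reflexive (W-++ P Q)) (∼-trans (rotate (W P) (W Q)) (cj-cong (W P) (∼-reflexive (sym (W-++ Q P)))))

  nz-rotate-W : ∀ {c} P Q → NZ c (W (P ++ Q)) → NZ (c ++ W P) (W (Q ++ P))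
  nz-rotate-W P Q z = nz-∼ (∼-reflexive (sym (W-++ Q P))) (nz-rotate (W P) (W Q) (nz-∼ (∼-reflexive (W-++ P Q)) z))

  tail° : Turn → List Turn → Word
  tail° t A = uw t ++ W A

  #S-tail° : ∀ t A → #S (tail° t A) ≡ length A
  #S-tail° t A = trans (#S-++ (uw t) (W A)) (cong₂ ℕ._+_ (#S-uw t) (#S-W A))

  -- S α S β S γ S δ = [H, G⁻¹] γ β α δ for G = S α S β S and H = S α S β S γ S (S α)⁻¹.
  linked-reduction : ∀ c P t₁ A t₂ B t₃ C t₄ D → let es = P ++ ((t₁ ∷ A) ++ ((t₂ ∷ B) ++ ((t₃ ∷ C) ++ (t₄ ∷ D)))) in
    NZ c (W es) → Opp c (P ++ ((t₁ ∷ A) ++ (t₂ ∷ B))) P →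
    Opp c (P ++ ((t₁ ∷ A) ++ ((t₂ ∷ B) ++ (t₃ ∷ C)))) (P ++ (t₁ ∷ A)) → Reduction es
  linked-reduction c P t₁ A t₂ B t₃ C t₄ D z r₁ r₂ = record
    { c = c₁ ; G = H ; H = winv G ; K = κ ; e = [] ; t = W P
    ; loop-G = loop-H ; loop-H = loop-winv loop-G
    ; nz-K = nz-∼ (cj-[] κ) (nz-commW loop-H (loop-winv loop-G) (nz-∼ factor₁ (nz-∼ (∼-reflexive word) (nz-rotate-W P Q z))))
    ; fewer = fewer
    ; factor = ∼-trans (rotate-W P Q) (cj-cong (W P) (∼-trans (∼-reflexive word) (∼-trans factor₁ (∼-++ˡ (commW H (winv G)) (cj-[] κ)))))
    }
    where
    Q = (t₁ ∷ A) ++ ((t₂ ∷ B) ++ ((t₃ ∷ C) ++ (t₄ ∷ D)))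
    c₁ = c ++ W P
    α = tail° t₁ A
    β = tail° t₂ B
    γ = tail° t₃ C
    δ = tail° t₄ (D ++ P)
    κ = γ ++ (β ++ (α ++ δ))
    wA = S ∷ α
    wB = S ∷ β
    wC = S ∷ γ
    G = wA ++ (wB ++ S ∷ [])
    H = wA ++ (wB ++ (wC ++ (S ∷ winv wA)))
    word : W (Q ++ P) ≡ wA ++ (wB ++ (wC ++ (S ∷ δ)))
    word = trans (cong W (trans (++-assoc (t₁ ∷ A) _ P) (cong ((t₁ ∷ A) ++_) (trans (++-assoc (t₂ ∷ B) _ P)
        (cong ((t₂ ∷ B) ++_) (++-assoc (t₃ ∷ C) (t₄ ∷ D) P))))))
      (trans (W-++ (t₁ ∷ A) _) (cong (wA ++_) (trans (W-++ (t₂ ∷ B) _) (cong (wB ++_) (W-++ (t₃ ∷ C) (t₄ ∷ (D ++ P)))))))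
    G-app : ∀ v → G ++ v ≡ wA ++ (wB ++ (S ∷ v))
    G-app v = trans (++-assoc wA _ v) (cong (wA ++_) (++-assoc wB (S ∷ []) v))
    H-app : ∀ v → H ++ v ≡ wA ++ (wB ++ (wC ++ (S ∷ (winv wA ++ v))))
    H-app v = trans (++-assoc wA _ v) (cong (wA ++_) (trans (++-assoc wB _ v) (cong (wB ++_) (++-assoc wC _ v))))
    H-wA : ∀ v → H ++ (wA ++ v) ∼ wA ++ (wB ++ (wC ++ (S ∷ v)))
    H-wA v = ∼-trans (∼-reflexive (H-app (wA ++ v))) (∼-++ˡ wA (∼-++ˡ wB (∼-++ˡ wC (∼-cons S (winv-cancelˡ wA v)))))
    step₁ : winv H ++ (winv (winv G) ++ κ) ∼ wA ++ (wB ++ (α ++ δ))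
    step₁ = ∼-trans (∼-++ˡ (winv H) (∼-trans (∼-++ʳ κ (winv-involutive G)) (∼-trans (∼-reflexive (G-app κ)) (∼-sym
        (∼-trans (H-wA (S ∷ (β ++ (α ++ δ)))) (∼-++ˡ wA (∼-++ˡ wB (∼-++ˡ wC ∼-SS))))))))
      (winv-cancelˡ H (wA ++ (S ∷ (β ++ (α ++ δ)))))
    step₂ : winv G ++ (wA ++ (wB ++ (α ++ δ))) ∼ wA ++ δ
    step₂ = ∼-trans (∼-++ˡ (winv G) (∼-sym (∼-trans (∼-reflexive (G-app (S ∷ (α ++ δ)))) (∼-++ˡ wA (∼-++ˡ wB ∼-SS)))))
      (winv-cancelˡ G (S ∷ (α ++ δ)))
    factor₁ : wA ++ (wB ++ (wC ++ (S ∷ δ))) ∼ commW H (winv G) ++ κ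
    factor₁ = ∼-sym (∼-trans (∼-reflexive (trans (++-assoc H _ κ) (cong (H ++_) (trans (++-assoc (winv G) _ κ)
        (cong (winv G ++_) (++-assoc (winv H) (winv (winv G)) κ))))))
      (∼-trans (∼-++ˡ H (∼-trans (∼-++ˡ (winv G) step₁) step₂)) (H-wA δ)))
    -- The two opposite pairs are what closes `G` and `H`: by `r₁` the word S α S β S returns to the
    -- coset of `c₁`, and by `r₂` the word S α S β S γ S ends in the same coset as S α.
    loop-G : Loop c₁ G
    loop-G = same-∼ (∼-reflexive (trans (cong (_++ S ∷ []) (trans (state-++ c P _) (cong (c₁ ++_) (W-++ (t₁ ∷ A) (t₂ ∷ B)))))
      (trans (++-assoc c₁ _ _) (cong (c₁ ++_) (++-assoc wA wB (S ∷ [])))))) ∼-refl r₁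
    loop-H : Loop c₁ H
    loop-H = same-∼
      (∼-reflexive (trans (cong (λ u → (u ++ S ∷ []) ++ winv wA) (trans (state-++ c P _) (cong (c₁ ++_)
          (trans (W-++ (t₁ ∷ A) _) (cong (wA ++_) (W-++ (t₂ ∷ B) (t₃ ∷ C)))))))
        (trans (++-assoc (c₁ ++ (wA ++ (wB ++ wC))) (S ∷ []) (winv wA)) (trans (++-assoc c₁ _ _)
          (cong (c₁ ++_) (trans (++-assoc wA _ _) (cong (wA ++_) (++-assoc wB wC _))))))))
      (∼-trans (∼-reflexive (trans (cong (_++ winv wA) (state-++ c P (t₁ ∷ A))) (++-assoc c₁ wA (winv wA))))
        (∼-trans (∼-++ˡ c₁ (winv-inverseʳ wA)) (∼-reflexive (++-identityʳ c₁))))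
      (same-++ (winv wA) r₂)
    count : #S κ ≡ length C ℕ.+ (length B ℕ.+ (length A ℕ.+ (length D ℕ.+ length P)))
    count = trans (#S-++ γ _) (cong₂ ℕ._+_ (#S-tail° t₃ C) (trans (#S-++ β _) (cong₂ ℕ._+_ (#S-tail° t₂ B)
      (trans (#S-++ α δ) (cong₂ ℕ._+_ (#S-tail° t₁ A) (trans (#S-tail° t₄ (D ++ P)) (length-++ D)))))))
    total : length (P ++ Q) ≡ 4 ℕ.+ (length C ℕ.+ (length B ℕ.+ (length A ℕ.+ (length D ℕ.+ length P))))
    total = trans (length-++ P) (trans (cong (λ k → length P ℕ.+ suc k) (trans (length-++ A) (cong (λ k → length A ℕ.+ suc k)
      (trans (length-++ B) (cong (λ k → length B ℕ.+ suc k) (length-++ C)))))) (regroup (length P) (length A) (length B) (length C) (length D)))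
      where
      regroup : ∀ p a b c d → p ℕ.+ suc (a ℕ.+ suc (b ℕ.+ suc (c ℕ.+ suc d))) ≡ 4 ℕ.+ (c ℕ.+ (b ℕ.+ (a ℕ.+ (d ℕ.+ p))))
      regroup = ℕ-Solver.solve-∀
    fewer : #S κ ℕ.< length (P ++ Q)
    fewer = subst₂ ℕ._<_ (sym count) (sym total) (ℕₚ.m<n+m _ {4} (s≤s z≤n))

  leading-S : ∀ X r → ∃ λ Z → W X ++ (S ∷ r) ≡ S ∷ Z
  leading-S []      r = r , refl
  leading-S (η ∷ X) r = (uw η ++ W X) ++ (S ∷ r) , refl

  -- U^ε X U^ε' Y = [U^ε, X] (X U^ε U^ε' Y), and the second factor begins and ends with S.
  backtrack-reduction : ∀ c P ε Q → NZ c (W (P ++ (ε ∷ Q))) → Opp c (P ++ (ε ∷ [])) P → Reduction (P ++ (ε ∷ Q))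
  backtrack-reduction c P ε Q z r = build (hit-split (another-turn c₁ ε post loopU z₁))
    where
    c₁ = c ++ W P
    post = Q ++ P
    v = c₁ ++ S ∷ []
    z₁ : NZ c₁ (W (ε ∷ post))
    z₁ = nz-rotate-W P (ε ∷ Q) z
    loopε : Loop v (uw ε)
    loopε = same-∼
      (∼-trans (∼-reflexive (trans (cong (λ u → (u ++ S ∷ []) ++ S ∷ []) (trans (state-++ c P (ε ∷ []))
          (cong (λ w → c₁ ++ (S ∷ w)) (++-identityʳ (uw ε))))) (trans (++-assoc (c₁ ++ (S ∷ uw ε)) (S ∷ []) (S ∷ [])) (++-assoc c₁ (S ∷ uw ε) _))))
        (∼-trans (∼-++ˡ c₁ (∼-cons S (∼-trans (∼-++ˡ (uw ε) ∼-SS) (∼-reflexive (++-identityʳ (uw ε))))))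
          (∼-reflexive (sym (++-assoc c₁ (S ∷ []) (uw ε))))))
      ∼-refl (same-++ (S ∷ []) r)
    to-U : ∀ ε → Loop v (uw ε) → Loop v (U ∷ [])
    to-U ℓ l = l
    to-U ʳ l = loop-∼ ∼-UUU (loop-++ l l)
    loopU : Loop v (U ∷ [])
    loopU = to-U ε loopε
    build : (∃ λ X' → ∃ λ ε' → ∃ λ Y' → post ≡ X' ++ ε' ∷ Y' × Same ((next c₁ ε ++ W X') ++ S ∷ []) v) → Reduction (P ++ (ε ∷ Q))
    build (X' , ε' , Y' , eq , hit) = record
      { c = v ; G = uw ε ; H = X ; K = proj₁ leading ; e = Z ; t = W P ++ (S ∷ [])
      ; loop-G = loopε ; loop-H = loopX
      ; nz-K = nz-∼ K₀∼ (nz-commW loopε loopX (nz-∼ (∼-trans based (commW-swap (uw ε) X _)) (nz-rotate (S ∷ []) (uw ε ++ W post) z₁)))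
      ; fewer = fewer
      ; factor = ∼-trans (rotate-W P (ε ∷ Q)) (∼-trans (cj-cong (W P) (rotate (S ∷ []) (uw ε ++ W post))) (∼-trans (cj-cj (W P) (S ∷ []) _)
          (cj-cong (W P ++ S ∷ []) (∼-trans based (∼-trans (commW-swap (uw ε) X _) (∼-++ˡ (commW (uw ε) X) K₀∼))))))
      }
      where
      X = W X' ++ S ∷ []
      Y = W Y' ++ S ∷ []
      r' = uw ε ++ (uw ε' ++ W Y')
      Z = W X' ++ (S ∷ r')
      based : (uw ε ++ W post) ++ S ∷ [] ∼ uw ε ++ (X ++ (uw ε' ++ Y))
      based = ∼-reflexive (trans (++-assoc (uw ε) (W post) (S ∷ [])) (cong (uw ε ++_)
        (trans (cong (_++ S ∷ []) (trans (cong W eq) (W-++ X' (ε' ∷ Y')))) (trans (++-assoc (W X') _ (S ∷ []))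
          (trans (cong (λ w → W X' ++ (S ∷ w)) (++-assoc (uw ε') (W Y') (S ∷ []))) (sym (++-assoc (W X') (S ∷ []) _)))))))
      loopX : Loop v X
      loopX = loop-cancel loopε (same-∼ (∼-reflexive (trans (++-assoc (next c₁ ε) (W X') (S ∷ []))
        (trans (next-++ c₁ ε X) (sym (++-assoc c₁ (S ∷ []) (uw ε ++ X)))))) ∼-refl hit)
      leading : ∃ λ Z' → Z ≡ S ∷ Z'
      leading = leading-S X' r'
      K₀∼ : X ++ (uw ε ++ (uw ε' ++ Y)) ∼ cj Z (proj₁ leading)
      K₀∼ = ∼-trans (∼-reflexive (trans (++-assoc (W X') (S ∷ []) _) (sym (trans (++-assoc (W X') (S ∷ r') (S ∷ []))
          (cong (λ w → W X' ++ (S ∷ w)) (trans (++-assoc (uw ε) _ (S ∷ [])) (cong (uw ε ++_) (++-assoc (uw ε') (W Y') (S ∷ [])))))))))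
        (∼-trans (rotate Z (S ∷ [])) (cj-cong Z (∼-trans (∼-reflexive (cong (S ∷_) (proj₂ leading))) ∼-SS)))
      count : suc (#S (proj₁ leading)) ≡ length X' ℕ.+ suc (length Y')
      count = trans (cong #S (sym (proj₂ leading))) (trans (#S-++ (W X') (S ∷ r')) (cong₂ (λ i j → i ℕ.+ suc j) (#S-W X')
        (trans (#S-++ (uw ε) _) (cong₂ ℕ._+_ (#S-uw ε) (trans (#S-++ (uw ε') (W Y')) (cong₂ ℕ._+_ (#S-uw ε') (#S-W Y')))))))
      total : length (P ++ (ε ∷ Q)) ≡ suc (length X' ℕ.+ suc (length Y'))
      total = trans (length-++ P) (trans (ℕₚ.+-suc (length P) (length Q)) (cong suc (trans (ℕₚ.+-comm (length P) (length Q))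
        (trans (sym (length-++ Q)) (trans (cong length eq) (length-++ X'))))))
      fewer : #S (proj₁ leading) ℕ.< length (P ++ (ε ∷ Q))
      fewer = subst (#S (proj₁ leading) ℕ.<_) (sym total) (ℕₚ.m≤n⇒m≤1+n (ℕₚ.≤-reflexive count))

  reduction : ∀ c ε es → length (ε ∷ es) ℕ.≤ suc n → NZ c (W (ε ∷ es)) → Reduction (ε ∷ es)
  reduction c ε es len z with crossing c ε es len z
  ... | linked P t₁ A t₂ B t₃ C t₄ D eq r₁ r₂ = subst Reduction (sym eq)
    (linked-reduction c P t₁ A t₂ B t₃ C t₄ D (subst (λ es → NZ c (W es)) eq z) r₁ r₂)
  ... | backtrack P ε' Q eq r = subst Reduction (sym eq) (backtrack-reduction c P ε' Q (subst (λ es → NZ c (W es)) eq z) r)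

  abelianisation : ∀ c z → NZ c (uz z) → z ≡ z0
  abelianisation c z0 _ = refl
  abelianisation c z1 z = ⊥-elim (not-divisible ⅓M (s≤s z≤n) (multiple< 2 (s≤s (s≤s (s≤s z≤n))))
    (subst (λ i → i ≡ᴹ 0ℤ) (poly (+ ⅓M)) (NZ.null z constant-valid constant-invariant)))
    where
    poly : ∀ h → h * 1ℤ + 0ℤ ≡ h
    poly = solve-∀
  abelianisation c z2 z = ⊥-elim (not-divisible (⅓M ℕ.+ ⅓M) (s≤s z≤n)
    (subst (ℕ._< M) (four (suc n)) (multiple< 4 (s≤s (s≤s (s≤s (s≤s (s≤s z≤n)))))))
    (subst (λ i → i ≡ᴹ 0ℤ) (poly (+ ⅓M)) (NZ.null z constant-valid constant-invariant)))
    where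
    four : ∀ n → 4 ℕ.* n ≡ 2 ℕ.* n ℕ.+ 2 ℕ.* n
    four = ℕ-Solver.solve-∀
    poly : ∀ h → h * 1ℤ + (h * 1ℤ + 0ℤ) ≡ h + h
    poly = solve-∀

  S-not-null : ∀ c → ¬ NZ c (S ∷ [])
  S-not-null c z = not-divisible ½M (s≤s z≤n) (multiple< 3 (s≤s (s≤s (s≤s (s≤s z≤n)))))
    (subst (λ i → i ≡ᴹ 0ℤ) (poly (+ ½M)) (NZ.null z constant-valid constant-invariant))
    where
    poly : ∀ h → h * 1ℤ + 0ℤ ≡ h
    poly = solve-∀

  module _ (xy : + q ∣ + 2 - tr (ρ (commW x y)))
           (short : ∀ ε es → length es ℕ.< n → ¬ (+ q ∣ + 2 - tr (ρ (W (ε ∷ es))))) where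

    loops-trace : ∀ {c G H} → Loop c G → Loop c H → + q ∣ + 2 - tr (ρ (commW G H))
    loops-trace {c} {G} {H} p r = subst (λ t → + q ∣ + 2 - t)
      (trans (cong tr (ρ-∼ (∼-sym (cj-commW c G H)))) (tr-conj c (commW G H)))
      (commutator-trace (+ q) x y (cj c G) (cj c H) xy (loop-InB p) (loop-InB r))

    -- The remainder `K` is null-homologous. The weight `constant` excludes `S` and the nontrivial
    -- powers of `U`, and `shorter` excludes a hyperbolic word, so `K` is trivial and the path is a
    -- conjugate of the commutator of two loops. Its trace is then 2 modulo `q`, and `short` yields
    -- the lower bound on its length.
    finish : ∀ ε es → Reduction (ε ∷ es) →
      (∀ c ε' es' → length es' ℕ.< length es → ¬ NZ c (W (ε' ∷ es'))) → n ℕ.≤ length es × IsCommW (W (ε ∷ es))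
    finish ε es red shorter = go (cyclic K)
      where
      open Reduction red
      nzK : NZ (c ++ e) K
      nzK = nz-cj e K nz-K
      transport : ∀ c' {w} → K ∼ cj c' w → NZ ((c ++ e) ++ c') w
      transport c' {w} p = nz-cj c' w (nz-∼ p nzK)
      conclude : K ∼ [] → n ℕ.≤ length es × IsCommW (W (ε ∷ es))
      conclude p = ℕₚ.≮⇒≥ (λ lt → short ε es lt (subst (λ i → + q ∣ + 2 - i)
              (trans (sym (tr-conj t (commW G H))) (cong tr (ρ-∼ (∼-sym conj)))) (loops-trace loop-G loop-H)))
            , commutator-cong conj (commutator-cj t (G , H , ∼-refl))
        where
        conj : W (ε ∷ es) ∼ cj t (commW G H)
        conj = ∼-trans factor (cj-cong t (∼-trans (∼-++ˡ (commW G H) (∼-trans (cj-cong e p) (winv-inverseʳ e)))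
          (∼-reflexive (++-identityʳ (commW G H)))))
      go : CyclicForm K (#S K) → n ℕ.≤ length es × IsCommW (W (ε ∷ es))
      go (power-of-U c' z p) = conclude (∼-trans p (∼-trans (∼-reflexive (cong (λ z → cj c' (uz z)) (abelianisation ((c ++ e) ++ c') z (transport c' p)))) (winv-inverseʳ c')))
      go (just-S c' p) = ⊥-elim (S-not-null ((c ++ e) ++ c') (transport c' p))
      go (hyperbolic c' ε' es' p le) = ⊥-elim (shorter ((c ++ e) ++ c') ε' es' (ℕₚ.≤-pred (ℕₚ.≤-trans (s≤s le) fewer)) (transport c' p))

    -- The two conclusions are proved together because the induction runs on the first: for a path
    -- shorter than `es`, hence shorter than `n`, the lower bound is absurd, so no such
    -- null-homologous path exists.
    core : ∀ c ε es → Acc ℕ._<_ (length es) → length es ℕ.≤ n → NZ c (W (ε ∷ es)) → n ℕ.≤ length es × IsCommW (W (ε ∷ es))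
    core c ε es (acc rs) len z = finish ε es (reduction c ε es (s≤s len) z)
      (λ c' ε' es' lt z' → ℕₚ.<⇒≱ (ℕₚ.<-≤-trans lt len) (proj₁ (core c' ε' es' (rs lt) (ℕₚ.≤-trans (ℕₚ.<⇒≤ lt) len) z')))

-- The finite quotient that detects commutators.

module FromQuotient (a : ℤ) (q : ℕ) .{{_ : NonZero q}} (n : ℕ) (x y : Word) where

  open Rep a
  open Core a q n x y
  open Weighted a q M
  open Mod (+ q) using (≋-sym; tr-≋; ≡ᵐ-∣; ≡ᵐ-+; ≡ᵐ-neg; ≡ᵐ-refl; ≡ᵐ-sym)
  open Mod (+ M) using () renaming (≡ᵐ-trans to ≡ᴹ-trans)
  open Mod.Algebra (+ q) (ρ x) (ρ y)

  loop-x : Loop [] x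
  loop-x = same (InB-≡ (cong ρ (++-identityʳ x)) InB-x)

  loop-y : Loop [] y
  loop-y = same (InB-≡ (cong ρ (++-identityʳ y)) InB-y)

  -- `x` and `y` belong to L, so their commutator is a loop at the trivial coset of weight 0, and
  -- the congruence transfers both properties to `D`.
  nz-start : ∀ {D} → D ≐ commW x y → NZ [] D
  nz-start {D} p = nz
    (same (InB-≡ (cong ρ (++-identityʳ D)) (InB-≋ (≋-sym (same-ρ p)) (InB-≡ (sym (cong ρ (++-identityʳ (commW x y)))) (Same.inB (loop-commW loop-x loop-y))))))
    (λ valid inv → ≡ᴹ-trans (same-wt p valid) (wt-commW valid inv loop-x loop-y))

  trace-start : ∀ {D} → D ≐ commW x y → + q ∣ + 2 - tr (ρ D) → + q ∣ + 2 - tr (ρ (commW x y))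
  trace-start p d = ≡ᵐ-∣ (≡ᵐ-+ (≡ᵐ-refl (+ 2)) (≡ᵐ-neg (≡ᵐ-sym (tr-≋ (same-ρ p))))) d

record Quotient : Set where
  field
    a : ℤ
    q : ℕ
    {{q≢0}} : NonZero q
    n : ℕ

  M : ℕ
  M = 6 ℕ.* suc n

  open Weighted a q M using (_≐_; N-PSL; N-SL)

  Congruent : Word → Word → Set
  Congruent = _≐_

  kernel-PSL : Profinite.FINormal PSL₂ℤ
  kernel-PSL = N-PSL

  kernel-SL : Profinite.FINormal SL₂ℤ
  kernel-SL = N-SL

detecting : ∀ D → ∃ λ (Q : Quotient) → ∀ x y → Quotient.Congruent Q D (commW x y) → IsCommW D
detecting D with cyclic D
-- For a torsion element the abelianisation decides, so `q = 1` makes all matrices congruent and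
-- `n = 0` leaves weights modulo 6.
... | power-of-U c z p = record { a = 0ℤ ; q = 1 ; n = 0 } , λ x y r →
  let open FromQuotient 0ℤ 1 0 x y
      open Core 0ℤ 1 0 x y
      open Descent 0ℤ 1 0 x y
  in [] , [] , ∼-trans p (∼-trans (∼-reflexive (cong (λ z → cj c (uz z)) (abelianisation c z (nz-cj c (uz z) (nz-∼ p (nz-start r)))))) (winv-inverseʳ c))
... | just-S c p = record { a = 0ℤ ; q = 1 ; n = 0 } , λ x y r →
  let open FromQuotient 0ℤ 1 0 x y
      open Core 0ℤ 1 0 x y
      open Descent 0ℤ 1 0 x y
  in ⊥-elim (S-not-null c (nz-cj c (S ∷ []) (nz-∼ p (nz-start r))))
-- `n` counts the turns after the first. So `core` is entered at its upper limit, where the bound on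
-- the length says nothing new and the commutator is the information gained.
... | hyperbolic c ε es p _ = record { a = + suc b ; q = modulus (ε ∷ es) ; n = length es } , detect
  where
  b : ℕ
  b = 6 ℕ.^ suc (length es)
  6≤b : 6 ℕ.≤ b
  6≤b = ℕₚ.m≤m*n 6 (6 ℕ.^ length es) {{ℕₚ.m^n≢0 6 (length es)}}
  3≤b : 3 ℕ.≤ b
  3≤b = ℕₚ.≤-trans (s≤s (s≤s (s≤s z≤n))) 6≤b
  open Growth b 3≤b
  open Rep (+ suc b)
  instance
    modulus≢0 : NonZero (modulus (ε ∷ es))
    modulus≢0 = modulus-nonZero ε es 6≤b
  detect : ∀ x y → Weighted._≐_ (+ suc b) (modulus (ε ∷ es)) (6 ℕ.* suc (length es)) D (commW x y) → IsCommW D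
  detect x y r = commutator-cong p (commutator-cj c (proj₂
    (core (trace-start r (subst (λ t → + modulus (ε ∷ es) ∣ + 2 - t) (sym trace) ∣m∣∣m))
      (λ ε' es' lt → short-trace ε es ε' es' refl lt) c ε es (<-wellFounded _) ℕₚ.≤-refl
      (nz-cj c (W (ε ∷ es)) (nz-∼ p (nz-start r))))))
    where
    open FromQuotient (+ suc b) (modulus (ε ∷ es)) (length es) x y
    open Core (+ suc b) (modulus (ε ∷ es)) (length es) x y
    open Descent (+ suc b) (modulus (ε ∷ es)) (length es) x y
    trace : tr (ρ D) ≡ tr (ρ (W (ε ∷ es)))
    trace = trans (cong tr (ρ-∼ p)) (tr-conj c (W (ε ∷ es)))

-- From words back to matrices, and the case of PSL₂(ℤ).

⁅_,_⁆ : SL2 → SL2 → SL2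
⁅ x , y ⁆ = ((x · y) · inv x) · inv y

wd-commutator : ∀ x y → wd ⁅ x , y ⁆ ∼ commW (wd x) (wd y)
wd-commutator x y = ∼-trans (false , R-wd-· ((x · y) · inv x) (inv y)) (∼-trans
  (∼-++ (∼-trans (false , R-wd-· (x · y) (inv x)) (∼-++ (false , R-wd-· x y) (∼-wd-inv x))) (∼-wd-inv y))
  (∼-trans (∼-assoc (wd x ++ wd y) (winv (wd x)) (winv (wd y))) (∼-assoc (wd x) (wd y) (winv (wd x) ++ winv (wd y)))))

module _ (Q : Quotient) where

  open Quotient Q
  open Weighted a q M

  congruent-commutator : ∀ d x y → wd (inv d · ⁅ x , y ⁆) ≐ [] → wd d ≐ commW (wd x) (wd y)
  congruent-commutator d x y p = ≐-sym (≐-trans (≐-∼ (∼-sym (winv-cancelʳ (wd d) (commW (wd x) (wd y)))))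
    (≐-trans (≐-++ (≐-refl {wd d}) (≐-trans (≐-++ (≐-sym (≐-wd-inv d)) (≐-∼ (∼-sym (wd-commutator x y))))
      (≐-trans (≐-sym (≐-wd-· (inv d) ⁅ x , y ⁆)) p))) (≐-∼ (∼-reflexive (++-identityʳ (wd d))))))

  -- Stated for operations that are only propositionally those of SL2, so that the products below are compared
  -- syntactically and never expanded into polynomials in the entries.
  congruent-commutator′ : ∀ {_∙_ : SL2 → SL2 → SL2} {_⁻¹ : SL2 → SL2} → _∙_ ≡ _·_ → _⁻¹ ≡ inv → ∀ d x y →
    wd ((d ⁻¹) ∙ (((x ∙ y) ∙ (x ⁻¹)) ∙ (y ⁻¹))) ≐ [] → wd d ≐ commW (wd x) (wd y)
  congruent-commutator′ refl refl = congruent-commutator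

lift-commutator : ∀ d → IsCommW (wd d) → ∃ λ X → ∃ λ Y → d ≈PSL ⁅ X , Y ⁆
lift-commutator d (u , v , p) = toSL u , toSL v , R-PSL {proj₁ related} {d} {⁅ toSL u , toSL v ⁆} (proj₂ related)
  where
  related : wd d ∼ wd ⁅ toSL u , toSL v ⁆
  related = ∼-trans p (∼-sym (∼-trans (wd-commutator (toSL u) (toSL v))
    (commW-cong (false , R-wd-toSL u) (false , R-wd-toSL v))))

lift-commutator′ : ∀ {_∙_ : SL2 → SL2 → SL2} {_⁻¹ : SL2 → SL2} → _∙_ ≡ _·_ → _⁻¹ ≡ inv → ∀ d → IsCommW (wd d) →
  ∃ λ X → ∃ λ Y → d ≈PSL (((X ∙ Y) ∙ (X ⁻¹)) ∙ (Y ⁻¹))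
lift-commutator′ refl refl = lift-commutator

PSL-case : ∀ d → Profinite.IsCommutatorĜ PSL₂ℤ d → Profinite.IsCommutator PSL₂ℤ d
PSL-case d (x , y , h) = lift-commutator′ {Group._∙_ PSL₂ℤ} {Group._⁻¹ PSL₂ℤ} refl refl d
  (proj₂ (detecting (wd d)) (wd x₀) (wd y₀)
    (congruent-commutator′ Q {Group._∙_ PSL₂ℤ} {Group._⁻¹ PSL₂ℤ} refl refl (Profinite.at (Profinite.ι PSL₂ℤ d) N) x₀ y₀ (h N)))
  where
  Q = proj₁ (detecting (wd d))
  N : Profinite.FINormal PSL₂ℤ
  N = Quotient.kernel-PSL Q
  x₀ = Profinite.at x N
  y₀ = Profinite.at y N

-- The sign, and the case of SL₂(ℤ).

χ̂ : SL2 → ℤ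
χ̂ g = χ (wd g)

open Mod4 using (_≡ᵐ_; difference; ≡ᵐ-reflexive; ≡ᵐ-refl; ≡ᵐ-sym; ≡ᵐ-trans; ≡ᵐ-+; ≡ᵐ-neg)

χ̂-· : ∀ g h → χ̂ (g · h) ≡ᵐ χ̂ g + χ̂ h
χ̂-· g h = ≡ᵐ-trans (χ-R₀ (R-wd-· g h)) (≡ᵐ-reflexive (χ-++ (wd g) (wd h)))

χ̂-inv : ∀ g → χ̂ (inv g) + χ̂ g ≡ᵐ 0ℤ
χ̂-inv g = ≡ᵐ-trans (≡ᵐ-reflexive (sym (χ-++ (wd (inv g)) (wd g)))) (χ-R₀ (R-wd-inverseˡ g))

χ̂-commutator : ∀ x y → χ̂ ⁅ x , y ⁆ ≡ᵐ 0ℤ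
χ̂-commutator x y = ≡ᵐ-trans (χ̂-· ((x · y) · inv x) (inv y)) (≡ᵐ-trans
  (≡ᵐ-+ (≡ᵐ-trans (χ̂-· (x · y) (inv x)) (≡ᵐ-+ (χ̂-· x y) (≡ᵐ-refl (χ̂ (inv x))))) (≡ᵐ-refl (χ̂ (inv y))))
  (≡ᵐ-trans (≡ᵐ-reflexive (regroup (χ̂ x) (χ̂ y) (χ̂ (inv x)) (χ̂ (inv y)))) (≡ᵐ-+ (χ̂-inv x) (χ̂-inv y))))
  where
  regroup : ∀ a b c d → a + b + c + d ≡ (c + a) + (d + b)
  regroup = solve-∀

χ̂-quotient : ∀ d k → χ̂ (inv d · k) ≡ᵐ 0ℤ → χ̂ k ≡ᵐ 0ℤ → χ̂ d ≡ᵐ 0ℤ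
χ̂-quotient d k p r = ≡ᵐ-trans (≡ᵐ-reflexive (regroup (χ̂ d) (χ̂ (inv d)) (χ̂ k))) (≡ᵐ-trans
  (≡ᵐ-+ (≡ᵐ-+ (χ̂-inv d) r) (≡ᵐ-neg (≡ᵐ-trans (≡ᵐ-sym (χ̂-· (inv d) k)) p))) (≡ᵐ-reflexive refl))
  where
  regroup : ∀ a b c → a ≡ (b + a) + c + - (b + c)
  regroup = solve-∀

two≢0 : ¬ (+ 2 ≡ᵐ 0ℤ)
two≢0 p with ∣⇒≤ (∣⇒∣ᵤ (difference p))
... | s≤s (s≤s ())

-- If `d` were the negative of the commutator found in PSL₂(ℤ), its character would be 2 modulo 4
-- and not 0.
lift-commutator-SL : ∀ d → χ̂ d ≡ᵐ 0ℤ → IsCommW (wd d) → ∃ λ X → ∃ λ Y → d ≈SL ⁅ X , Y ⁆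
lift-commutator-SL d χ̂d p = sign (lift-commutator d p)
  where
  sign : (∃ λ X → ∃ λ Y → d ≈PSL ⁅ X , Y ⁆) → ∃ λ X → ∃ λ Y → d ≈SL ⁅ X , Y ⁆
  sign (X , Y , inj₁ eq) = X , Y , eq
  sign (X , Y , inj₂ eq) = ⊥-elim (two≢0 (≡ᵐ-trans (≡ᵐ-sym (≡ᵐ-trans flipped (≡ᵐ-+ (χ̂-commutator X Y) (≡ᵐ-refl (+ 2))))) χ̂d))
    where
    flipped : χ̂ d ≡ᵐ χ̂ ⁅ X , Y ⁆ + + 2
    flipped = χ-R (R-complete (wd d) (wd ⁅ X , Y ⁆) true (trans (mt-wd d) (trans eq (cong neg (sym (mt-wd ⁅ X , Y ⁆))))))

lift-commutator-SL′ : ∀ {_∙_ : SL2 → SL2 → SL2} {_⁻¹ : SL2 → SL2} → _∙_ ≡ _·_ → _⁻¹ ≡ inv → ∀ d → χ̂ d ≡ᵐ 0ℤ → IsCommW (wd d) →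
  ∃ λ X → ∃ λ Y → d ≈SL (((X ∙ Y) ∙ (X ⁻¹)) ∙ (Y ⁻¹))
lift-commutator-SL′ refl refl = lift-commutator-SL

χ̂-null : ∀ {_∙_ : SL2 → SL2 → SL2} {_⁻¹ : SL2 → SL2} → _∙_ ≡ _·_ → _⁻¹ ≡ inv → ∀ d x y →
  χ (wd ((d ⁻¹) ∙ (((x ∙ y) ∙ (x ⁻¹)) ∙ (y ⁻¹)))) ≡ᵐ 0ℤ → χ̂ d ≡ᵐ 0ℤ
χ̂-null refl refl d x y p = χ̂-quotient d ⁅ x , y ⁆ p (χ̂-commutator x y)

SL-case : ∀ d → Profinite.IsCommutatorĜ SL₂ℤ d → Profinite.IsCommutator SL₂ℤ d
SL-case d (x , y , h) = lift-commutator-SL′ {Group._∙_ SL₂ℤ} {Group._⁻¹ SL₂ℤ} refl refl d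
  (χ̂-null {Group._∙_ SL₂ℤ} {Group._⁻¹ SL₂ℤ} refl refl (Profinite.at (Profinite.ι SL₂ℤ d) N) x₀ y₀ (proj₂ (h N)))
  (proj₂ (detecting (wd d)) (wd x₀) (wd y₀)
    (congruent-commutator′ Q {Group._∙_ SL₂ℤ} {Group._⁻¹ SL₂ℤ} refl refl (Profinite.at (Profinite.ι SL₂ℤ d) N) x₀ y₀ (proj₁ (h N))))
  where
  Q = proj₁ (detecting (wd d))
  N : Profinite.FINormal SL₂ℤ
  N = Quotient.kernel-SL Q
  x₀ = Profinite.at x N
  y₀ = Profinite.at y N

theorem2p4 : ((d : Group.Carrier SL₂ℤ) → Profinite.IsCommutatorĜ SL₂ℤ d → Profinite.IsCommutator SL₂ℤ d)
    × ((d : Group.Carrier PSL₂ℤ) → Profinite.IsCommutatorĜ PSL₂ℤ d → Profinite.IsCommutator PSL₂ℤ d)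
theorem2p4 = SL-case , PSL-case
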